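{- The following decision problem is in $\mathrm{PTIME}$: given a one-player generalized reachability game $\mathcal{G} = (\mathcal{A}, \mathrm{GenReach}(F_1,\ldots,F_k))$ (i.e. all vertices of the arena are controlled by Eve) in which every reachability set $F_i$ ($1\le i\le k$) has size two, and a starting vertex $v_0$, decide whether Eve wins from $v_0$.
   Context: An arena $\mathcal{A} = (V,(V_\circ,V_\Box),E)$ consists of a finite directed graph $(V,E)$, in which every vertex has at least one outgoing edge, and a partition $(V_\circ,V_\Box)$ of $V$ (one part may be empty): vertices in $V_\circ$ are controlled by Eve, vertices in $V_\Box$ by Adam. A play is an infinite path $\pi = v_0,v_1,v_2,\ldots$ in the graph. From a starting vertex $v_0$, at each step the player controlling the current vertex chooses an outgoing edge, and the play moves along it. A strategy for Eve is a function $\sigma : V^*\cdot V_\circ \to V$ with $(v,\sigma(w\cdot v))\in E$ for all $w \in V^*$, $v \in V_\circ$; strategies $\tau$ for Adam are defined similarly with $V_\Box$. A starting vertex $v_0$ and strategies $\sigma,\tau$ determine a unique play $\pi(v_0,\sigma,\tau)$. A game is a pair $(\mathcal{A},\Phi)$ with $\Phi$ a set of plays; Eve wins a play iff it belongs to $\Phi$. Eve wins from $v_0$ if she has a strategy $\sigma$ such that for every strategy $\tau$ of Adam, $\pi(v_0,\sigma,\tau)\in\Phi$. The game is one-player if $V_\Box=\emptyset$. Given subsets $F_1,\ldots,F_k \subseteq V$ (reachability sets), the generalized reachability objective is $$\mathrm{GenReach}(F_1,\ldots,F_k) = \{ v_0,v_1,v_2,\ldots \mid \forall i\in\{1,\ldots,k\},\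 \exists p_i\in\mathbb{N},\ v_{p_i}\in F_i\}.$$ A generalized reachability game is a game of the form $(\mathcal{A},\mathrm{GenReach}(F_1,\ldots,F_k))$. The input is the explicitly given finite graph, partition, sets $F_1,\ldots,F_k$ and starting vertex; $k$ is part of the input. -}

module Defs where

open import Data.Bool.Base using (Bool; true; false)
open import Data.Fin.Base using (Fin)
open import Data.Fin.Subset using (Subset; _∈_; ∁; ⁅_⁆; ∣_∣; Nonempty; Empty)
open import Data.Fin.Subset.Properties using (_∈?_; x∉p⇒x∈∁p)
open import Data.List.Base using (List; []; _∷_; _++_; _∷ʳ_; concatMap; length; map)
open import Data.Maybe.Base using (Maybe; just; nothing)
open import Data.Nat.Base using (ℕ; zero; suc; _+_; _*_; _^_)
open import Data.Product.Base using (Σ-syntax; ∃-syntax; _×_; _,_; proj₁; proj₂)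
open import Data.Vec.Base as Vec using (Vec; lookup; toList)
open import Function.Bundles using (_↔_)
open import Function.Definitions using (Injective)
open import Relation.Binary.PropositionalEquality using (_≡_; _≢_)
open import Relation.Nullary using (yes; no; Reflects)

------------------------------------------------------------------------
-- Games on finite graphs

-- E lists the set of successors of each vertex.
record Arena : Set where
  field
    size  : ℕ
    V○    : Subset size
    E     : Vec (Subset size) size
    total : ∀ v → Nonempty (lookup E v)

  V : Set
  V = Fin size

  V□ : Subset size
  V□ = ∁ V○

  Edge : V → V → Set
  Edge u v = v ∈ lookup E u

module _ (A : Arena) where
  open Arena A

  record Play : Set where
    field
      vertex : ℕ → V
      edge   : ∀ i → Edge (vertex i) (vertex (suc i))

  -- Strategies of the player controlling the vertices in P.  The list is
  -- the history, in chronological order, before the current vertex.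
  record Strategy (P : Subset size) : Set where
    field
      move  : List V → (v : V) → v ∈ P → V
      legal : ∀ w v (v∈P : v ∈ P) → Edge v (move w v v∈P)

  module _ (v₀ : V) (σ : Strategy V○) (τ : Strategy V□) where

    next : (w : List V) (v : V) → Σ[ v′ ∈ V ] Edge v v′
    next w v with v ∈? V○
    ... | yes v∈V○ = Strategy.move σ w v v∈V○ , Strategy.legal σ w v v∈V○
    ... | no  v∉V○ = Strategy.move τ w v v∈V□ , Strategy.legal τ w v v∈V□
      where v∈V□ = x∉p⇒x∈∁p v∉V○

    history : ℕ → List V
    current : ℕ → V
    history zero    = []
    history (suc i) = history i ∷ʳ current i
    current zero    = v₀
    current (suc i) = proj₁ (next (history i) (current i))

    outcome : Play
    outcome = record
      { vertex = current
      ; edge   = λ i → proj₂ (next (history i) (current i))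
      }

  EveWins : (Play → Set) → V → Set
  EveWins Φ v₀ = Σ[ σ ∈ Strategy V○ ] (∀ (τ : Strategy V□) → Φ (outcome v₀ σ τ))

  OnePlayer : Set
  OnePlayer = Empty V□

  GenReach : ∀ {k} → Vec (Subset size) k → Play → Set
  GenReach F π = ∀ i → ∃[ p ] Play.vertex π p ∈ lookup F i

------------------------------------------------------------------------
-- Deterministic multi-tape Turing machines and polynomial time

Finite : Set → Set
Finite A = ∃[ n ] (A ↔ Fin n)

data Direction : Set where
  left stay right : Direction

-- A two-way infinite tape: the scanned cell and the cells on either side
-- of it, nearest first; all cells not listed are blank.
record Tape (Γ : Set) : Set where
  constructor tape
  field
    before : List Γ
    head   : Γ
    after  : List Γ

module _ {Γ : Set} (blank : Γ) where

  load : List Γ → Tape Γ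
  load []       = tape [] blank []
  load (x ∷ xs) = tape [] x xs

  shift : Direction → Tape Γ → Tape Γ
  shift left  (tape []       x rs)       = tape [] blank (x ∷ rs)
  shift left  (tape (l ∷ ls) x rs)       = tape ls l (x ∷ rs)
  shift stay  t                          = t
  shift right (tape ls       x [])       = tape (x ∷ ls) blank []
  shift right (tape ls       x (r ∷ rs)) = tape (x ∷ ls) r rs

  writeAndShift : Γ × Direction → Tape Γ → Tape Γ
  writeAndShift (y , d) (tape ls _ rs) = shift d (tape ls y rs)

-- A state q with verdict q ≡ just b is halting, accepting if b is true and
-- rejecting if b is false; δ is never consulted there.
record TuringMachine (I : Set) : Set₁ where
  field
    Γ               : Set
    Γ-finite        : Finite Γ
    blank           : Γ
    input           : I → Γ
    input-injective : Injective _≡_ _≡_ input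
    input≢blank     : ∀ a → input a ≢ blank
    Q               : Set
    Q-finite        : Finite Q
    start           : Q
    verdict         : Q → Maybe Bool
    workTapes       : ℕ
    δ               : Q → Vec Γ (suc workTapes) →
                      Q × Vec (Γ × Direction) (suc workTapes)

module _ {I : Set} (M : TuringMachine I) where
  open TuringMachine M

  record Configuration : Set where
    constructor config
    field
      state : Q
      tapes : Vec (Tape Γ) (suc workTapes)

  initial : List I → Configuration
  initial w = config start
    (load blank (map input w) Vec.∷ Vec.replicate workTapes (load blank []))

  step : Configuration → Configuration
  step (config q ts) with verdict q
  ... | just _  = config q ts
  ... | nothing =
    let q′ , actions = δ q (Vec.map Tape.head ts)
    in  config q′ (Vec.zipWith (writeAndShift blank) actions ts)

  run : ℕ → Configuration → Configuration
  run zero    c = c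
  run (suc t) c = run t (step c)

-- Halting configurations are fixed by step, so the machine below halts
-- within the stated number of steps.
PTIME : {I : Set} → (List I → Set) → Set₁
PTIME {I} L =
  Σ[ M ∈ TuringMachine I ] ∃[ c ] ∃[ d ] ∀ (w : List I) →
    let final = run M (c * length w ^ d + c) (initial M w) in
    ∃[ b ] TuringMachine.verdict M (Configuration.state final) ≡ just b
         × Reflects (L w) b

------------------------------------------------------------------------
-- Generalized reachability games as inputs

record Instance : Set where
  field
    arena : Arena
  open Arena arena public
  field
    k  : ℕ
    F  : Vec (Subset size) k
    v₀ : V

data Symbol : Set where
  𝟎 𝟏 ♯ : Symbol

bit : Bool → Symbol
bit false = 𝟎
bit true  = 𝟏

-- A set of vertices is written as its characteristic vector, closed by ♯.
encodeSubset : ∀ {n} → Subset n → List Symbol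
encodeSubset p = map bit (toList p) ++ ♯ ∷ []

encodeSubsets : ∀ {n m} → Vec (Subset n) m → List Symbol
encodeSubsets ps = concatMap encodeSubset (toList ps)

-- V○, the adjacency matrix, the starting vertex, the reachability sets.
-- All blocks have length size and the matrix has size rows, so the number
-- of reachability sets can be read off.
encode : Instance → List Symbol
encode G =
  encodeSubset V○ ++ encodeSubsets E ++ encodeSubset ⁅ v₀ ⁆ ++ encodeSubsets F
  where open Instance G

OnePlayerGenReachSizeTwo : List Symbol → Set
OnePlayerGenReachSizeTwo w =
  Σ[ G ∈ Instance ] let open Instance G in
    w ≡ encode G
  × OnePlayer arena
  × (∀ i → ∣ lookup F i ∣ ≡ 2)
  × EveWins arena (GenReach arena F) v₀

-- In a one-player game Eve visits a set S of vertices on one path from v₀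
-- exactly when the members of S are reachable from v₀ and pairwise comparable
-- for reachability.  So she has to pick one element of each pair F i such
-- that the picks are pairwise compatible in this sense, an instance of 2-SAT.
-- Picking u forces v when some w is incompatible with u and {w , v} is one of
-- the pairs; Eve wins if and only if no pair {x , y} is such that both x and y
-- force, in several steps, a vertex incompatible with themselves.
--
-- Both the well-formedness of the input and this criterion are expressed by a
-- formula of first-order logic with inductive fixpoints of sets, quantifiers
-- being bounded by polynomials in the length of the input.  A formula is
-- evaluated by a structured program, with one tape per bound variable, whose
-- head position is the value of the variable, or per set, whose entries are
-- its characteristic function; a program is run by a Turing machine whose
-- states are its control points.

module Submission where

open import Defs
open import Data.Bool.Base using (Bool; true; false; if_then_else_; not; T; _∧_; _∨_)
open import Data.Empty using (⊥; ⊥-elim)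
open import Data.Fin.Base as Fin
  using (Fin; zero; suc; toℕ; fromℕ<; join; splitAt; _↑ˡ_; _↑ʳ_)
open import Data.Fin.Patterns
open import Data.Fin.Properties as Fin
  using (any?; toℕ<n; toℕ-fromℕ<; toℕ-↑ˡ; toℕ-↑ʳ; splitAt-join; join-splitAt; splitAt⁻¹-↑ˡ; splitAt⁻¹-↑ʳ)
open import Data.Fin.Subset
  using (Subset; ∣_∣; _∈_; _∉_; _-_; Empty; Nonempty; inside; outside; ⁅_⁆)
open import Data.Fin.Subset.Properties
  using (∈⊤; ∣p∣≤n; ∣p∣≡n⇒p≡⊤; p⊂q⇒∣p∣<∣q∣; _∈?_; nonempty?; p─⊥≡p; p─q⊆p; x∉p⇒x∈∁p; x∈∁p⇒x∉p;
         x∈p∧x≢y⇒x∈p-y; Empty-unique; ∣⊥∣≡0; x∈⁅x⁆; x∈⁅y⁆⇒x≡y; ⊆-antisym)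
open import Data.List.Base using (List; []; _∷_; length; map; _++_; _ʳ++_; concatMap; allFin)
open import Data.List.Membership.Propositional using () renaming (_∈_ to _∈ₗ_)
open import Data.List.Membership.Propositional.Properties using (∈-allFin; ∈-map⁺)
open import Data.List.Properties using (length-map; length-++; concatMap-++)
open import Data.List.Relation.Unary.All as All using (All; []; _∷_)
import Data.List.Relation.Unary.All.Properties as All
open import Data.List.Relation.Unary.Any using (here; there)
open import Data.Maybe.Base using (Maybe; just; nothing)
open import Data.Maybe.Properties using (just-injective)
open import Data.Nat.Base hiding (∣_-_∣; _/_; _%_)
open import Data.Nat.DivMod using (_/_; _%_; m≡m%n+[m/n]*n; m%n<n; m<n*o⇒m/o<n)
open import Data.Nat.Properties
open import Data.Product.Base using (Σ-syntax; ∃-syntax; _×_; _,_; proj₁; proj₂; map₂)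
open import Data.Sum.Base using (_⊎_; inj₁; inj₂; [_,_]′; swap)
open import Data.Sum.Function.Propositional using (_⊎-↔_)
open import Data.Unit.Base using (⊤; tt)
open import Data.Vec.Base as Vec using (Vec; []; _∷_; here; there; lookup; tabulate; toList)
open import Data.Vec.Properties
  using (lookup∘tabulate; lookup⇒[]=; []=⇒lookup; toList-++; length-toList; lookup-++ˡ; lookup-++ʳ)
open import Function.Base using (_∘_; const; id)
open import Function.Bundles using (mk↔ₛ′)
open import Function.Construct.Composition using (_↔-∘_)
open import Relation.Binary.Construct.Closure.ReflexiveTransitive using (Star; ε; _◅_; _◅◅_)
open import Relation.Binary.Definitions using (tri<; tri≈; tri>)
open import Relation.Binary.PropositionalEquality
open import Relation.Nullary
  using (¬_; Dec; does; yes; no; ofʸ; ofⁿ; _because_; contradiction; Reflects; ¬?; _×-dec_; _⊎-dec_)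
open import Relation.Nullary.Decidable using (decidable-stable)
open import Relation.Nullary.Reflects using (_×-reflects_; ¬-reflects)

-- Programs and their machines

-- `PTIME` asks for a concrete Turing machine with an explicit time bound, and this shapes the
-- proof. Formulas keep machines and mathematics apart: one induction, `run-compile`, yields both
-- the right answer and a polynomial bound, and after it only the meaning of a single fixed formula
-- is left to discuss. Nothing is cached: reachability is computed anew in every test of
-- compatibility, and these tests are repeated inside the fixpoint of forcing. The cost stays
-- polynomial because the nesting depth of the formula does not depend on the input.
--
-- In the 2-SAT instance a vertex is a variable, a pair {x, y} is the clause "x or y", and
-- incompatibility of u and w is the clause "not u or not w". Every implication therefore changes
-- polarity: u implies not w, and not w implies v. Forcing composes two such implications, so that
-- negative literals disappear and the fixpoints range over vertices only.

Content : Set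
Content = Maybe Symbol

-- nothing marks the left end of a tape, which the programs never cross.
Cell : Set
Cell = Maybe Content

pattern ⊢ = nothing
pattern ␣ = just nothing

-- Recursion on both indices makes `upd f (suc i) x ∘ suc` reduce to `upd (f ∘ suc) i x`, as the
-- inductions over `prefix` require, and lets updates at numerals evaluate.
upd : ∀ {A : Set} → (ℕ → A) → ℕ → A → ℕ → A
upd f zero    x zero    = x
upd f zero    x (suc j) = f (suc j)
upd f (suc i) x zero    = f zero
upd f (suc i) x (suc j) = upd (f ∘ suc) i x j

-- With infinitely many tapes, programs compose without agreeing on a number of tapes; `width`
-- bounds those that a program touches.
State : Set
State = ℕ → Tape Cell

infixr 4 _⨾_

-- An `op` reads and changes a single tape and is exactly one machine step. Every program ends with
-- a Boolean, on which `cond` and `while` branch.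
data Prog : Set where
  op    : ℕ → (Cell → Bool × Cell × Direction) → Prog
  _⨾_   : Prog → Prog → Prog
  cond  : Prog → Prog → Prog → Prog
  while : Prog → Prog

act : ℕ → Cell × Direction → State → State
act i a σ = upd σ i (writeAndShift ␣ a (σ i))

data Exec : Prog → State → ℕ → Bool → State → Set where
  op     : ∀ {i f σ} → let r = f (Tape.head (σ i)) in
           Exec (op i f) σ 1 (proj₁ r) (act i (proj₂ r) σ)
  seq    : ∀ {p q σ τ υ m n b c} →
           Exec p σ m b τ → Exec q τ n c υ → Exec (p ⨾ q) σ (m + n) c υ
  then   : ∀ {p q r σ τ υ m n c} →
           Exec p σ m true τ → Exec q τ n c υ → Exec (cond p q r) σ (m + n) c υ
  else   : ∀ {p q r σ τ υ m n c} →
           Exec p σ m false τ → Exec r τ n c υ → Exec (cond p q r) σ (m + n) c υ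
  stop   : ∀ {p σ τ m} → Exec p σ m false τ → Exec (while p) σ m false τ
  repeat : ∀ {p σ τ υ m n b} →
           Exec p σ m true τ → Exec (while p) τ n b υ → Exec (while p) σ (m + n) b υ

-- There is one control point for each occurrence of `op`. Sequencing, branching and looping are
-- folded into the transition of the preceding `op`, so the machine takes as many steps as `Exec`
-- counts.
Loc : Prog → Set
Loc (op _ _)     = ⊤
Loc (p ⨾ q)      = Loc p ⊎ Loc q
Loc (cond p q r) = Loc p ⊎ Loc q ⊎ Loc r
Loc (while p)    = Loc p

entry : ∀ p → Loc p
entry (op _ _)     = tt
entry (p ⨾ q)      = inj₁ (entry p)
entry (cond p q r) = inj₁ (entry p)
entry (while p)    = entry p

Action : Set
Action = ℕ × Cell × Direction

redirect : ∀ {L M : Set} → (L → M) → (Bool → M ⊎ Bool) → Action × (L ⊎ Bool) → Action × (M ⊎ Bool)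
redirect ι κ = map₂ [ inj₁ ∘ ι , κ ]′

branch : ∀ p q r → Bool → Loc (cond p q r) ⊎ Bool
branch p q r b = inj₁ (inj₂ (if b then inj₁ (entry q) else inj₂ (entry r)))

again : ∀ p → Bool → Loc (while p) ⊎ Bool
again p b = if b then inj₁ (entry p) else inj₂ false

fire : ∀ p → Loc p → (ℕ → Cell) → Action × (Loc p ⊎ Bool)
fire (op i f)     _               h = (i , proj₂ (f (h i))) , inj₂ (proj₁ (f (h i)))
fire (p ⨾ q)      (inj₁ l)        h = redirect inj₁ (λ _ → inj₁ (inj₂ (entry q))) (fire p l h)
fire (p ⨾ q)      (inj₂ l)        h = redirect inj₂ inj₂ (fire q l h)
fire (cond p q r) (inj₁ l)        h = redirect inj₁ (branch p q r) (fire p l h)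
fire (cond p q r) (inj₂ (inj₁ l)) h = redirect (inj₂ ∘ inj₁) inj₂ (fire q l h)
fire (cond p q r) (inj₂ (inj₂ l)) h = redirect (inj₂ ∘ inj₂) inj₂ (fire r l h)
fire (while p)    l               h = redirect id (again p) (fire p l h)

heads : State → ℕ → Cell
heads σ i = Tape.head (σ i)

act′ : Action → State → State
act′ (i , a) = act i a

data Steps (p : Prog) : Loc p → State → ℕ → Bool → State → Set where
  exit : ∀ {l σ a b} → fire p l (heads σ) ≡ (a , inj₂ b) →
         Steps p l σ 1 b (act′ a σ)
  more : ∀ {l l′ σ a n b τ} → fire p l (heads σ) ≡ (a , inj₁ l′) →
         Steps p l′ (act′ a σ) n b τ → Steps p l σ (suc n) b τ

steps-seq₂ : ∀ {p q l σ n b τ} → Steps q l σ n b τ → Steps (p ⨾ q) (inj₂ l) σ n b τ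
steps-seq₂ (exit e) = exit (cong (redirect inj₂ inj₂) e)
steps-seq₂ (more e s) = more (cong (redirect inj₂ inj₂) e) (steps-seq₂ s)

steps-seq₁ : ∀ {p q l σ m n b c τ υ} → Steps p l σ m b τ → Steps q (entry q) τ n c υ →
             Steps (p ⨾ q) (inj₁ l) σ (m + n) c υ
steps-seq₁ {q = q} (exit e)   s′ = more (cong (redirect inj₁ (λ _ → inj₁ (inj₂ (entry q)))) e) (steps-seq₂ s′)
steps-seq₁ {q = q} (more e s) s′ = more (cong (redirect inj₁ (λ _ → inj₁ (inj₂ (entry q)))) e) (steps-seq₁ s s′)

steps-then : ∀ {p q r l σ n b τ} → Steps q l σ n b τ →
             Steps (cond p q r) (inj₂ (inj₁ l)) σ n b τ
steps-then (exit e) = exit (cong (redirect (inj₂ ∘ inj₁) inj₂) e)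
steps-then (more e s) = more (cong (redirect (inj₂ ∘ inj₁) inj₂) e) (steps-then s)

steps-else : ∀ {p q r l σ n b τ} → Steps r l σ n b τ →
             Steps (cond p q r) (inj₂ (inj₂ l)) σ n b τ
steps-else (exit e) = exit (cong (redirect (inj₂ ∘ inj₂) inj₂) e)
steps-else (more e s) = more (cong (redirect (inj₂ ∘ inj₂) inj₂) e) (steps-else s)

steps-true : ∀ {p q r l σ m n c τ υ} → Steps p l σ m true τ → Steps q (entry q) τ n c υ →
             Steps (cond p q r) (inj₁ l) σ (m + n) c υ
steps-true {p} {q} {r} (exit e)   s′ = more (cong (redirect inj₁ (branch p q r)) e) (steps-then s′)
steps-true {p} {q} {r} (more e s) s′ = more (cong (redirect inj₁ (branch p q r)) e) (steps-true s s′)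

steps-false : ∀ {p q r l σ m n c τ υ} → Steps p l σ m false τ → Steps r (entry r) τ n c υ →
              Steps (cond p q r) (inj₁ l) σ (m + n) c υ
steps-false {p} {q} {r} (exit e)   s′ = more (cong (redirect inj₁ (branch p q r)) e) (steps-else s′)
steps-false {p} {q} {r} (more e s) s′ = more (cong (redirect inj₁ (branch p q r)) e) (steps-false s s′)

steps-stop : ∀ {p l σ n τ} → Steps p l σ n false τ → Steps (while p) l σ n false τ
steps-stop {p} (exit e) = exit (cong (redirect id (again p)) e)
steps-stop {p} (more e s) = more (cong (redirect id (again p)) e) (steps-stop s)

steps-repeat : ∀ {p l σ m n b τ υ} → Steps p l σ m true τ →
               Steps (while p) (entry p) τ n b υ → Steps (while p) l σ (m + n) b υ
steps-repeat {p} (exit e)   s′ = more (cong (redirect id (again p)) e) s′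
steps-repeat {p} (more e s) s′ = more (cong (redirect id (again p)) e) (steps-repeat s s′)

exec⇒steps : ∀ {p σ n b τ} → Exec p σ n b τ → Steps p (entry p) σ n b τ
exec⇒steps op           = exit refl
exec⇒steps (seq e f)    = steps-seq₁ (exec⇒steps e) (exec⇒steps f)
exec⇒steps (then e f)   = steps-true (exec⇒steps e) (exec⇒steps f)
exec⇒steps (else e f)  = steps-false (exec⇒steps e) (exec⇒steps f)
exec⇒steps (stop e)     = steps-stop (exec⇒steps e)
exec⇒steps (repeat e f) = steps-repeat (exec⇒steps e) (exec⇒steps f)

-- Simulation of a program by a multi-tape machine

width : Prog → ℕ
width (op i _)     = suc i
width (p ⨾ q)      = width p ⊔ width q
width (cond p q r) = width p ⊔ (width q ⊔ width r)
width (while p)    = width p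

-- The machine sees only finitely many heads, whereas `fire` takes the heads of all tapes; this
-- bridges the two.
fire-cong : ∀ {K} p → width p ≤ K → ∀ l {g h} → (∀ i → i < K → g i ≡ h i) →
             fire p l g ≡ fire p l h
fire-cong (op i f) w l g≗h rewrite g≗h i w = refl
fire-cong (p ⨾ q) w (inj₁ l) e = cong (redirect inj₁ (λ _ → inj₁ (inj₂ (entry q)))) (fire-cong p (m⊔n≤o⇒m≤o _ _ w) l e)
fire-cong (p ⨾ q) w (inj₂ l) e = cong (redirect inj₂ inj₂) (fire-cong q (m⊔n≤o⇒n≤o (width p) _ w) l e)
fire-cong (cond p q r) w (inj₁ l) e =
  cong (redirect inj₁ (branch p q r)) (fire-cong p (m⊔n≤o⇒m≤o _ _ w) l e)
fire-cong (cond p q r) w (inj₂ (inj₁ l)) e =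
  cong (redirect (inj₂ ∘ inj₁) inj₂) (fire-cong q (m⊔n≤o⇒m≤o _ _ (m⊔n≤o⇒n≤o (width p) _ w)) l e)
fire-cong (cond p q r) w (inj₂ (inj₂ l)) e =
  cong (redirect (inj₂ ∘ inj₂) inj₂) (fire-cong r (m⊔n≤o⇒n≤o (width q) _ (m⊔n≤o⇒n≤o (width p) _ w)) l e)
fire-cong (while p) w l e = cong (redirect id (again p)) (fire-cong p w l e)

prefix : ∀ {A : Set} n → (ℕ → A) → Vec A n
prefix zero    f = []
prefix (suc n) f = f 0 ∷ prefix n (f ∘ suc)

headAt : ∀ {n} → Vec Cell n → ℕ → Cell
headAt []       _       = ␣
headAt (c ∷ cs) zero    = c
headAt (c ∷ cs) (suc i) = headAt cs i

headAt-prefix : ∀ n σ i → i < n → headAt (Vec.map Tape.head (prefix n σ)) i ≡ heads σ i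
headAt-prefix (suc n) σ zero    _       = refl
headAt-prefix (suc n) σ (suc i) (s≤s l) = headAt-prefix n (σ ∘ suc) i l

idle : Cell → Cell × Direction
idle c = c , stay

actions : ∀ {n} → Vec Cell n → Action → Vec (Cell × Direction) n
actions []       _             = []
actions (c ∷ cs) (zero  , a)   = a ∷ Vec.map idle cs
actions (c ∷ cs) (suc i , a)   = (c , stay) ∷ actions cs (i , a)

actions-idle : ∀ n σ → Vec.zipWith (writeAndShift ␣)
  (Vec.map idle (Vec.map Tape.head (prefix n σ))) (prefix n σ) ≡ prefix n σ
actions-idle zero    σ = refl
actions-idle (suc n) σ = cong (σ 0 ∷_) (actions-idle n (σ ∘ suc))

actions-prefix : ∀ n σ a → Vec.zipWith (writeAndShift ␣)
  (actions (Vec.map Tape.head (prefix n σ)) a) (prefix n σ) ≡ prefix n (act′ a σ)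
actions-prefix zero    σ a           = refl
actions-prefix (suc n) σ (zero , a)  = cong (writeAndShift ␣ a (σ 0) ∷_) (actions-idle n (σ ∘ suc))
actions-prefix (suc n) σ (suc i , a) = cong (σ 0 ∷_) (actions-prefix n (σ ∘ suc) (i , a))

finite-⊎ : ∀ {A B} → Finite A → Finite B → Finite (A ⊎ B)
finite-⊎ (m , f) (n , g) = m + n ,
  mk↔ₛ′ (join m n) (splitAt m) (join-splitAt m n) (splitAt-join m n) ↔-∘ (f ⊎-↔ g)

Loc-finite : ∀ p → Finite (Loc p)
Loc-finite (op _ _)     = 1 , mk↔ₛ′ (λ _ → zero) (λ _ → tt) (λ { zero → refl }) (λ _ → refl)
Loc-finite (p ⨾ q)      = finite-⊎ (Loc-finite p) (Loc-finite q)
Loc-finite (cond p q r) = finite-⊎ (Loc-finite p) (finite-⊎ (Loc-finite q) (Loc-finite r))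
Loc-finite (while p)    = Loc-finite p

Bool-finite : Finite Bool
Bool-finite = 2 , mk↔ₛ′ (λ { true → 0F ; false → 1F }) (λ { 0F → true ; 1F → false })
  (λ { 0F → refl ; 1F → refl }) (λ { true → refl ; false → refl })

Cell-finite : Finite Cell
Cell-finite = 5 , mk↔ₛ′
  (λ { ⊢ → 0F ; ␣ → 1F ; (just (just 𝟎)) → 2F ; (just (just 𝟏)) → 3F ; (just (just ♯)) → 4F })
  (λ { 0F → ⊢ ; 1F → ␣ ; 2F → just (just 𝟎) ; 3F → just (just 𝟏) ; 4F → just (just ♯) })
  (λ { 0F → refl ; 1F → refl ; 2F → refl ; 3F → refl ; 4F → refl })
  (λ { ⊢ → refl ; ␣ → refl ; (just (just 𝟎)) → refl ; (just (just 𝟏)) → refl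
     ; (just (just ♯)) → refl })

module _ (p : Prog) (k : ℕ) where

  machine : TuringMachine Symbol
  machine = record
    { Γ               = Cell
    ; Γ-finite        = Cell-finite
    ; blank           = ␣
    ; input           = λ s → just (just s)
    ; input-injective = λ e → just-injective (just-injective e)
    ; input≢blank     = λ _ ()
    ; Q               = Loc p ⊎ Bool
    ; Q-finite        = finite-⊎ (Loc-finite p) Bool-finite
    ; start           = inj₁ (entry p)
    ; verdict         = λ { (inj₁ _) → nothing ; (inj₂ b) → just b }
    ; workTapes       = k
    ; δ               = δ
    }
    where
    δ : Loc p ⊎ Bool → Vec Cell (suc k) → (Loc p ⊎ Bool) × Vec (Cell × Direction) (suc k)
    δ (inj₂ b) cs = inj₂ b , Vec.map idle cs
    δ (inj₁ l) cs = let a , next = fire p l (headAt cs) in next , actions cs a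

  machine-step : width p ≤ suc k → ∀ {l σ a r} → fire p l (heads σ) ≡ (a , r) →
    step machine (config (inj₁ l) (prefix (suc k) σ)) ≡ config r (prefix (suc k) (act′ a σ))
  machine-step w {l} {σ} {a} {r} e
    with eq ← trans (fire-cong p w l (headAt-prefix (suc k) σ)) e
    rewrite eq = cong (config r) (actions-prefix (suc k) σ a)

  machine-steps : width p ≤ suc k → ∀ {l σ n b τ} → Steps p l σ n b τ →
    run machine n (config (inj₁ l) (prefix (suc k) σ)) ≡ config (inj₂ b) (prefix (suc k) τ)
  machine-steps w (exit e)           = machine-step w e
  machine-steps w (more {n = n} e s) =
    trans (cong (run machine n) (machine-step w e)) (machine-steps w s)

  machine-halted : ∀ n b ts → run machine n (config (inj₂ b) ts) ≡ config (inj₂ b) ts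
  machine-halted zero    b ts = refl
  machine-halted (suc n) b ts = machine-halted n b ts

run-+ : ∀ {I} (M : TuringMachine I) m n c → run M (m + n) c ≡ run M n (run M m c)
run-+ M zero    n c = refl
run-+ M (suc m) n c = run-+ M m n (step M c)

-- Tapes and running times

upd-same : ∀ {A : Set} (f : ℕ → A) i x → upd f i x i ≡ x
upd-same f zero    x = refl
upd-same f (suc i) x = upd-same (f ∘ suc) i x

upd-other : ∀ {A : Set} (f : ℕ → A) {i j} x → i ≢ j → upd f i x j ≡ f j
upd-other f {zero}  {zero}  x i≢j = ⊥-elim (i≢j refl)
upd-other f {zero}  {suc j} x i≢j = refl
upd-other f {suc i} {zero}  x i≢j = refl
upd-other f {suc i} {suc j} x i≢j = upd-other (f ∘ suc) x (i≢j ∘ cong suc)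

upd-cong : ∀ {A : Set} {f g : ℕ → A} i x → f ≗ g → upd f i x ≗ upd g i x
upd-cong zero    x e zero    = refl
upd-cong zero    x e (suc j) = e (suc j)
upd-cong (suc i) x e zero    = e zero
upd-cong (suc i) x e (suc j) = upd-cong i x (e ∘ suc) j

upd-upd : ∀ {A : Set} (f : ℕ → A) i x y → upd (upd f i x) i y ≗ upd f i y
upd-upd f zero    x y zero    = refl
upd-upd f zero    x y (suc j) = refl
upd-upd f (suc i) x y zero    = refl
upd-upd f (suc i) x y (suc j) = upd-upd (f ∘ suc) i x y j

upd-id : ∀ {A : Set} (f : ℕ → A) {i x} → f i ≡ x → upd f i x ≗ f
upd-id f {zero}  refl zero    = refl
upd-id f {zero}  e    (suc j) = refl
upd-id f {suc i} e    zero    = refl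
upd-id f {suc i} e    (suc j) = upd-id (f ∘ suc) {i} e j

nth : ∀ {A : Set} → A → List A → ℕ → A
nth d []       _       = d
nth d (x ∷ xs) zero    = x
nth d (x ∷ xs) (suc i) = nth d xs i

pos : Tape Cell → ℕ
pos t = length (Tape.before t)

-- Cells are numbered from the leftmost listed one. A left move at position 0 would renumber them
-- all, which is why `pos-left` and `cell-left` ask for a positive position and why the tapes carry
-- an end marker.
cell : Tape Cell → ℕ → Cell
cell (tape ls x rs) = nth ␣ (ls ʳ++ (x ∷ rs))

nth-ʳ++ : ∀ ls (xs : List Cell) j → nth ␣ (ls ʳ++ xs) (length ls + j) ≡ nth ␣ xs j
nth-ʳ++ []       xs j = refl
nth-ʳ++ (l ∷ ls) xs j = trans (cong (nth ␣ (ls ʳ++ (l ∷ xs))) (sym (+-suc (length ls) j)))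
                              (nth-ʳ++ ls (l ∷ xs) (suc j))

nth-ʳ++-cong : ∀ ls {xs ys : List Cell} → nth ␣ xs ≗ nth ␣ ys →
               nth ␣ (ls ʳ++ xs) ≗ nth ␣ (ls ʳ++ ys)
nth-ʳ++-cong []       e = e
nth-ʳ++-cong (l ∷ ls) e = nth-ʳ++-cong ls λ { zero → refl ; (suc j) → e j }

head≡cell : ∀ t → Tape.head t ≡ cell t (pos t)
head≡cell (tape ls x rs) =
  sym (trans (cong (nth ␣ (ls ʳ++ (x ∷ rs))) (sym (+-identityʳ _))) (nth-ʳ++ ls (x ∷ rs) 0))

pos-right : ∀ t → pos (shift ␣ right t) ≡ suc (pos t)
pos-right (tape ls x [])       = refl
pos-right (tape ls x (r ∷ rs)) = refl

cell-right : ∀ t → cell (shift ␣ right t) ≗ cell t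
cell-right (tape ls x [])       = nth-ʳ++-cong ls
  λ { zero → refl ; (suc zero) → refl ; (suc (suc _)) → refl }
cell-right (tape ls x (r ∷ rs)) j = refl

pos-left : ∀ t {k} → pos t ≡ suc k → pos (shift ␣ left t) ≡ k
pos-left (tape (l ∷ ls) x rs) refl = refl

cell-left : ∀ t {k} → pos t ≡ suc k → cell (shift ␣ left t) ≗ cell t
cell-left (tape (l ∷ ls) x rs) e j = refl

cell-write : ∀ c t → cell (writeAndShift ␣ (c , stay) t) ≗ upd (cell t) (pos t) c
cell-write c (tape ls x rs) = go ls x rs
  where
  front : ∀ c x rs → nth ␣ (c ∷ rs) ≗ upd (nth ␣ (x ∷ rs)) 0 c
  front c x rs zero    = refl
  front c x rs (suc j) = refl
  go′ : ∀ ls (xs ys : List Cell) i → nth ␣ xs ≗ upd (nth ␣ ys) i c →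
        nth ␣ (ls ʳ++ xs) ≗ upd (nth ␣ (ls ʳ++ ys)) (length ls + i) c
  go′ []       xs ys i e = e
  go′ (l ∷ ls) xs ys i e j = trans
    (go′ ls (l ∷ xs) (l ∷ ys) (suc i) (λ { zero → refl ; (suc k) → e k }) j)
    (cong (λ m → upd (nth ␣ (ls ʳ++ (l ∷ ys))) m c j) (+-suc (length ls) i))
  go : ∀ ls x rs → cell (tape ls c rs) ≗ upd (cell (tape ls x rs)) (length ls) c
  go ls x rs j = trans (go′ ls (c ∷ rs) (x ∷ rs) 0 (front c x rs) j)
    (cong (λ m → upd (cell (tape ls x rs)) m c j) (+-identityʳ (length ls)))

-- Cell 0 of every tape is the end marker, so cell suc j holds entry j.
line : (ℕ → Content) → ℕ → Cell
line κ zero    = ⊢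
line κ (suc j) = just (κ j)

infix 3 _⊨_,_

-- Lists that differ in trailing blanks describe the same tape, so a state is specified pointwise
-- and not by an equation between tapes. A position serves as the value of a variable, a content as
-- a set or as the input.
record _⊨_,_ (σ : State) (ν : ℕ → ℕ) (κ : ℕ → ℕ → Content) : Set where
  constructor view
  field
    at-pos  : ∀ i → pos (σ i) ≡ ν i
    at-cell : ∀ i → cell (σ i) ≗ line (κ i)

open _⊨_,_ public

line-cong : ∀ {f g : ℕ → Content} → f ≗ g → line f ≗ line g
line-cong e zero    = refl
line-cong e (suc j) = cong just (e j)

⊨-cong : ∀ {σ ν ν′ κ κ′} → ν ≗ ν′ → (∀ i → κ i ≗ κ′ i) → σ ⊨ ν , κ → σ ⊨ ν′ , κ′
⊨-cong e f (view p c) = view (λ i → trans (p i) (e i))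
                             (λ i j → trans (c i j) (line-cong (f i) j))

⊨-pos : ∀ {σ ν ν′ κ} → ν ≗ ν′ → σ ⊨ ν , κ → σ ⊨ ν′ , κ
⊨-pos e = ⊨-cong e (λ _ _ → refl)

⊨-head : ∀ {σ ν κ} → σ ⊨ ν , κ → ∀ i → Tape.head (σ i) ≡ line (κ i) (ν i)
⊨-head {σ} s i = trans (head≡cell (σ i)) (trans (cong (cell (σ i)) (at-pos s i)) (at-cell s i _))

upd-elim : ∀ {A : Set} (P : ℕ → A → Set) {f : ℕ → A} i {x} → P i x →
           (∀ j → i ≢ j → P j (f j)) → ∀ j → P j (upd f i x j)
upd-elim P {f} i {x} p q j with i ≟ j
... | yes refl = subst (P i) (sym (upd-same f i x)) p
... | no i≢j   = subst (P j) (sym (upd-other f x i≢j)) (q j i≢j)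

-- Time-bounded runs and rules for loops

record Run (p : Prog) (σ : State) (B : ℕ) (Q : Bool → State → Set) : Set where
  constructor run-to
  field
    {time}   : ℕ
    {result} : Bool
    {final}  : State
    exec     : Exec p σ time result final
    in-time  : time ≤ B
    post     : Q result final

run-mono : ∀ {p σ B C Q R} → B ≤ C → (∀ {b τ} → Q b τ → R b τ) → Run p σ B Q → Run p σ C R
run-mono B≤C f (run-to e t q) = run-to e (≤-trans t B≤C) (f q)

run-seq : ∀ {p q σ B C Q R} → Run p σ B Q → (∀ {b τ} → Q b τ → Run q τ C R) →
          Run (p ⨾ q) σ (B + C) R
run-seq (run-to e t x) f with run-to e′ t′ y ← f x = run-to (seq e e′) (+-mono-≤ t t′) y

run-cond : ∀ {p q r σ B C Q R} → Run p σ B Q →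
           (∀ {τ} → Q true τ → Run q τ C R) → (∀ {τ} → Q false τ → Run r τ C R) →
           Run (cond p q r) σ (B + C) R
run-cond (run-to {result = true}  e t x) f g with run-to e′ t′ y ← f x =
  run-to (then e e′) (+-mono-≤ t t′) y
run-cond (run-to {result = false} e t x) f g with run-to e′ t′ y ← g x =
  run-to (else e e′) (+-mono-≤ t t′) y

Round : (ℕ → State → Set) → (State → Set) → ℕ → Bool → State → Set
Round I Q k true  τ = ∃[ k′ ] k ≡ suc k′ × I k′ τ
Round I Q k false τ = Q τ

-- `Round` ties the result `true` to a decrease of `k`, so at most `k` rounds succeed; `suc k` also
-- counts the failing one.
run-while : ∀ {p B Q} (I : ℕ → State → Set) →
            (∀ k {σ} → I k σ → Run p σ B (Round I Q k)) →
            ∀ k {σ} → I k σ → Run (while p) σ (suc k * B) (λ _ → Q)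
run-while {B = B} I body k i with body k i
... | run-to {result = false} e t q = run-to (stop e) (≤-trans t (m≤m+n _ _)) q
... | run-to {result = true}  e t (k′ , refl , i′)
  with run-to e′ t′ q ← run-while I body k′ i′ = run-to (repeat e e′) (+-mono-≤ t t′) q

test : ℕ → (Cell → Bool) → Prog
test i g = op i λ c → g c , c , stay

move : ℕ → Direction → Prog
move i d = op i λ c → true , c , d

write : ℕ → Content → Prog
write i x = op i λ _ → true , just x , stay

yes! no! : Prog
yes! = test 0 (const true)
no!  = test 0 (const false)

module _ {σ ν κ} (s : σ ⊨ ν , κ) where

  run-test : ∀ i g → Run (test i g) σ 1 (λ b τ → b ≡ g (line (κ i) (ν i)) × τ ⊨ ν , κ)
  run-test i g = run-to op ≤-refl
    ( cong g (⊨-head s i)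
    , view (λ j → trans (cong pos (upd-id σ {i} refl j)) (at-pos s j))
           (λ j k → trans (cong (λ t → cell t k) (upd-id σ {i} refl j)) (at-cell s j k)) )

  run-yes : Run yes! σ 1 (λ b τ → b ≡ true × τ ⊨ ν , κ)
  run-yes = run-test 0 (const true)

  run-no : Run no! σ 1 (λ b τ → b ≡ false × τ ⊨ ν , κ)
  run-no = run-test 0 (const false)

  private
    moved : ∀ i {d k} → pos (shift ␣ d (σ i)) ≡ k → cell (shift ␣ d (σ i)) ≗ cell (σ i) →
            upd σ i (shift ␣ d (σ i)) ⊨ upd ν i k , κ
    moved i {d} {k} p c = view
      (λ j → upd-elim (λ j t → pos t ≡ upd ν i k j) i
        (trans p (sym (upd-same ν i k)))
        (λ j i≢j → trans (at-pos s j) (sym (upd-other ν k i≢j))) j)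
      (λ j → upd-elim (λ j t → cell t ≗ line (κ j)) i
        (λ m → trans (c m) (at-cell s i m)) (λ j _ → at-cell s j) j)

  run-right : ∀ i → Run (move i right) σ 1 (λ b τ → b ≡ true × τ ⊨ upd ν i (suc (ν i)) , κ)
  run-right i = run-to op ≤-refl (refl ,
    moved i (trans (pos-right (σ i)) (cong suc (at-pos s i))) (cell-right (σ i)))

  run-left : ∀ i {k} → ν i ≡ suc k → Run (move i left) σ 1 (λ b τ → b ≡ true × τ ⊨ upd ν i k , κ)
  run-left i e = run-to op ≤-refl (refl ,
    moved i (pos-left (σ i) (trans (at-pos s i) e)) (cell-left (σ i) (trans (at-pos s i) e)))

  run-write : ∀ i x {k} → ν i ≡ suc k →
              Run (write i x) σ 1 (λ b τ → τ ⊨ ν , upd κ i (upd (κ i) k x))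
  run-write i x {k} e = run-to op ≤-refl (view
    (λ j → upd-elim (λ j t → pos t ≡ ν j) i (at-pos s i) (λ j _ → at-pos s j) j)
    (λ j → upd-elim (λ j t → cell t ≗ line (upd κ i (upd (κ i) k x) j)) i
      (λ m → trans (written m) (cong (λ f → line f m) (sym (upd-same κ i _))))
      (λ j i≢j m → trans (at-cell s j m) (cong (λ f → line f m) (sym (upd-other κ _ i≢j)))) j))
    where
    line-upd : ∀ f k → upd (line f) (suc k) (just x) ≗ line (upd f k x)
    line-upd f k       zero          = refl
    line-upd f zero    (suc zero)    = refl
    line-upd f zero    (suc (suc j)) = refl
    line-upd f (suc k) (suc zero)    = refl
    line-upd f (suc k) (suc (suc j)) = line-upd (f ∘ suc) k (suc j)
    written : cell (writeAndShift ␣ (just x , stay) (σ i)) ≗ line (upd (κ i) k x)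
    written m = begin
      cell (writeAndShift ␣ (just x , stay) (σ i)) m  ≡⟨ cell-write (just x) (σ i) m ⟩
      upd (cell (σ i)) (pos (σ i)) (just x) m
        ≡⟨ cong (λ q → upd (cell (σ i)) q (just x) m) (trans (at-pos s i) e) ⟩
      upd (cell (σ i)) (suc k) (just x) m             ≡⟨ upd-cong (suc k) _ (at-cell s i) m ⟩
      upd (line (κ i)) (suc k) (just x) m             ≡⟨ line-upd (κ i) k m ⟩
      line (upd (κ i) k x) m                          ∎
      where open ≡-Reasoning

inside? : Cell → Bool
inside? ⊢        = false
inside? (just _) = true

-- The position of tape `i` is the counter. The body finds it already decreased, so it can use the
-- values from k - 1 down to 0 as an index, and the tape ends on its marker.
loop : ℕ → Prog → Prog
loop i p = while (cond (test i inside?) (move i left ⨾ p ⨾ yes!) no!)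

Assertion : Set₁
Assertion = (ℕ → ℕ) → (ℕ → ℕ → Content) → Set

Holds : Assertion → State → Set
Holds I σ = ∃[ ν ] ∃[ κ ] σ ⊨ ν , κ × I ν κ

-- The three steps added to `B` are the test, the move to the left and the final `yes!`.
run-loop : ∀ {p B} i (I : ℕ → Assertion) → (∀ {k ν κ} → I k ν κ → ν i ≡ k) →
           (∀ k {ν κ σ} → I (suc k) ν κ → σ ⊨ upd ν i k , κ →
              Run p σ B (λ _ → Holds (I k))) →
           ∀ k {σ} → Holds (I k) σ → Run (loop i p) σ (suc k * (B + 3)) (λ _ → Holds (I 0))
run-loop {p} {B} i I counter body = run-while (λ k → Holds (I k)) round
  where
  round : ∀ k {σ} → Holds (I k) σ →
          Run (cond (test i inside?) (move i left ⨾ p ⨾ yes!) no!) σ (B + 3)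
            (Round (λ k → Holds (I k)) (Holds (I 0)) k)
  round zero (ν , κ , s , h) = run-mono (m≤n⇒m≤o+n B (s≤s (s≤s z≤n))) id
    (run-cond (run-test s i inside?)
      (λ (e , _) → contradiction (trans (sym (cong (inside? ∘ line (κ i)) (counter h))) (sym e)) λ ())
      (λ (_ , s′) → run-mono ≤-refl (λ { (refl , s″) → ν , κ , s″ , h }) (run-no s′)))
  round (suc k) (ν , κ , s , h) = run-mono (≤-reflexive bound) id
    (run-cond (run-test s i inside?)
      (λ (_ , s′) → run-seq (run-left s′ i (counter h)) λ (_ , s″) →
         run-seq (body k h s″) λ (ν′ , κ′ , s‴ , h′) →
         run-mono ≤-refl (λ { (refl , s⁗) → k , refl , ν′ , κ′ , s⁗ , h′ }) (run-yes s‴))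
      (λ (e , _) → contradiction (trans (sym (cong (inside? ∘ line (κ i)) (counter h))) (sym e)) λ ()))
    where
    bound : 1 + (1 + (B + 1)) ≡ B + 3
    bound = trans (cong (2 +_) (+-comm B 1)) (+-comm 3 B)

-- The state before round j + 1 is given by ν j and κ j, up to the counter.
run-for : ∀ {p B} i (ν : ℕ → ℕ → ℕ) (κ : ℕ → ℕ → ℕ → Content) m →
          (∀ j k {σ} → k + suc j ≡ m → σ ⊨ upd (ν j) i k , κ j →
             Run p σ B (λ _ τ → τ ⊨ upd (ν (suc j)) i k , κ (suc j))) →
          ∀ {σ} → σ ⊨ upd (ν 0) i m , κ 0 →
          Run (loop i p) σ (suc m * (B + 3)) (λ _ τ → τ ⊨ upd (ν m) i 0 , κ m)
run-for {p} {B} i ν κ m body s = run-mono ≤-refl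
  (λ { (_ , _ , s′ , j , refl , refl , refl) → s′ })
  (run-loop i I (λ { (j , _ , refl , _) → upd-same (ν j) i _ })
    (λ { k (j , e , refl , refl) s′ → run-mono ≤-refl
         (λ s″ → _ , _ , s″ , suc j , trans (+-suc k j) e , refl , refl)
         (body j k (trans (+-suc k j) e) (⊨-pos (upd-upd (ν j) i _ k) s′)) })
    m (_ , _ , s , 0 , +-identityʳ m , refl , refl))
  where
  I : ℕ → Assertion
  I k ν′ κ′ = ∃[ j ] k + j ≡ m × ν′ ≡ upd (ν j) i k × κ′ ≡ κ j

-- Terms

inj-mono : ∀ {n} (ρ : Fin n → ℕ) → (∀ {a b} → a Fin.< b → ρ a < ρ b) →
           ∀ {a b} → a ≢ b → ρ a ≢ ρ b
inj-mono ρ mono {a} {b} a≢b with Fin.<-cmp a b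
... | tri< a<b _ _ = <⇒≢ (mono a<b)

... | tri≈ _ a≡b _ = λ _ → a≢b a≡b
... | tri> _ _ b<a = <⇒≢ (mono b<a) ∘ sym

-- Two chains of updates at pairwise distinct indices ρ a are compared by
-- computing their values at every ρ a.
module Updates {A : Set} {n : ℕ} (ρ : Fin n → ℕ) (ρ-inj : ∀ {a b} → a ≢ b → ρ a ≢ ρ b) where

  upds : List (Fin n × A) → (ℕ → A) → ℕ → A
  upds []            f = f
  upds ((a , x) ∷ l) f = upd (upds l f) (ρ a) x

  find : List (Fin n × A) → (ℕ → A) → Fin n → A
  find []            f a = f (ρ a)
  find ((b , x) ∷ l) f a = if does (a Fin.≟ b) then x else find l f a

  upds-find : ∀ l f a → upds l f (ρ a) ≡ find l f a
  upds-find []            f a = refl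
  upds-find ((b , x) ∷ l) f a with a Fin.≟ b
  ... | yes refl = upd-same (upds l f) (ρ a) x
  ... | no a≢b   = trans (upd-other (upds l f) x (ρ-inj (a≢b ∘ sym))) (upds-find l f a)

  upds-outside : ∀ l f {j} → (∀ a → ρ a ≢ j) → upds l f j ≡ f j
  upds-outside []            f out = refl
  upds-outside ((a , x) ∷ l) f out = trans (upd-other (upds l f) x (out a)) (upds-outside l f out)

  upds-≗ : ∀ l l′ {f} → (∀ a → find l f a ≡ find l′ f a) → upds l f ≗ upds l′ f
  upds-≗ l l′ {f} e j with any? (λ a → ρ a ≟ j)
  ... | yes (a , refl) = trans (upds-find l f a) (trans (e a) (sym (upds-find l′ f a)))
  ... | no out = trans (upds-outside l f (λ a eq → out (a , eq)))
                       (sym (upds-outside l′ f (λ a eq → out (a , eq))))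

-- Costs are kept as syntax so that the shape required by `PTIME` can be found by recursion in
-- `poly≤`.
data Poly : Set where
  con     : ℕ → Poly
  X       : Poly
  _⊞_ _⊠_ : Poly → Poly → Poly

infixl 6 _⊞_
infixl 7 _⊠_

⟪_⟫ : Poly → ℕ → ℕ
⟪ con c ⟫ n = c
⟪ X ⟫     n = n
⟪ p ⊞ q ⟫ n = ⟪ p ⟫ n + ⟪ q ⟫ n
⟪ p ⊠ q ⟫ n = ⟪ p ⟫ n * ⟪ q ⟫ n

infixl 6 _⊕_
infixl 7 _⊗_

data Term : Set where
  var     : ℕ → Term
  one     : Term
  _⊕_ _⊗_ : Term → Term → Term

val : Term → (ℕ → ℕ) → ℕ
val (var i) ν = ν i
val one     ν = 1
val (t ⊕ u) ν = val t ν + val u ν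
val (t ⊗ u) ν = val t ν * val u ν

-- For concrete terms and formulas this reduces to a product of unit types, so the scope of the
-- final formula is checked by inference alone.
ScopedT : ℕ → Term → Set
ScopedT m (var i) = T (i <ᵇ m)
ScopedT m one     = ⊤
ScopedT m (t ⊕ u) = ScopedT m t × ScopedT m u
ScopedT m (t ⊗ u) = ScopedT m t × ScopedT m u

val-cong : ∀ {m ν ν′} t → ScopedT m t → (∀ i → i < m → ν i ≡ ν′ i) → val t ν ≡ val t ν′
val-cong (var i) s       e = e i (<ᵇ⇒< i _ s)
val-cong one     s       e = refl
val-cong (t ⊕ u) (s , r) e = cong₂ _+_ (val-cong t s e) (val-cong u r e)
val-cong (t ⊗ u) (s , r) e = cong₂ _*_ (val-cong t s e) (val-cong u r e)

limit : Term → Poly → Poly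
limit (var i) β = β
limit one     β = con 1
limit (t ⊕ u) β = limit t β ⊞ limit u β
limit (t ⊗ u) β = limit t β ⊠ limit u β

val≤limit : ∀ {m ν β N} t → ScopedT m t → (∀ i → i < m → ν i ≤ ⟪ β ⟫ N) →
            val t ν ≤ ⟪ limit t β ⟫ N
val≤limit (var i) s       b = b i (<ᵇ⇒< i _ s)
val≤limit one     s       b = ≤-refl
val≤limit (t ⊕ u) (s , r) b = +-mono-≤ (val≤limit t s b) (val≤limit u r b)
val≤limit (t ⊗ u) (s , r) b = *-mono-≤ (val≤limit t s b) (val≤limit u r b)

-- e is the target tape; the tapes from d on are free.
addTo : ℕ → ℕ → Term → Prog
addTo d e (var x) = loop x (move e right ⨾ move d right) ⨾ loop d (move x right)
addTo d e one     = move e right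
addTo d e (t ⊕ u) = addTo d e t ⨾ addTo d e u
addTo d e (t ⊗ u) = addTo (suc d) d t ⨾ loop d (addTo (suc d) e u)

-- The factors 5 and 4 are the overhead 3 of a loop plus the two moves, respectively the one move,
-- of its body.
costT : Term → Poly → Poly
costT (var x) β = (con 1 ⊞ β) ⊠ con 5 ⊞ (con 1 ⊞ β) ⊠ con 4
costT one     β = con 1
costT (t ⊕ u) β = costT t β ⊞ costT u β
costT (t ⊗ u) β = costT t β ⊞ (con 1 ⊞ limit t β) ⊠ (costT u β ⊞ con 3)

module _ {κ : ℕ → ℕ → Content} {m : ℕ} {β : Poly} {N : ℕ} where

  -- Reading a variable counts its tape down. So `x` is copied both to `e` and to the free tape `d`,
  -- from which it is then restored. In a product, `d` holds the first factor and is used up by the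
  -- loop that adds the second. The bound `m ≤ e` keeps the target out of the scope of the term,
  -- whose value is thus unaffected by the additions.
  run-addTo : ∀ {d e ν σ} t → ScopedT m t → m ≤ e → e < d →
              (∀ i → d ≤ i → ν i ≡ 0) → (∀ i → i < m → ν i ≤ ⟪ β ⟫ N) → σ ⊨ ν , κ →
              Run (addTo d e t) σ (⟪ costT t β ⟫ N) (λ _ τ → τ ⊨ upd ν e (ν e + val t ν) , κ)
  run-addTo {d} {e} {ν} (var x) sc m≤e e<d free small s =
    run-mono (+-mono-≤ (*-monoˡ-≤ 5 (s≤s x-small)) (*-monoˡ-≤ 4 (s≤s x-small))) id
      (run-seq
        (run-for x (λ j → upd (upd ν e (ν e + j)) d j) (λ _ → κ) (ν x)
          (λ j k _ s → run-seq (run-right s e) λ (_ , s) →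
            run-mono ≤-refl
              (λ (_ , s) → ⊨-pos
                (upds-≗ ((2F , _) ∷ (1F , _) ∷ (0F , _) ∷ (2F , _) ∷ (1F , _) ∷ [])
                        ((0F , _) ∷ (2F , _) ∷ (1F , _) ∷ [])
                  λ { 0F → refl
                    ; 1F → trans (cong suc (upds-find ((0F , _) ∷ (2F , _) ∷ (1F , _) ∷ []) ν 1F))
                                 (sym (+-suc (ν e) j))
                    ; 2F → cong suc
                        (upds-find ((1F , _) ∷ (0F , _) ∷ (2F , _) ∷ (1F , _) ∷ []) ν 2F) }) s)
              (run-right s d))
          (⊨-pos (upds-≗ [] ((0F , _) ∷ (2F , _) ∷ (1F , _) ∷ [])
            λ { 0F → refl ; 1F → sym (+-identityʳ _) ; 2F → free d ≤-refl }) s))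
        (λ s → run-mono ≤-refl
          (⊨-pos (upds-≗ ((2F , _) ∷ (0F , _) ∷ (1F , _) ∷ []) ((1F , _) ∷ [])
            λ { 0F → refl ; 1F → refl ; 2F → sym (free d ≤-refl) }))
          (run-for d (λ j → upd (upd ν e (ν e + ν x)) x j) (λ _ → κ) (ν x)
            (λ j k _ s → run-mono ≤-refl
              (λ (_ , s) → ⊨-pos
                (upds-≗ ((0F , _) ∷ (2F , _) ∷ (0F , _) ∷ (1F , _) ∷ [])
                        ((2F , _) ∷ (0F , _) ∷ (1F , _) ∷ [])
                  λ { 0F → cong suc (upds-find ((2F , _) ∷ (0F , _) ∷ (1F , _) ∷ []) ν 0F)
                    ; 1F → refl ; 2F → refl }) s)
              (run-right s x))
            (⊨-pos (upds-≗ ((0F , _) ∷ (2F , _) ∷ (1F , _) ∷ []) ((2F , _) ∷ (0F , _) ∷ (1F , _) ∷ [])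
              λ { 0F → refl ; 1F → refl ; 2F → refl }) s))))
    where
    x<m : x < m
    x<m = <ᵇ⇒< x m sc
    x-small : ν x ≤ ⟪ β ⟫ N
    x-small = small x x<m
    x<e : x < e
    x<e = <-≤-trans x<m m≤e
    ρ : Fin 3 → ℕ
    ρ 0F = x
    ρ 1F = e
    ρ 2F = d
    ρ-mono : ∀ {a b} → a Fin.< b → ρ a < ρ b
    ρ-mono {0F} {1F} _ = x<e
    ρ-mono {0F} {2F} _ = <-trans x<e e<d
    ρ-mono {1F} {2F} _ = e<d
    ρ-mono {1F} {1F} (s≤s ())
    ρ-mono {2F} {1F} (s≤s ())
    ρ-mono {2F} {2F} (s≤s (s≤s ()))
    ρ-inj : ∀ {a b} → a ≢ b → ρ a ≢ ρ b
    ρ-inj = inj-mono ρ ρ-mono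
    open Updates ρ ρ-inj
  run-addTo {d} {e} {ν} one sc m≤e e<d free small s =
    run-mono ≤-refl (λ (_ , s) → ⊨-pos (λ i → cong (λ y → upd ν e y i) (+-comm 1 (ν e))) s)
      (run-right s e)
  run-addTo {d} {e} {ν} (t ⊕ u) (sc , sc′) m≤e e<d free small s =
    run-seq (run-addTo t sc m≤e e<d free small s) λ s →
    run-mono ≤-refl
      (⊨-pos λ i → trans (upd-upd ν e _ _ i) (cong (λ y → upd ν e y i) (begin
        upd ν e (ν e + val t ν) e + val u (upd ν e (ν e + val t ν))
          ≡⟨ cong₂ _+_ (upd-same ν e _)
               (val-cong u sc′ λ i i<m → upd-other ν _ (<⇒≢ (<-≤-trans i<m m≤e) ∘ sym)) ⟩
        ν e + val t ν + val u ν    ≡⟨ +-assoc (ν e) _ _ ⟩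
        ν e + (val t ν + val u ν)  ∎)))
      (run-addTo u sc′ m≤e e<d
        (λ i d≤i → trans (upd-other ν _ (<⇒≢ (<-≤-trans e<d d≤i))) (free i d≤i))
        (λ i i<m → ≤-trans (≤-reflexive (upd-other ν _ (<⇒≢ (<-≤-trans i<m m≤e) ∘ sym)))
                           (small i i<m)) s)
    where open ≡-Reasoning
  run-addTo {d} {e} {ν} (t ⊗ u) (sc , sc′) m≤e e<d free small s =
    run-mono (+-monoʳ-≤ (⟪ costT t β ⟫ N)
               (*-monoˡ-≤ (⟪ costT u β ⟫ N + 3) (s≤s (val≤limit t sc small)))) id
      (run-seq (run-addTo t sc (≤-trans m≤e (<⇒≤ e<d)) ≤-refl (λ i l → free i (<⇒≤ l)) small s) λ s →
       run-mono ≤-refl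
         (⊨-pos (upds-≗ ((1F , _) ∷ (0F , _) ∷ []) ((0F , _) ∷ [])
           λ { 0F → refl ; 1F → sym (free d ≤-refl) }))
         (run-for d (λ j → upd ν e (ν e + j * val u ν)) (λ _ → κ) (val t ν)
           (λ j k _ s → run-mono ≤-refl
             (⊨-pos (upds-≗ ((0F , _) ∷ (1F , _) ∷ (0F , _) ∷ []) ((1F , _) ∷ (0F , _) ∷ [])
               λ { 0F → begin
                     upd (upd ν e (ν e + j * val u ν)) d k e + val u (upd (upd ν e _) d k)
                       ≡⟨ cong₂ _+_ (upds-find ((1F , _) ∷ (0F , _) ∷ []) ν 0F)
                            (val-cong u sc′ (elsewhere _ _)) ⟩
                     ν e + j * val u ν + val u ν    ≡⟨ +-assoc (ν e) _ _ ⟩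
                     ν e + (j * val u ν + val u ν)  ≡⟨ cong (ν e +_) (+-comm _ (val u ν)) ⟩
                     ν e + suc j * val u ν          ∎
                 ; 1F → refl }))
             (run-addTo u sc′ m≤e (m<n⇒m<1+n e<d)
               (λ i d<i → trans (upd-other _ _ (<⇒≢ d<i))
                          (trans (upd-other ν _ (<⇒≢ (<-trans e<d d<i))) (free i (<⇒≤ d<i))))
               (λ i i<m → ≤-trans (≤-reflexive (elsewhere _ _ i i<m)) (small i i<m)) s))
           (⊨-pos (upds-≗ ((1F , _) ∷ []) ((1F , _) ∷ (0F , _) ∷ [])
             λ { 0F → sym (+-identityʳ _) ; 1F → cong (_+ val t ν) (free d ≤-refl) }) s)))
    where
    open ≡-Reasoning
    ρ : Fin 2 → ℕ
    ρ 0F = e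
    ρ 1F = d
    ρ-mono : ∀ {a b} → a Fin.< b → ρ a < ρ b
    ρ-mono {0F} {1F} _ = e<d
    ρ-mono {1F} {1F} (s≤s ())
    ρ-inj : ∀ {a b} → a ≢ b → ρ a ≢ ρ b
    ρ-inj = inj-mono ρ ρ-mono
    open Updates ρ ρ-inj
    elsewhere : ∀ x y i → i < m → upd (upd ν e x) d y i ≡ ν i
    elsewhere x y i i<m =
      trans (upd-other _ _ (<⇒≢ (<-trans (<-≤-trans i<m m≤e) e<d) ∘ sym))
            (upd-other ν _ (<⇒≢ (<-≤-trans i<m m≤e) ∘ sym))

-- Formulas

infixr 4 _&_
infix 5 ∼_
infix 5 _≼_

-- ex and fix bind tapes: in a formula at level n the tapes from n on are free.
data Formula : Set where
  at   : ℕ → Symbol → Term → Formula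
  _≼_  : Term → Term → Formula
  ∼_   : Formula → Formula
  _&_  : Formula → Formula → Formula
  ex   : Term → Formula → Formula
  fix  : Term → Formula → Formula → Formula

has : Symbol → Content → Bool
has 𝟎 (just 𝟎) = true
has 𝟏 (just 𝟏) = true
has ♯ (just ♯) = true
has _ _        = false

any< : ℕ → (ℕ → Bool) → Bool
any< zero    f = false
any< (suc k) f = f k ∨ any< k f

-- Candidates are tried downwards because the counter of the compiled loop decreases; each one sees
-- the marks made earlier in the same sweep.
sweep : ((ℕ → Content) → ℕ → Bool) → ℕ → (ℕ → Content) → ℕ → Content
sweep step zero    A = A
sweep step (suc k) A = sweep step k (if step A k then upd A k (just 𝟏) else A)

-- The number of remaining rounds is passed to `step` because in the program it is the position of a
-- tape that lies in the scope of the formula.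
rounds : (ℕ → (ℕ → Content) → ℕ → Bool) → ℕ → ℕ → (ℕ → Content) → ℕ → Content
rounds step b zero    A = A
rounds step b (suc r) A = rounds step b r (sweep (step r) b A)

∅ : ℕ → Content
∅ _ = nothing

-- fix t φ ψ marks, in place and starting from the empty set, the x < t (on
-- tape n + 2) satisfying φ, for t rounds; φ and ψ see the set on tape n.
⟦_⟧ : Formula → ℕ → (ℕ → ℕ) → (ℕ → ℕ → Content) → Bool
⟦ at i a t ⟧ n ν κ = has a (κ i (ν i + val t ν))
⟦ t ≼ u ⟧ n ν κ = val t ν ≤ᵇ val u ν
⟦ ∼ φ ⟧ n ν κ = not (⟦ φ ⟧ n ν κ)
⟦ φ & ψ ⟧ n ν κ = ⟦ φ ⟧ n ν κ ∧ ⟦ ψ ⟧ n ν κ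
⟦ ex t φ ⟧ n ν κ = any< (val t ν) λ x → ⟦ φ ⟧ (1 + n) (upd ν n x) κ
⟦ fix t φ ψ ⟧ n ν κ = ⟦ ψ ⟧ (1 + n) (upd ν n 0) (upd κ n (rounds
  (λ r A x → ⟦ φ ⟧ (3 + n) (upd (upd (upd ν n 0) (1 + n) r) (2 + n) x) (upd κ n A))
  (val t ν) (val t ν) ∅))

Scoped : ℕ → Formula → Set
Scoped n (at i a t)  = T (i <ᵇ n) × ScopedT n t
Scoped n (t ≼ u)     = ScopedT n t × ScopedT n u
Scoped n (∼ φ)       = Scoped n φ
Scoped n (φ & ψ)     = Scoped n φ × Scoped n ψ
Scoped n (ex t φ)    = ScopedT n t × Scoped (1 + n) φ
Scoped n (fix t φ ψ) = ScopedT n t × Scoped (3 + n) φ × Scoped (1 + n) ψ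

hasCell : Symbol → Cell → Bool
hasCell a ⊢        = false
hasCell a (just c) = has a c

back : ℕ → ℕ → Prog
back n i = move i left ⨾ loop n (move i left)

rewind : ℕ → Prog
rewind n = loop n yes!

mark : ℕ → Prog
mark n = addTo (4 + n) (3 + n) (var (2 + n)) ⨾ move n right ⨾ loop (3 + n) (move n right) ⨾
         write n (just 𝟏) ⨾ rewind n

clear : ℕ → Term → Prog
clear n t = addTo (2 + n) (1 + n) t ⨾ loop (1 + n) (move n right ⨾ write n nothing) ⨾ rewind n

-- For ex, a witness x is left as position x + 1 of tape n, which tells the
-- witness 0 from failure.
compile : ℕ → Formula → Prog
compile n (at i a t) =
  addTo (1 + n) n t ⨾ addTo (2 + n) (1 + n) (var n) ⨾ move i right ⨾ loop n (move i right) ⨾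
  cond (test i (hasCell a)) (back (1 + n) i ⨾ yes!) (back (1 + n) i ⨾ no!)
compile n (t ≼ u) =
  addTo (1 + n) n t ⨾ addTo (2 + n) (1 + n) u ⨾
  loop (1 + n) (cond (test n inside?) (move n left) yes!) ⨾
  cond (test n inside?) (rewind n ⨾ no!) yes!
compile n (∼ φ) = cond (compile n φ) no! yes!
compile n (φ & ψ) = cond (compile n φ) (compile n ψ) no!
compile n (ex t φ) =
  addTo (1 + n) n t ⨾
  while (cond (test n inside?)
              (move n left ⨾ cond (compile (1 + n) φ) (move n right ⨾ no!) yes!) no!) ⨾
  cond (test n inside?) (rewind n ⨾ yes!) no!
compile n (fix t φ ψ) =
  addTo (2 + n) (1 + n) t ⨾
  loop (1 + n) (addTo (3 + n) (2 + n) t ⨾ loop (2 + n) (cond (compile (3 + n) φ) (mark n) yes!)) ⨾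
  cond (compile (1 + n) ψ) (clear n t ⨾ yes!) (clear n t ⨾ no!)

loopCost : Poly → Poly → Poly
loopCost L c = (con 1 ⊞ L) ⊠ (c ⊞ con 3)

markCost : Poly → Poly
markCost β = costT (var 0) β ⊞ (con 1 ⊞ (loopCost β (con 1) ⊞ (con 1 ⊞ loopCost (con 1 ⊞ β) (con 1))))

clearCost : Term → Poly → Poly
clearCost t β = costT t β ⊞ (loopCost (limit t β) (con 2) ⊞ loopCost (limit t β) (con 1))

cost : Formula → Poly → Poly
cost (at i a t) β =
  costT t β ⊞ (costT (var 0) (β ⊞ limit t β) ⊞ (con 1 ⊞ (loopCost (limit t β) (con 1) ⊞
  (con 1 ⊞ ((con 1 ⊞ loopCost (limit t β) (con 1)) ⊞ con 1)))))
cost (t ≼ u) β =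
  costT t β ⊞ (costT u β ⊞ (loopCost (limit u β) (con 2) ⊞
  (con 1 ⊞ (loopCost (limit t β) (con 1) ⊞ con 1))))
cost (∼ φ) β = cost φ β ⊞ con 1
cost (φ & ψ) β = cost φ β ⊞ (cost ψ β ⊞ con 1)
cost (ex t φ) β =
  costT t β ⊞ ((con 1 ⊞ limit t β) ⊠ (con 1 ⊞ (con 1 ⊞ (cost φ (β ⊞ limit t β) ⊞ con 2))) ⊞
  (con 1 ⊞ (loopCost (limit t β) (con 1) ⊞ con 1)))
cost (fix t φ ψ) β =
  costT t β ⊞
  (loopCost (limit t β)
     (costT t β ⊞ loopCost (limit t β) (cost φ (β ⊞ limit t β) ⊞ (markCost (β ⊞ limit t β) ⊞ con 1))) ⊞
  (cost ψ β ⊞ (clearCost t β ⊞ con 1)))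

-- Correctness and running time of compiled formulas

Free : ℕ → (ℕ → ℕ) → (ℕ → ℕ → Content) → Set
Free n ν κ = (∀ i → n ≤ i → ν i ≡ 0) × (∀ i → n ≤ i → ∀ j → κ i j ≡ nothing)

Small : ℕ → (ℕ → ℕ) → ℕ → Set
Small n ν b = ∀ i → i < n → ν i ≤ b

loop≤ : ∀ {v L} B → v ≤ L → suc v * (B + 3) ≤ suc L * (B + 3)
loop≤ B v≤L = *-monoˡ-≤ (B + 3) (s≤s v≤L)

run-rewind : ∀ {σ ν κ L} n → ν n ≤ L → σ ⊨ ν , κ →
             Run (rewind n) σ (suc L * 4) (λ _ τ → τ ⊨ upd ν n 0 , κ)
run-rewind {ν = ν} {κ} n small s = run-mono (loop≤ 1 small) id
  (run-for n (λ _ → ν) (λ _ → κ) (ν n)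
    (λ j k _ s → run-mono ≤-refl proj₂ (run-yes s))
    (⊨-pos (λ i → sym (upd-id ν {n} refl i)) s))

-- The head of tape `i` itself travels to the cell, so the value of `t` is stored twice: one counter
-- leads the head out, the other leads it back. The extra move to the right accounts for the end
-- marker, which shifts entry j to cell j + 1.
run-at : ∀ {n i a t ν κ σ β N} → Scoped n (at i a t) → Free n ν κ → Small n ν (⟪ β ⟫ N) →
         σ ⊨ ν , κ →
         Run (compile n (at i a t)) σ (⟪ cost (at i a t) β ⟫ N)
           (λ b τ → b ≡ ⟦ at i a t ⟧ n ν κ × τ ⊨ ν , κ)
run-at {n} {i} {a} {t} {ν} {κ} {σ} {β} {N} (sci , sct) (free , _) small s =
  run-seq (run-addTo t sct ≤-refl ≤-refl (λ i l → free i (<⇒≤ l)) small s) λ s →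
  run-seq (run-addTo {m = suc n} {β ⊞ limit t β} (var n) (<⇒<ᵇ {n} ≤-refl) ≤-refl ≤-refl
             (λ i l → trans (upd-other ν _ (<⇒≢ (<-trans (n<1+n n) l)))
                            (free i (≤-trans (n≤1+n n) (<⇒≤ l))))
             (upd-elim (λ j x → j < suc n → x ≤ ⟪ β ⟫ N + ⟪ limit t β ⟫ N) n
               (λ _ → m≤n⇒m≤o+n (⟪ β ⟫ N) (≤-trans (≤-reflexive (cong (_+ v) (free n ≤-refl))) v≤L))
               (λ j n≢j j≤n → m≤n⇒m≤n+o _ (small j (≤∧≢⇒< (s≤s⁻¹ j≤n) (n≢j ∘ sym))))) s) λ s →
  run-seq (run-right s i) λ (_ , s) →
  run-seq (run-mono (loop≤ 1 v≤L) id
    (run-for n (λ j → upd (upd ν i (suc (ν i) + j)) (1 + n) v) (λ _ → κ) v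
      (λ j k _ s → run-mono ≤-refl
        (λ (_ , s) → ⊨-pos (upds-≗ ((0F , _) ∷ (1F , _) ∷ (2F , _) ∷ (0F , _) ∷ [])
                                    ((1F , _) ∷ (2F , _) ∷ (0F , _) ∷ [])
          λ { 0F → trans (cong suc (upds-find ((1F , _) ∷ (2F , _) ∷ (0F , _) ∷ []) ν 0F))
                         (sym (+-suc (suc (ν i)) j))
            ; 1F → refl ; 2F → refl }) s)
        (run-right s i))
      (⊨-pos (upds-≗ ((0F , _) ∷ (2F , _) ∷ (1F , _) ∷ []) ((1F , _) ∷ (2F , _) ∷ (0F , _) ∷ [])
        λ { 0F → trans (cong suc (upds-find ((2F , _) ∷ (1F , _) ∷ []) ν 0F))
                       (sym (+-identityʳ _))
          ; 1F → cong (_+ v) (free n ≤-refl)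
          ; 2F → trans (cong₂ _+_ (upds-find ((1F , _) ∷ []) ν 2F) (upds-find ((1F , _) ∷ []) ν 1F))
                       (cong₂ (λ x y → x + (y + v)) (free (suc n) (n≤1+n n)) (free n ≤-refl)) }) s))) λ s →
  run-cond (run-test s i (hasCell a))
    (λ (e , s) → run-seq (goBack s) λ s →
       run-mono ≤-refl (λ (e′ , s) → trans e′ (trans e look) , s) (run-yes s))
    (λ (e , s) → run-seq (goBack s) λ s →
       run-mono ≤-refl (λ (e′ , s) → trans e′ (trans e look) , s) (run-no s))
  where
  v = val t ν
  v≤L : v ≤ ⟪ limit t β ⟫ N
  v≤L = val≤limit t sct small
  i<n : i < n
  i<n = <ᵇ⇒< i n sci
  ρ : Fin 3 → ℕ
  ρ 0F = i
  ρ 1F = n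
  ρ 2F = suc n
  ρ-mono : ∀ {a b} → a Fin.< b → ρ a < ρ b
  ρ-mono {0F} {1F} _ = i<n
  ρ-mono {0F} {2F} _ = m<n⇒m<1+n i<n
  ρ-mono {1F} {2F} _ = ≤-refl
  ρ-mono {1F} {1F} (s≤s ())
  ρ-mono {2F} {1F} (s≤s ())
  ρ-mono {2F} {2F} (s≤s (s≤s ()))
  ρ-inj : ∀ {a b} → a ≢ b → ρ a ≢ ρ b
  ρ-inj = inj-mono ρ ρ-mono
  open Updates ρ ρ-inj
  look : hasCell a (line (κ i) (upd (upd (upd ν i (suc (ν i) + v)) (1 + n) v) n 0 i)) ≡
         has a (κ i (ν i + v))
  look = cong (hasCell a ∘ line (κ i)) (upds-find ((1F , _) ∷ (2F , _) ∷ (0F , _) ∷ []) ν 0F)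
  goBack : ∀ {σ} → σ ⊨ upd (upd (upd ν i (suc (ν i) + v)) (1 + n) v) n 0 , κ →
           Run (back (1 + n) i) σ (1 + suc (⟪ limit t β ⟫ N) * 4) (λ _ τ → τ ⊨ ν , κ)
  goBack s =
    run-seq (run-left s i (upds-find ((1F , _) ∷ (2F , _) ∷ (0F , _) ∷ []) ν 0F)) λ (_ , s) →
    run-mono (loop≤ 1 v≤L)
      (⊨-pos (upds-≗ ((2F , _) ∷ (0F , _) ∷ []) []
        λ { 0F → trans (cong (ν i +_) (n∸n≡0 v)) (+-identityʳ _) ; 1F → refl
          ; 2F → sym (free (suc n) (n≤1+n n)) }))
      (run-for (1 + n) (λ j → upd ν i (ν i + (v ∸ j))) (λ _ → κ) v
        (λ j k e s → run-mono ≤-refl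
          (λ (_ , s) → ⊨-pos (upds-≗ ((0F , _) ∷ (2F , _) ∷ (0F , _) ∷ []) ((2F , _) ∷ (0F , _) ∷ [])
            λ { 0F → cong (ν i +_) (sym (trans (cong (_∸ suc j) (sym e)) (m+n∸n≡m k (suc j))))
              ; 1F → refl ; 2F → refl }) s)
          (run-left s i {ν i + k} (trans (upds-find ((2F , _) ∷ (0F , _) ∷ []) ν 0F)
            (trans (cong (ν i +_) (trans (cong (_∸ j) (trans (sym e) (+-suc k j)))
                                         (m+n∸n≡m (suc k) j)))
                   (+-suc (ν i) k)))))
        (⊨-pos (upds-≗ ((0F , _) ∷ (1F , _) ∷ (2F , _) ∷ (0F , _) ∷ []) ((2F , _) ∷ (0F , _) ∷ [])
          λ { 0F → refl ; 1F → sym (free n ≤-refl) ; 2F → refl }) s))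

module Above (n : ℕ) {k : ℕ} where
  ρ : Fin k → ℕ
  ρ a = Fin.toℕ a + n

  ρ-inj : ∀ {a b} → a ≢ b → ρ a ≢ ρ b
  ρ-inj = inj-mono ρ (+-monoˡ-< n)

  open Updates {ℕ} ρ ρ-inj public

inside?-zero : ∀ {κ : ℕ → Content} k → inside? (line κ k) ≡ false → k ≡ 0
inside?-zero zero e = refl

inside?-suc : ∀ {κ : ℕ → Content} k → inside? (line κ k) ≡ true → k ≡ suc (pred k)
inside?-suc (suc k) e = refl

∸-≤ᵇ : ∀ v u → v ∸ u ≡ 0 → (v ≤ᵇ u) ≡ true
∸-≤ᵇ zero    u       e = refl
∸-≤ᵇ (suc v) (suc u) e = trans (<ᵇ-suc v u) (∸-≤ᵇ v u e)
  where
  <ᵇ-suc : ∀ v u → (v <ᵇ suc u) ≡ (v ≤ᵇ u)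
  <ᵇ-suc zero    u = refl
  <ᵇ-suc (suc v) u = refl

∸-≰ᵇ : ∀ v u {k} → v ∸ u ≡ suc k → (v ≤ᵇ u) ≡ false
∸-≰ᵇ (suc v)       zero    e = refl
∸-≰ᵇ (suc (suc v)) (suc u) e = ∸-≰ᵇ (suc v) u e
∸-≰ᵇ (suc zero) (suc zero) ()
∸-≰ᵇ (suc zero) (suc (suc u)) ()

-- Tape `n` starts at the value of `t` and is decreased once per unit of `u`, resting on its marker
-- when it gets there. This is truncated subtraction, which gives 0 exactly when the inequality
-- holds.
run-≼ : ∀ {n t u ν κ σ β N} → Scoped n (t ≼ u) → Free n ν κ → Small n ν (⟪ β ⟫ N) →
        σ ⊨ ν , κ →
        Run (compile n (t ≼ u)) σ (⟪ cost (t ≼ u) β ⟫ N)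
          (λ b τ → b ≡ ⟦ t ≼ u ⟧ n ν κ × τ ⊨ ν , κ)
run-≼ {n} {t} {u} {ν} {κ} {β = β} {N} (sct , scu) (free , _) small s =
  run-seq (run-addTo t sct ≤-refl ≤-refl (λ i l → free i (<⇒≤ l)) small s) λ s →
  run-seq (run-addTo u scu (n≤1+n n) ≤-refl
             (λ i l → trans (upd-other ν _ (<⇒≢ (<-trans (n<1+n n) l)))
                            (free i (≤-trans (n≤1+n n) (<⇒≤ l))))
             (λ i i<n → ≤-trans (≤-reflexive (upd-other ν _ (<⇒≢ i<n ∘ sym))) (small i i<n)) s) λ s →
  run-seq (run-mono (loop≤ 2 (val≤limit u scu small)) id
    (run-for (1 + n) (λ j → upd ν n (v ∸ j)) (λ _ → κ) w
      (λ j k _ s → run-cond (run-test s n inside?)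
        (λ (e , s) → run-mono ≤-refl
          (λ (_ , s) → ⊨-pos (upds-≗ ((0F , _) ∷ (1F , _) ∷ (0F , _) ∷ []) ((1F , _) ∷ (0F , _) ∷ [])
             λ { 0F → pred[m∸n]≡m∸[1+n] v j ; 1F → refl }) s)
          (run-left s n {pred (v ∸ j)}
            (trans (at0 j k) (inside?-suc (v ∸ j)
              (trans (cong (inside? ∘ line (κ n)) (sym (at0 j k))) (sym e))))))
        (λ (e , s) → run-mono ≤-refl
          (λ (_ , s) → ⊨-pos (upds-≗ ((1F , _) ∷ (0F , _) ∷ []) ((1F , _) ∷ (0F , _) ∷ [])
             λ { 0F → trans (stuck j k (sym e))
                        (trans (cong pred (sym (stuck j k (sym e)))) (pred[m∸n]≡m∸[1+n] v j))
               ; 1F → refl }) s)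
          (run-yes s)))
      (⊨-pos (upds-≗ ((1F , _) ∷ (0F , _) ∷ []) ((1F , _) ∷ (0F , _) ∷ [])
        λ { 0F → cong (_+ v) (free n ≤-refl)
          ; 1F → trans (cong₂ _+_ (upds-find ((0F , _) ∷ []) ν 1F)
                          (val-cong u scu λ i i<n → upd-other ν _ (<⇒≢ i<n ∘ sym)))
                       (cong (_+ w) (free (suc n) (n≤1+n n))) }) s))) λ s →
  run-cond (run-test s n inside?)
    (λ (e , s) → run-seq
      (run-mono (loop≤ {spot} 1 spot≤L) id (run-rewind n ≤-refl s)) λ s →
      run-mono ≤-refl
        (λ (e′ , s) → trans e′ (sym (∸-≰ᵇ v w (inside?-suc (v ∸ w)
            (trans (cong (inside? ∘ line (κ n)) (sym (at0 w 0))) (sym e)))))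
          , ⊨-pos (upds-≗ ((0F , _) ∷ (1F , _) ∷ (0F , _) ∷ []) []
              λ { 0F → sym (free n ≤-refl) ; 1F → sym (free (suc n) (n≤1+n n)) }) s)
        (run-no s))
    (λ (e , s) → run-mono (m≤n⇒m≤o+n (suc (⟪ limit t β ⟫ N) * 4) ≤-refl)
      (λ (e′ , s) → trans e′ (sym (∸-≤ᵇ v w (stuck w 0 (sym e))))
        , ⊨-pos (upds-≗ ((1F , _) ∷ (0F , _) ∷ []) []
            λ { 0F → trans (stuck w 0 (sym e)) (sym (free n ≤-refl))
              ; 1F → sym (free (suc n) (n≤1+n n)) }) s)
      (run-yes s))
  where
  v = val t ν
  w = val u ν
  open Above n {2}
  at0 : ∀ j k → upd (upd ν n (v ∸ j)) (1 + n) k n ≡ v ∸ j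
  at0 j k = upds-find ((1F , _) ∷ (0F , _) ∷ []) ν 0F
  stuck : ∀ j k → inside? (line (κ n) (upd (upd ν n (v ∸ j)) (1 + n) k n)) ≡ false → v ∸ j ≡ 0
  stuck j k e = inside?-zero (v ∸ j) (trans (cong (inside? ∘ line (κ n)) (sym (at0 j k))) e)
  spot = upd (upd ν n (v ∸ w)) (1 + n) 0 n
  spot≤L : spot ≤ ⟪ limit t β ⟫ N
  spot≤L = ≤-trans (≤-reflexive (at0 w 0)) (≤-trans (m∸n≤m v w) (val≤limit t sct small))

-- All positions and contents are restored, those of free tapes included, so a formula can be
-- evaluated again in each round of an enclosing loop. The bound `β` on the positions in scope is
-- arbitrary because binders enlarge it.
Correct : Formula → Set
Correct φ = ∀ {n ν κ σ β N} → Scoped n φ → Free n ν κ → Small n ν (⟪ β ⟫ N) → σ ⊨ ν , κ →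
  Run (compile n φ) σ (⟪ cost φ β ⟫ N) (λ b τ → b ≡ ⟦ φ ⟧ n ν κ × τ ⊨ ν , κ)

small-upd : ∀ {n ν b c x} → Small n ν b → x ≤ c → Small (suc n) (upd ν n x) (b + c)
small-upd {n} {ν} {b} {c} small x≤c = upd-elim (λ j y → j < suc n → y ≤ b + c) n
  (λ _ → m≤n⇒m≤o+n b x≤c)
  (λ j n≢j j≤n → m≤n⇒m≤n+o c (small j (≤∧≢⇒< (s≤s⁻¹ j≤n) (n≢j ∘ sym))))

free-upd : ∀ {n ν κ} → Free n ν κ → ∀ x → Free (suc n) (upd ν n x) κ
free-upd (f , g) x = (λ i n<i → trans (upd-other _ x (<⇒≢ n<i)) (f i (<⇒≤ n<i)))
                   , (λ i n<i → g i (<⇒≤ n<i))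

-- Invariant: the candidates from `k` on have failed, so the search below `k` decides the whole
-- search. The loop ends at position 0 after failure and at a positive position after success, which
-- the last test tells apart.
run-ex : ∀ {t φ} → Correct φ → Correct (ex t φ)
run-ex {t} {φ} correct {n} {ν} {κ} {σ} {β} {N} (sct , scφ) fr@(free , _) small s =
  run-seq (run-addTo t sct ≤-refl ≤-refl (λ i l → free i (<⇒≤ l)) small s) λ s →
  run-seq (run-mono (*-monoˡ-≤ (1 + (1 + (⟪ cost φ (β ⊞ limit t β) ⟫ N + 2))) (s≤s v≤L)) id
    (run-while I round v (≤-refl , refl , ⊨-pos start s))) λ (y , y≤v , e , s) →
  run-cond (run-test s n inside?)
    (λ (e′ , s) → run-seq
      (run-rewind n (≤-trans (≤-reflexive (upd-same ν n y)) (≤-trans y≤v v≤L)) s) λ s →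
      run-mono ≤-refl
        (λ (e″ , s) → trans e″ (trans e′ (trans (atn y) e)) , ⊨-pos (reset y) s) (run-yes s))
    (λ (e′ , s) → run-mono (m≤n⇒m≤o+n (suc (⟪ limit t β ⟫ N) * 4) ≤-refl)
      (λ (e″ , s) → trans e″ (trans e′ (trans (atn y) e))
        , ⊨-pos (upd-id ν {n} (trans (free n ≤-refl)
            (sym (inside?-zero y (trans (sym (atn y)) (sym e′)))))) s)
      (run-no s))
  where
  v = val t ν
  v≤L : v ≤ ⟪ limit t β ⟫ N
  v≤L = val≤limit t sct small
  f : ℕ → Bool
  f x = ⟦ φ ⟧ (1 + n) (upd ν n x) κ
  atn : ∀ y → inside? (line (κ n) (upd ν n y n)) ≡ inside? (line (κ n) y)
  atn y = cong (inside? ∘ line (κ n)) (upd-same ν n y)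
  start : upd ν n (ν n + v) ≗ upd ν n v
  start i = cong (λ y → upd ν n y i) (cong (_+ v) (free n ≤-refl))
  reset : ∀ y → upd (upd ν n y) n 0 ≗ ν
  reset y i = trans (upd-upd ν n y 0 i) (upd-id ν {n} (free n ≤-refl) i)
  I : ℕ → State → Set
  I k τ = k ≤ v × any< k f ≡ any< v f × τ ⊨ upd ν n k , κ
  Q : State → Set
  Q τ = ∃[ y ] y ≤ v × inside? (line (κ n) y) ≡ any< v f × τ ⊨ upd ν n y , κ
  round : ∀ k {σ} → I k σ → Run
    (cond (test n inside?)
          (move n left ⨾ cond (compile (1 + n) φ) (move n right ⨾ no!) yes!) no!) σ
    (1 + (1 + (⟪ cost φ (β ⊞ limit t β) ⟫ N + 2))) (Round I Q k)
  round zero {σ} (_ , e , s) = run-cond (run-test s n inside?)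
    (λ (e′ , _) → contradiction (trans e′ (atn 0)) λ ())
    (λ (_ , s) → run-mono (m≤m+n 1 _) (λ { (refl , s) → 0 , z≤n , e , s }) (run-no s))
  round (suc k) {σ} (k<v , e , s) = run-cond (run-test s n inside?)
    (λ (_ , s) → run-seq (run-left s n (upd-same ν n (suc k))) λ (_ , s) →
      run-cond (correct {β = β ⊞ limit t β} scφ (free-upd fr k) (small-upd small (≤-trans (<⇒≤ k<v) v≤L))
                  (⊨-pos (upd-upd ν n _ k) s))
        (λ (found , s) → run-seq (run-right s n) λ (_ , s) →
           run-mono ≤-refl
             (λ { (refl , s) → suc k , k<v , trans (cong (_∨ any< k f) found) e
                , ⊨-pos (λ i → trans (upd-upd ν n k _ i)
                                     (cong (λ y → upd ν n (suc y) i) (upd-same ν n k))) s })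
             (run-no s))
        (λ (failed , s) → run-mono (s≤s z≤n)
           (λ { (refl , s) → k , refl , <⇒≤ k<v , trans (cong (_∨ any< k f) failed) e , s })
           (run-yes s)))
    (λ (e′ , _) → contradiction (trans e′ (atn (suc k))) λ ())

sweep-beyond : ∀ step k A {j} → k ≤ j → sweep step k A j ≡ A j
sweep-beyond step zero    A k≤j = refl
sweep-beyond step (suc k) A k<j with step A k
... | false = sweep-beyond step k A (<⇒≤ k<j)
... | true  = trans (sweep-beyond step k _ (<⇒≤ k<j)) (upd-other A _ (<⇒≢ k<j))

-- Marks are made below the bound only, so `clear` empties the tape although it visits no more than
-- that many entries.
rounds-beyond : ∀ step b r A {j} → b ≤ j → rounds step b r A j ≡ A j
rounds-beyond step b zero    A b≤j = refl
rounds-beyond step b (suc r) A b≤j =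
  trans (rounds-beyond step b r _ b≤j) (sweep-beyond (step r) b A b≤j)

wipe : ℕ → (ℕ → Content) → ℕ → Content
wipe zero    A = A
wipe (suc j) A = upd (wipe j A) j nothing

wipe-outside : ∀ v A {j} → v ≤ j → wipe v A j ≡ A j
wipe-outside zero    A _   = refl
wipe-outside (suc v) A v<j = trans (upd-other (wipe v A) nothing (<⇒≢ v<j)) (wipe-outside v A (<⇒≤ v<j))

wipe-inside : ∀ v A j → j < v → wipe v A j ≡ nothing
wipe-inside (suc v) A j (s≤s j≤v) = upd-elim (λ j c → j ≤ v → c ≡ nothing) v (λ _ → refl)
  (λ j v≢j j≤v → wipe-inside v A j (≤∧≢⇒< j≤v (v≢j ∘ sym))) j j≤v

wipe-all : ∀ v A → (∀ j → v ≤ j → A j ≡ nothing) → wipe v A ≗ ∅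
wipe-all v A blank j with v ≤? j
... | yes v≤j = trans (wipe-outside v A v≤j) (blank j v≤j)
... | no v≰j  = wipe-inside v A j (≰⇒> v≰j)

upd-row : ∀ (κ : ℕ → ℕ → Content) n A B → ∀ i → upd (upd κ n A) n B i ≗ upd κ n B i
upd-row κ n A B i j = cong (λ f → f j) (upd-upd κ n A B i)

row-cong : ∀ (κ : ℕ → ℕ → Content) n {A B} → A ≗ B → ∀ i → upd κ n A i ≗ upd κ n B i
row-cong κ n {A} {B} e = upd-elim (λ i f → f ≗ upd κ n B i) n
  (λ j → trans (e j) (cong (λ f → f j) (sym (upd-same κ n B))))
  (λ i n≢i j → cong (λ f → f j) (sym (upd-other κ B n≢i)))

upd-entry : ∀ (κ : ℕ → ℕ → Content) n A k c i →
  upd (upd κ n A) n (upd (upd κ n A n) k c) i ≗ upd κ n (upd A k c) i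
upd-entry κ n A k c i j = trans (upd-row κ n A _ i j)
  (cong (λ f → upd κ n (upd f k c) i j) (upd-same κ n A))

run-mark : ∀ {n ν κ σ β N} → Free (3 + n) ν κ → ν n ≡ 0 → Small (3 + n) ν (⟪ β ⟫ N) → σ ⊨ ν , κ →
           Run (mark n) σ (⟪ markCost β ⟫ N)
             (λ _ τ → τ ⊨ ν , upd κ n (upd (κ n) (ν (2 + n)) (just 𝟏)))
run-mark {n} {ν} {κ} {σ} {β} {N} (free , _) νn≡0 small s =
  run-seq (run-addTo {m = 3 + n} {β} (var (2 + n)) (<⇒<ᵇ {2 + n} ≤-refl) ≤-refl ≤-refl
             (λ i l → free i (<⇒≤ l)) small s) λ s →
  run-seq (run-right s n) λ (_ , s) →
  run-seq (run-mono (loop≤ 1 k≤β) id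
    (run-for (3 + n) (λ j → upd ν n (suc j)) (λ _ → κ) k
      (λ j l _ s → run-mono ≤-refl
        (λ (_ , s) → ⊨-pos (upds-≗ ((0F , _) ∷ (3F , _) ∷ (0F , _) ∷ []) ((3F , _) ∷ (0F , _) ∷ [])
          λ { 0F → cong suc (upds-find ((3F , _) ∷ (0F , _) ∷ []) ν 0F)
            ; 1F → refl ; 2F → refl ; 3F → refl }) s)
        (run-right s n))
      (⊨-pos (upds-≗ ((0F , _) ∷ (3F , _) ∷ []) ((3F , _) ∷ (0F , _) ∷ [])
        λ { 0F → cong suc (trans (upds-find ((3F , _) ∷ []) ν 0F) νn≡0)
          ; 1F → refl ; 2F → refl ; 3F → cong (_+ k) (free (3 + n) ≤-refl) }) s))) λ s →
  run-seq (run-write s n (just 𝟏) (atn)) λ s →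
  run-mono (loop≤ {spot} 1 (≤-trans (≤-reflexive atn) (s≤s k≤β)))
    (⊨-pos (upds-≗ ((0F , _) ∷ (3F , _) ∷ (0F , _) ∷ []) []
      λ { 0F → sym νn≡0 ; 1F → refl ; 2F → refl ; 3F → sym (free (3 + n) ≤-refl) }))
    (run-rewind n ≤-refl s)
  where
  k = ν (2 + n)
  k≤β : k ≤ ⟪ β ⟫ N
  k≤β = small (2 + n) ≤-refl
  open Above n {4}
  spot = upd (upd ν n (suc k)) (3 + n) 0 n
  atn : spot ≡ suc k
  atn = upds-find ((3F , _) ∷ (0F , _) ∷ []) ν 0F

run-clear : ∀ {n t ν κ σ β N} → ScopedT n t → Free (1 + n) ν κ → ν n ≡ 0 →
            (∀ j → val t ν ≤ j → κ n j ≡ nothing) → Small n ν (⟪ β ⟫ N) → σ ⊨ ν , κ →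
            Run (clear n t) σ (⟪ clearCost t β ⟫ N) (λ _ τ → τ ⊨ ν , upd κ n ∅)
run-clear {n} {t} {ν} {κ} {σ} {β} {N} sct (free , _) νn≡0 blank small s =
  run-seq (run-addTo t sct (n≤1+n n) ≤-refl (λ i l → free i (<⇒≤ l)) small s) λ s →
  run-seq (run-mono (loop≤ 2 v≤L) id
    (run-for (1 + n) (λ j → upd ν n j) (λ j → upd κ n (wipe j (κ n))) v
      (λ j k _ s → run-seq (run-right s n) λ (_ , s) →
        run-mono ≤-refl
          (⊨-cong
            (upds-≗ ((0F , _) ∷ (1F , _) ∷ (0F , _) ∷ []) ((1F , _) ∷ (0F , _) ∷ [])
              λ { 0F → cong suc (upds-find ((1F , _) ∷ (0F , _) ∷ []) ν 0F) ; 1F → refl })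
            (upd-entry κ n (wipe j (κ n)) j nothing))
          (run-write s n nothing (trans (upd-same _ n _)
            (cong suc (upds-find ((1F , _) ∷ (0F , _) ∷ []) ν 0F)))))
      (⊨-cong
        (upds-≗ ((1F , _) ∷ []) ((1F , _) ∷ (0F , _) ∷ [])
          λ { 0F → νn≡0 ; 1F → cong (_+ v) (free (1 + n) ≤-refl) })
        (λ i j → cong (λ f → f j) (sym (upd-id κ {n} refl i))) s))) λ s →
  run-mono (loop≤ {spot} 1 (≤-trans (≤-reflexive atn) v≤L))
    (⊨-cong
      (upds-≗ ((0F , _) ∷ (1F , _) ∷ (0F , _) ∷ []) []
        λ { 0F → sym νn≡0 ; 1F → sym (free (1 + n) ≤-refl) })
      (row-cong κ n (wipe-all v (κ n) blank)))
    (run-rewind n ≤-refl s)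
  where
  v = val t ν
  v≤L : v ≤ ⟪ limit t β ⟫ N
  v≤L = val≤limit t sct small
  open Above n {2}
  spot = upd (upd ν n v) (1 + n) 0 n
  atn : spot ≡ v
  atn = upds-find ((1F , _) ∷ (0F , _) ∷ []) ν 0F

small-upd′ : ∀ {n ν b x} → Small n ν b → x ≤ b → Small (suc n) (upd ν n x) b
small-upd′ {n} {ν} {b} small x≤b = upd-elim (λ j y → j < suc n → y ≤ b) n
  (λ _ → x≤b) (λ j n≢j j≤n → small j (≤∧≢⇒< (s≤s⁻¹ j≤n) (n≢j ∘ sym)))

free-row : ∀ {m n ν κ} → n < m → Free m ν κ → ∀ A → Free m ν (upd κ n A)
free-row {m} {n} {κ = κ} n<m (f , g) A = f , upd-elim (λ i (h : ℕ → Content) → m ≤ i → ∀ j → h j ≡ nothing) n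
  (λ m≤n → ⊥-elim (<⇒≱ n<m m≤n)) (λ i _ → g i)

-- Both invariants look ahead: what remains of the sweep, or of the rounds, leads from the present
-- set to the intended one. Since `sweep` and `rounds` carry the set as an accumulator, each
-- iteration of the program merely unfolds them once.
run-fix : ∀ {t φ ψ} → Correct φ → Correct ψ → Correct (fix t φ ψ)
run-fix {t} {φ} {ψ} correctφ correctψ {n} {ν} {κ} {σ} {β} {N} (sct , scφ , scψ) fr@(free , blank) small s =
  run-seq (run-addTo t sct (n≤1+n n) ≤-refl (λ i l → free i (≤-trans (m≤n+m n 2) l)) small s) λ s →
  run-seq (run-mono (loop≤ roundCost v≤L) id
    (run-loop (1 + n) I′ (λ { (_ , refl , _) → upd-same ν₀ (1 + n) _ }) round v
      (_ , _
      , ⊨-cong (upds-≗ ((1F , _) ∷ []) ((1F , _) ∷ (0F , _) ∷ [])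
          λ { 0F → free n ≤-refl ; 1F → cong (_+ v) (free (1 + n) (n≤1+n n)) ; 2F → refl })
          (λ i j → sym (blankRow i j)) s
      , ∅ , refl , refl , refl , ≤-refl))) λ { (_ , _ , s , A , refl , refl , e , _) →
  after A e (⊨-pos (upds-≗ ((1F , _) ∷ (0F , _) ∷ []) ((0F , _) ∷ [])
    λ { 0F → refl ; 1F → sym (free (1 + n) (n≤1+n n)) ; 2F → refl }) s) }
  where
  v = val t ν
  L = ⟪ limit t β ⟫ N
  v≤L : v ≤ L
  v≤L = val≤limit t sct small
  open Above n {3}
  ν₀ = upd ν n 0
  stage : ℕ → ℕ → ℕ → ℕ
  stage r x = upd (upd ν₀ (1 + n) r) (2 + n) x
  step′ : ℕ → (ℕ → Content) → ℕ → Bool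
  step′ r A x = ⟦ φ ⟧ (3 + n) (stage r x) (upd κ n A)
  β′ : Poly
  β′ = β ⊞ limit t β
  bodyCost = ⟪ cost φ β′ ⟫ N + (⟪ markCost β′ ⟫ N + 1)
  roundCost = ⟪ costT t β ⟫ N + suc L * (bodyCost + 3)
  blankRow : ∀ i → upd κ n ∅ i ≗ κ i
  blankRow = upd-elim (λ i f → f ≗ κ i) n (λ j → sym (blank n ≤-refl j)) (λ _ _ _ → refl)
  I : ℕ → (ℕ → Content) → ℕ → Assertion
  I r goal k ν′ κ′ = ∃[ A ] ν′ ≡ stage r k × κ′ ≡ upd κ n A × sweep (step′ r) k A ≡ goal × k ≤ v
  I′ : ℕ → Assertion
  I′ r ν′ κ′ = ∃[ A ] ν′ ≡ upd ν₀ (1 + n) r × κ′ ≡ upd κ n A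
                   × rounds step′ v r A ≡ rounds step′ v v ∅ × r ≤ v
  freeStage : ∀ r x A → Free (3 + n) (stage r x) (upd κ n A)
  freeStage r x A = free-row (m≤n+m (suc n) 2)
    (free-upd {2 + n} (free-upd {1 + n} (free-upd fr 0) r) x) A
  smallStage : ∀ {r x} → r ≤ v → x ≤ v → Small (3 + n) (stage r x) (⟪ β′ ⟫ N)
  smallStage r≤v x≤v =
    small-upd′ {2 + n} (small-upd′ {1 + n} (small-upd small z≤n) (m≤n⇒m≤o+n _ (≤-trans r≤v v≤L)))
      (m≤n⇒m≤o+n _ (≤-trans x≤v v≤L))
  sweeping : ∀ r → r ≤ v → ∀ goal k {ν′ κ′ τ} → I r goal (suc k) ν′ κ′ →
             τ ⊨ upd ν′ (2 + n) k , κ′ →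
             Run (cond (compile (3 + n) φ) (mark n) yes!) τ bodyCost (λ _ → Holds (I r goal k))
  sweeping r r≤v goal k (A , refl , refl , e , k<v) s = run-cond
    (correctφ {β = β′} scφ (freeStage r k A) (smallStage r≤v (<⇒≤ k<v))
      (⊨-pos (upd-upd (upd ν₀ (1 + n) r) (2 + n) _ k) s))
    (λ (found , s) → run-mono (m≤m+n _ 1)
      (λ s → _ , _ , ⊨-cong (λ _ → refl)
          (λ i j → trans (upd-entry κ n A (stage r k (2 + n)) (just 𝟏) i j)
            (cong (λ x → upd κ n (upd A x (just 𝟏)) i j) (upd-same (upd ν₀ (1 + n) r) (2 + n) k))) s
        , upd A k (just 𝟏) , refl , refl
        , trans (cong (λ b → sweep (step′ r) k (if b then upd A k (just 𝟏) else A)) found) e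
        , <⇒≤ k<v)
      (run-mark {β = β′} (freeStage r k A)
         (upds-find ((2F , _) ∷ (1F , _) ∷ (0F , _) ∷ []) ν 0F) (smallStage r≤v (<⇒≤ k<v)) s))
    (λ (failed , s) → run-mono (m≤n⇒m≤o+n (⟪ markCost β′ ⟫ N) ≤-refl)
      (λ (_ , s) → _ , _ , s , A , refl , refl
        , trans (cong (λ b → sweep (step′ r) k (if b then upd A k (just 𝟏) else A)) failed) e
        , <⇒≤ k<v)
      (run-yes s))
  round : ∀ r {ν′ κ′ τ} → I′ (suc r) ν′ κ′ → τ ⊨ upd ν′ (1 + n) r , κ′ →
          Run (addTo (3 + n) (2 + n) t ⨾ loop (2 + n) (cond (compile (3 + n) φ) (mark n) yes!))
              τ roundCost (λ _ → Holds (I′ r))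
  round r (A , refl , refl , e , r<v) s = run-seq
    (run-addTo {ν = upd ν₀ (1 + n) r} t sct (m≤n+m n 2) ≤-refl
      (λ i l → proj₁ (free-upd {1 + n} {κ = κ} (free-upd fr 0) r) i (<⇒≤ l))
      (λ i i<n → ≤-trans (≤-reflexive (low r i i<n)) (small i i<n))
      (⊨-pos (upd-upd ν₀ (1 + n) _ r) s)) λ s →
    run-mono (loop≤ bodyCost v≤L)
      (λ { (_ , _ , s , A′ , refl , refl , e′ , _) → _ , _
         , ⊨-pos (upds-≗ ((2F , _) ∷ (1F , _) ∷ (0F , _) ∷ []) ((1F , _) ∷ (0F , _) ∷ [])
             λ { 0F → refl ; 1F → refl ; 2F → sym (free (2 + n) (m≤n+m n 2)) }) s
         , A′ , refl , refl , trans (cong (rounds step′ v r) e′) e , <⇒≤ r<v })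
      (run-loop (2 + n) (I r (sweep (step′ r) v A))
        (λ { (_ , refl , _) → upd-same (upd ν₀ (1 + n) r) (2 + n) _ })
        (sweeping r (<⇒≤ r<v) _) v
        (_ , _ , ⊨-pos (λ i → cong (λ x → stage r x i)
            (cong₂ _+_ (trans (upds-find ((1F , _) ∷ (0F , _) ∷ []) ν 2F) (free (2 + n) (m≤n+m n 2)))
                       (val-cong t sct (low r)))) s
          , A , refl , refl , refl , ≤-refl))
    where
    low : ∀ r i → i < n → upd ν₀ (1 + n) r i ≡ ν i
    low r i i<n = trans (upd-other ν₀ r (<⇒≢ (m<n⇒m<1+n i<n) ∘ sym))
                        (upd-other ν 0 (<⇒≢ i<n ∘ sym))
  after : ∀ A → A ≡ rounds step′ v v ∅ → ∀ {τ} → τ ⊨ ν₀ , upd κ n A →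
          Run (cond (compile (1 + n) ψ) (clear n t ⨾ yes!) (clear n t ⨾ no!)) τ
            (⟪ cost ψ β ⟫ N + (⟪ clearCost t β ⟫ N + 1))
            (λ b υ → b ≡ ⟦ ψ ⟧ (1 + n) ν₀ (upd κ n (rounds step′ v v ∅)) × υ ⊨ ν , κ)
  after A refl s = run-cond
    (correctψ {β = β} scψ (free-row ≤-refl (free-upd fr 0) A) (small-upd′ small z≤n) s)
    (λ (e , s) → run-seq (clearing s) λ s →
       run-mono ≤-refl (λ (e′ , s) → trans e′ e , restore s) (run-yes s))
    (λ (e , s) → run-seq (clearing s) λ s →
       run-mono ≤-refl (λ (e′ , s) → trans e′ e , restore s) (run-no s))
    where
    t-same : val t ν₀ ≡ v
    t-same = val-cong t sct (λ i i<n → upd-other ν 0 (<⇒≢ i<n ∘ sym))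
    clearing : ∀ {τ} → τ ⊨ ν₀ , upd κ n A →
               Run (clear n t) τ (⟪ clearCost t β ⟫ N) (λ _ υ → υ ⊨ ν₀ , upd (upd κ n A) n ∅)
    clearing = run-clear {β = β} sct (free-row ≤-refl (free-upd fr 0) A) (upd-same ν n 0)
      (λ j v≤j → trans (cong (λ f → f j) (upd-same κ n A))
        (rounds-beyond step′ v v ∅ (≤-trans (≤-reflexive (sym t-same)) v≤j)))
      (λ i i<n → ≤-trans (≤-reflexive (upd-other ν 0 (<⇒≢ i<n ∘ sym))) (small i i<n))
    restore : ∀ {τ} → τ ⊨ ν₀ , upd (upd κ n A) n ∅ → τ ⊨ ν , κ
    restore = ⊨-cong (upd-id ν {n} (free n ≤-refl))
                     (λ i j → trans (upd-row κ n A ∅ i j) (blankRow i j))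

run-compile : ∀ φ → Correct φ
run-compile (at i a t) {β = β} sc fr sm s = run-at {t = t} {β = β} sc fr sm s
run-compile (t ≼ u) {β = β} sc fr sm s = run-≼ {t = t} {u} {β = β} sc fr sm s
run-compile (∼ φ) {β = β} sc fr sm s = run-cond (run-compile φ {β = β} sc fr sm s)
  (λ (e , s) → run-mono ≤-refl (λ (e′ , s) → trans e′ (cong not e) , s) (run-no s))
  (λ (e , s) → run-mono ≤-refl (λ (e′ , s) → trans e′ (cong not e) , s) (run-yes s))
run-compile (φ & ψ) {ν = ν} {κ} {β = β} (sc , sc′) fr sm s = run-cond (run-compile φ {β = β} sc fr sm s)
  (λ (e , s) → run-mono (m≤m+n _ 1) (λ (e′ , s) → trans e′ (cong (_∧ ⟦ ψ ⟧ _ ν κ) e) , s)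
    (run-compile ψ {β = β} sc′ fr sm s))
  (λ (e , s) → run-mono (m≤n⇒m≤o+n _ ≤-refl) (λ (e′ , s) → trans e′ (cong (_∧ ⟦ ψ ⟧ _ ν κ) e) , s)
    (run-no s))
run-compile (ex t φ) {β = β} sc fr sm s = run-ex {t} {φ} (run-compile φ) {β = β} sc fr sm s
run-compile (fix t φ ψ) {β = β} sc fr sm s =
  run-fix {t} {φ} {ψ} (run-compile φ) (run-compile ψ) {β = β} sc fr sm s

-- Formulas decide in polynomial time

-- The base `suc n` is positive, so its powers grow with the exponent even at n = 0; two monomials
-- can then be brought to the exponent `d + d′`.
poly≤ : ∀ p → ∃[ c ] ∃[ d ] ∀ n → ⟪ p ⟫ n ≤ c * suc n ^ d
poly≤ (con c) = c , 0 , λ n → ≤-reflexive (sym (*-identityʳ c))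
poly≤ X       = 1 , 1 , λ n → ≤-trans (n≤1+n n)
  (≤-reflexive (sym (trans (+-identityʳ _) (*-identityʳ (suc n)))))
poly≤ (p ⊞ q) with c , d , f ← poly≤ p | c′ , d′ , g ← poly≤ q =
  c + c′ , d + d′ , λ n → begin
    ⟪ p ⟫ n + ⟪ q ⟫ n                              ≤⟨ +-mono-≤ (f n) (g n) ⟩
    c * suc n ^ d + c′ * suc n ^ d′
      ≤⟨ +-mono-≤ (*-monoʳ-≤ c (^-monoʳ-≤ (suc n) (m≤m+n d d′)))
                  (*-monoʳ-≤ c′ (^-monoʳ-≤ (suc n) (m≤n+m d′ d))) ⟩
    c * suc n ^ (d + d′) + c′ * suc n ^ (d + d′)   ≡⟨ *-distribʳ-+ _ c c′ ⟨
    (c + c′) * suc n ^ (d + d′)                    ∎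
  where open ≤-Reasoning
poly≤ (p ⊠ q) with c , d , f ← poly≤ p | c′ , d′ , g ← poly≤ q =
  c * c′ , d + d′ , λ n → begin
    ⟪ p ⟫ n * ⟪ q ⟫ n                      ≤⟨ *-mono-≤ (f n) (g n) ⟩
    c * suc n ^ d * (c′ * suc n ^ d′)      ≡⟨ [m*n]*[o*p]≡[m*o]*[n*p] c _ c′ _ ⟩
    c * c′ * (suc n ^ d * suc n ^ d′)      ≡⟨ cong (c * c′ *_) (^-distribˡ-+-* (suc n) d d′) ⟨
    c * c′ * suc n ^ (d + d′)              ∎
  where open ≤-Reasoning

-- For positive n the factor 2 absorbs the successor; the summand `2 ^ d` is there for n = 0.
suc^≤ : ∀ n d → suc n ^ d ≤ 2 ^ d * n ^ d + 2 ^ d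
suc^≤ zero d = ≤-trans (≤-trans (≤-reflexive (^-zeroˡ d)) (m^n>0 2 d)) (m≤n+m _ _)
suc^≤ (suc n) d = ≤-trans (go d) (m≤m+n _ _)
  where
  double : suc (suc n) ≤ 2 * suc n
  double = s≤s (≤-trans (m≤m+n (suc n) 0) (m≤n+m (suc n + 0) n))
  go : ∀ d → suc (suc n) ^ d ≤ 2 ^ d * suc n ^ d
  go zero    = ≤-refl
  go (suc d) = ≤-trans (*-mono-≤ double (go d)) (≤-reflexive ([m*n]*[o*p]≡[m*o]*[n*p] 2 (suc n) (2 ^ d) (suc n ^ d)))

poly-bound : ∀ p → ∃[ c ] ∃[ d ] ∀ n → ⟪ p ⟫ n ≤ c * n ^ d + c
poly-bound p with c , d , f ← poly≤ p = c * 2 ^ d , d , λ n → begin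
  ⟪ p ⟫ n                            ≤⟨ f n ⟩
  c * suc n ^ d                      ≤⟨ *-monoʳ-≤ c (suc^≤ n d) ⟩
  c * (2 ^ d * n ^ d + 2 ^ d)        ≡⟨ *-distribˡ-+ c _ _ ⟩
  c * (2 ^ d * n ^ d) + c * 2 ^ d    ≡⟨ cong (_+ c * 2 ^ d) (*-assoc c _ _) ⟨
  c * 2 ^ d * n ^ d + c * 2 ^ d      ∎
  where open ≤-Reasoning

-- Preparing the tapes and assembling the machine

install : ℕ → Prog
install i = move i left ⨾ op i (λ _ → true , ⊢ , stay)

installs : ℕ → Prog
installs zero    = yes!
installs (suc k) = installs k ⨾ install k

-- A loaded tape has nothing to the left of its head. The move therefore creates a new leftmost
-- cell, which becomes cell 0 and takes the marker, and the input starts in cell 1 as `line`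
-- demands.
installed : Tape Cell → Tape Cell
installed t = writeAndShift ␣ (⊢ , stay) (shift ␣ left t)

run-installs : ∀ k {σ} → Run (installs k) σ (1 + k * 2) λ _ τ →
               (∀ i → i < k → τ i ≡ installed (σ i)) × (∀ i → k ≤ i → τ i ≡ σ i)
run-installs zero    {σ} = run-to op ≤-refl ((λ _ ()) , λ i _ → upd-id σ {0} refl i)
run-installs (suc k) {σ} = run-mono (≤-reflexive (cong suc (+-comm (k * 2) 2))) id
  (run-seq (run-installs k) λ {_} {τ} (done , rest) → run-to {time = 2}
    (seq op op) ≤-refl
    ( (λ i → upd-elim (λ i t → i < suc k → t ≡ installed (σ i)) k
        (λ _ → cong (writeAndShift ␣ (⊢ , stay))
          (trans (upd-same τ k _) (cong (λ t → shift ␣ left t) (rest k ≤-refl))))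
        (λ i k≢i i≤k → trans (upd-other τ _ k≢i) (done i (≤∧≢⇒< (s≤s⁻¹ i≤k) (k≢i ∘ sym)))) i)
    , λ i k<i → trans (upd-other _ _ (<⇒≢ k<i))
                  (trans (upd-other τ _ (<⇒≢ k<i)) (rest i (<⇒≤ k<i))) ))

isBlank : Cell → Bool
isBlank ␣ = true
isBlank _ = false

-- Heads 0 and 1 advance together until the input ends. The position of tape 1 then is the input
-- length, from which the formula takes its outermost quantifier bounds.
measure : Prog
measure = while (move 0 right ⨾ cond (test 0 isBlank) no! (move 1 right))

symbolAt : List Symbol → ℕ → Content
symbolAt w = nth nothing (map just w)

contents : List Symbol → ℕ → ℕ → Content
contents w = upd (λ _ _ → nothing) 0 (symbolAt w)

positions : List Symbol → ℕ → ℕ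
positions w = upd (λ _ → 0) 1 (length w)

run-measure : ∀ w {σ} → σ ⊨ (λ _ → 0) , contents w →
              Run (measure ⨾ rewind 0) σ (suc (length w) * 3 + suc (length w + 1) * 4)
                (λ _ τ → τ ⊨ positions w , contents w)
run-measure w s = run-seq
  (run-while I round (length w) (0 , +-identityʳ _ , ⊨-pos (λ { 0 → refl ; 1 → refl ; (2+ _) → refl }) s)) λ s →
  run-mono ≤-refl (⊨-pos λ { 0 → refl ; 1 → refl ; (2+ _) → refl })
    (run-rewind 0 (≤-reflexive (+-comm 1 _)) s)
  where
  at-both : ℕ → ℕ → ℕ → ℕ
  at-both i j = upd (upd (λ _ → 0) 0 i) 1 j
  I : ℕ → State → Set
  I k τ = ∃[ j ] k + j ≡ length w × τ ⊨ at-both j j , contents w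
  Q : State → Set
  Q τ = τ ⊨ at-both (suc (length w)) (length w) , contents w
  past : ∀ w → isBlank (just (symbolAt w (length w))) ≡ true
  past []      = refl
  past (x ∷ w) = past w
  before : ∀ w j k → suc k + j ≡ length w → isBlank (just (symbolAt w j)) ≡ false
  before (x ∷ w) zero    k e = refl
  before (x ∷ w) (suc j) k e = before w j k (trans (sym (+-suc k j)) (suc-injective e))
  before []      j       k ()
  round : ∀ k {σ} → I k σ →
          Run (move 0 right ⨾ cond (test 0 isBlank) no! (move 1 right)) σ 3 (Round I Q k)
  round zero (_ , refl , s) = run-seq (run-right s 0) λ (_ , s) →
    run-cond (run-test s 0 isBlank)
      (λ (_ , s) → run-mono ≤-refl
        (λ { (refl , s) → ⊨-pos (λ { 0 → refl ; 1 → refl ; (2+ _) → refl }) s }) (run-no s))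
      (λ (e , _) → contradiction (trans (sym (past w)) (sym e)) λ ())
  round (suc k) (j , e , s) = run-seq (run-right s 0) λ (_ , s) →
    run-cond (run-test s 0 isBlank)
      (λ (e′ , _) → contradiction (trans e′ (before w j k e)) λ ())
      (λ (_ , s) → run-mono ≤-refl
        (λ { (refl , s) → k , refl , suc j , trans (+-suc k j) e
           , ⊨-pos (λ { 0 → refl ; 1 → refl ; (2+ _) → refl }) s })
        (run-right s 1))

runs⇒PTIME : ∀ p k time (σ₀ : List Symbol → State) (decide : List Symbol → Bool) → width p ≤ suc k →
  (∀ w → prefix (suc k) (σ₀ w) ≡ load ␣ (map (just ∘ just) w) ∷ Vec.replicate k (load ␣ [])) →
  (∀ w → Run p (σ₀ w) (⟪ time ⟫ (length w)) (λ b _ → b ≡ decide w)) →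
  (L : List Symbol → Set) → (∀ w → Reflects (L w) (decide w)) → PTIME L
runs⇒PTIME p k time σ₀ decide width≤ starts runs L reflects
  with c , d , time≤ ← poly-bound time = machine p k , c , d , correct
  where
  correct : ∀ w → let final = run (machine p k) (c * length w ^ d + c) (initial (machine p k) w) in
    ∃[ b ] TuringMachine.verdict (machine p k) (Configuration.state final) ≡ just b × Reflects (L w) b
  correct w with run-to {n} {b} {τ} e n≤ b≡ ← runs w =
    b , cong (TuringMachine.verdict (machine p k) ∘ Configuration.state) halts
      , subst (Reflects (L w)) (sym b≡) (reflects w)
    where
    open ≡-Reasoning
    total = c * length w ^ d + c
    start = config (inj₁ (entry p)) (prefix (suc k) (σ₀ w))
    halts : run (machine p k) total (initial (machine p k) w) ≡ config (inj₂ b) (prefix (suc k) τ)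
    halts = begin
      run (machine p k) total (initial (machine p k) w)
        ≡⟨ cong₂ (run (machine p k)) (sym (m+[n∸m]≡n (≤-trans n≤ (time≤ (length w)))))
             (cong (config (inj₁ (entry p))) (sym (starts w))) ⟩
      run (machine p k) (n + (total ∸ n)) start
        ≡⟨ run-+ (machine p k) n _ _ ⟩
      run (machine p k) (total ∸ n) (run (machine p k) n start)
        ≡⟨ cong (run (machine p k) (total ∸ n)) (machine-steps p k width≤ (exec⇒steps e)) ⟩
      run (machine p k) (total ∸ n) (config (inj₂ b) (prefix (suc k) τ))
        ≡⟨ machine-halted p k (total ∸ n) b _ ⟩
      config (inj₂ b) (prefix (suc k) τ) ∎

module _ (φ : Formula) (scoped : Scoped 2 φ) where

  main : Prog
  main = (measure ⨾ rewind 0) ⨾ compile 2 φ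

  tapes : ℕ
  tapes = width main

  program : Prog
  program = installs (suc tapes) ⨾ main

  width-program : width program ≤ suc tapes
  width-program = ⊔-lub (width-installs (suc tapes) ≤-refl) (n≤1+n tapes)
    where
    width-installs : ∀ k → k ≤ suc tapes → width (installs k) ≤ suc tapes
    width-installs zero    _   = s≤s z≤n
    width-installs (suc k) k<K = ⊔-lub (width-installs k (<⇒≤ k<K)) (⊔-lub k<K k<K)

  time : Poly
  time = con (1 + suc tapes * 2) ⊞
    ((con 1 ⊞ X) ⊠ con 3 ⊞ (con 1 ⊞ (X ⊞ con 1)) ⊠ con 4 ⊞ cost φ X)

  fresh : List Symbol → ℕ → Tape Cell
  fresh w zero    = load ␣ (map (just ∘ just) w)
  fresh w (suc i) = load ␣ []

  -- The machine has no tapes beyond the first suc tapes; the others are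
  -- taken to be marked already.
  σ₀ : List Symbol → State
  σ₀ w i = if i <ᵇ suc tapes then fresh w i else tape [] ⊢ []

  run-program : ∀ w → Run program (σ₀ w) (⟪ time ⟫ (length w))
                  (λ b _ → b ≡ ⟦ φ ⟧ 2 (positions w) (contents w))
  run-program w = run-seq (run-installs (suc tapes)) λ (done , rest) →
    run-seq (run-measure w (ready _ done rest)) λ s →
    run-mono ≤-refl proj₁
      -- At level 2 the positions in scope are 0 and the input length, so `X` bounds them.
      (run-compile φ {β = X} scoped
        ((λ { 1 (s≤s ()) ; (2+ _) _ → refl }) , λ { 1 (s≤s ()) ; (2+ _) _ _ → refl })
        (λ { 0 _ → z≤n ; 1 _ → ≤-refl ; (2+ _) (s≤s (s≤s ())) }) s)
    where
    ready : ∀ τ → (∀ i → i < suc tapes → τ i ≡ installed (σ₀ w i)) →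
            (∀ i → suc tapes ≤ i → τ i ≡ σ₀ w i) → τ ⊨ (λ _ → 0) , contents w
    ready τ done rest = view (λ i → proj₁ (tape-at i)) (λ i → proj₂ (tape-at i))
      where
      loaded : ∀ w → cell (installed (load ␣ (map (just ∘ just) w))) ≗ line (symbolAt w)
      loaded w       zero          = marker w
        where
        marker : ∀ w → cell (installed (load ␣ (map (just ∘ just) w))) 0 ≡ ⊢
        marker []      = refl
        marker (x ∷ w) = refl
      loaded []      (suc zero)    = refl
      loaded []      (2+ j)        = refl
      loaded (x ∷ w) (suc j)       = entries (x ∷ w) j
        where
        entries : ∀ w j → nth ␣ (map (just ∘ just) w) j ≡ just (symbolAt w j)
        entries []      j       = refl
        entries (x ∷ w) zero    = refl
        entries (x ∷ w) (suc j) = entries w j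
      pos-loaded : ∀ w → pos (installed (load ␣ (map (just ∘ just) w))) ≡ 0
      pos-loaded []      = refl
      pos-loaded (x ∷ w) = refl
      first : ∀ i → pos (installed (fresh w i)) ≡ 0 × cell (installed (fresh w i)) ≗ line (contents w i)
      first zero    = pos-loaded w , loaded w
      first (suc i) = refl , λ { 0 → refl ; 1 → refl ; (2+ _) → refl }
      beyond : ∀ i → suc tapes ≤ i → cell (tape [] ⊢ []) ≗ line (contents w i)
      beyond (suc i) _ zero    = refl
      beyond (suc i) _ (suc j) = refl
      tape-at : ∀ i → pos (τ i) ≡ 0 × cell (τ i) ≗ line (contents w i)
      tape-at i with i <? suc tapes
      ... | yes i<K rewrite done i i<K with i <ᵇ suc tapes | <⇒<ᵇ i<K
      ...   | true | _ = first i
      tape-at i | no i≮K rewrite rest i (≮⇒≥ i≮K) with i <ᵇ suc tapes in e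
      ...   | false = refl , beyond i (≮⇒≥ i≮K)
      ...   | true  = ⊥-elim (i≮K (<ᵇ⇒< i (suc tapes) (subst T (sym e) _)))

  prefix-σ₀ : ∀ w → prefix (suc tapes) (σ₀ w) ≡
              load ␣ (map (just ∘ just) w) ∷ Vec.replicate tapes (load ␣ [])
  prefix-σ₀ w = cong (load ␣ (map (just ∘ just) w) ∷_) (go tapes (λ i → if i <ᵇ tapes then load ␣ [] else tape [] ⊢ [])
    λ i i<k → blank i i<k)
    where
    go : ∀ k σ → (∀ i → i < k → σ i ≡ load ␣ []) → prefix k σ ≡ Vec.replicate k (load ␣ [])
    go zero    σ e = refl
    go (suc k) σ e = cong₂ _∷_ (e 0 (s≤s z≤n)) (go k (σ ∘ suc) (λ i l → e (suc i) (s≤s l)))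
    blank : ∀ i → i < tapes → (if i <ᵇ tapes then load ␣ [] else tape [] ⊢ []) ≡ load ␣ []
    blank i i<k with i <ᵇ tapes | <⇒<ᵇ i<k
    ... | true | _ = refl

  formula⇒PTIME : (L : List Symbol → Set) →
    (∀ w → Reflects (L w) (⟦ φ ⟧ 2 (positions w) (contents w))) → PTIME L
  formula⇒PTIME = runs⇒PTIME program tapes time σ₀ (λ w → ⟦ φ ⟧ 2 (positions w) (contents w))
    width-program prefix-σ₀ run-program

-- Fixpoints compute reachability

has-reflects : ∀ a c → Reflects (c ≡ just a) (has a c)
has-reflects 𝟎 (just 𝟎) = ofʸ refl
has-reflects 𝟎 (just 𝟏) = ofⁿ λ ()
has-reflects 𝟎 (just ♯) = ofⁿ λ ()
has-reflects 𝟎 nothing  = ofⁿ λ ()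
has-reflects 𝟏 (just 𝟎) = ofⁿ λ ()
has-reflects 𝟏 (just 𝟏) = ofʸ refl
has-reflects 𝟏 (just ♯) = ofⁿ λ ()
has-reflects 𝟏 nothing  = ofⁿ λ ()
has-reflects ♯ (just 𝟎) = ofⁿ λ ()
has-reflects ♯ (just 𝟏) = ofⁿ λ ()
has-reflects ♯ (just ♯) = ofʸ refl
has-reflects ♯ nothing  = ofⁿ λ ()

reflected : ∀ {P : Set} {b} → Reflects P b → b ≡ true → P
reflected (ofʸ p) refl = p

reflects-true : ∀ {P : Set} {b} → Reflects P b → P → b ≡ true
reflects-true (ofʸ _)  p = refl
reflects-true (ofⁿ ¬p) p = contradiction p ¬p

module Closure {n : ℕ} (R : Fin n → Fin n → Set) (s : Fin n)
  (step : ℕ → (ℕ → Content) → ℕ → Bool) where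

  Marked : (ℕ → Content) → Fin n → Set
  Marked A x = A (toℕ x) ≡ just 𝟏

  Due : (ℕ → Content) → Fin n → Set
  Due A x = x ≡ s ⊎ ∃[ y ] Marked A y × R y x

  module _ (step-reflects : ∀ r A x → Reflects (Due A x) (step r A (toℕ x))) where

    Sound Closed : (ℕ → Content) → Set
    Sound A  = ∀ x → Marked A x → Star R s x
    Closed A = ∀ x → Due A x → Marked A x

    mark⁺ : ∀ A k x → toℕ x ≡ k ⊎ Marked A x → Marked (upd A k (just 𝟏)) x
    mark⁺ A k x (inj₁ refl) = upd-same A (toℕ x) _
    mark⁺ A k x (inj₂ m) with k ≟ toℕ x
    ... | yes refl = upd-same A k _
    ... | no k≢x   = trans (upd-other A _ k≢x) m

    mark⁻ : ∀ A k x → Marked (upd A k (just 𝟏)) x → toℕ x ≡ k ⊎ Marked A x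
    mark⁻ A k x m with k ≟ toℕ x
    ... | yes k≡x = inj₁ (sym k≡x)
    ... | no k≢x  = inj₂ (trans (sym (upd-other A _ k≢x)) m)

    due-mono : ∀ A B → (∀ x → Marked A x → Marked B x) → ∀ {x} → Due A x → Due B x
    due-mono A B f (inj₁ e)           = inj₁ e
    due-mono A B f (inj₂ (y , m , r)) = inj₂ (y , f y m , r)

    step-due : ∀ {r A k} (k<n : k < n) → step r A k ≡ true → Due A (fromℕ< k<n)
    step-due {r} {A} k<n e = reflected (step-reflects r A (fromℕ< k<n))
      (trans (cong (step r A) (toℕ-fromℕ< k<n)) e)

    sweep-marks : ∀ {r} k A x → Marked A x → Marked (sweep (step r) k A) x
    sweep-marks         zero    A x m = m
    sweep-marks {r = r} (suc k) A x m with step r A k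
    ... | false = sweep-marks k A x m
    ... | true  = sweep-marks k _ x (mark⁺ A k x (inj₂ m))

    sweep-sound : ∀ {r} k A → k ≤ n → Sound A → Sound (sweep (step r) k A)
    sweep-sound         zero    A k≤n so = so
    sweep-sound {r = r} (suc k) A k<n so with step r A k in e
    ... | false = sweep-sound k A (<⇒≤ k<n) so
    ... | true  = sweep-sound k _ (<⇒≤ k<n) λ x m → case x (mark⁻ A k x m)
      where
      reach : ∀ {x} → Due A x → Star R s x
      reach (inj₁ refl)        = ε
      reach (inj₂ (y , m , r)) = so y m ◅◅ r ◅ ε
      case : ∀ x → toℕ x ≡ k ⊎ Marked A x → Star R s x
      case x (inj₂ m)   = so x m
      case x (inj₁ x≡k) = reach (subst (Due A) (Fin.toℕ-injective (trans (toℕ-fromℕ< k<n) (sym x≡k)))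
                                       (step-due k<n e))

    sweep-closed : ∀ {r} k A → k ≤ n → Closed A → ∀ x → Marked (sweep (step r) k A) x → Marked A x
    sweep-closed         zero    A k≤n cl x m = m
    sweep-closed {r = r} (suc k) A k<n cl x m with step r A k in e
    ... | false = sweep-closed k A (<⇒≤ k<n) cl x m
    ... | true  = back′ x (sweep-closed k _ (<⇒≤ k<n)
                    (λ y d → mark⁺ A k y (inj₂ (cl y (due-mono (upd A k (just 𝟏)) A back′ d)))) x m)
      where
      back′ : ∀ y → Marked (upd A k (just 𝟏)) y → Marked A y
      back′ y m with mark⁻ A k y m
      ... | inj₂ m′  = m′
      ... | inj₁ y≡k = subst (Marked A) (Fin.toℕ-injective (trans (toℕ-fromℕ< k<n) (sym y≡k)))
                             (cl _ (step-due k<n e))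

    -- The sweep marks every due vertex that it meets, and marks are never lost. Hence a sweep that
    -- adds nothing shows that everything due was marked beforehand.
    progress : ∀ {r} k A → k ≤ n →
               (∀ x → toℕ x < k → Due A x → Marked A x) ⊎
               (∃[ x ] ¬ Marked A x × Marked (sweep (step r) k A) x)
    progress         zero    A k≤n = inj₁ λ _ ()
    progress {r = r} (suc k) A k<n with step r A k in e
    progress {r = r} (suc k) A k<n | false with progress {r} k A (<⇒≤ k<n)
    ... | inj₂ new = inj₂ new
    ... | inj₁ cl  = inj₁ below
      where
      below : ∀ x → toℕ x < suc k → Due A x → Marked A x
      below x (s≤s x≤k) d with m≤n⇒m<n∨m≡n x≤k
      ... | inj₁ x<k = cl x x<k d
      ... | inj₂ refl = contradiction (trans (sym e) (reflects-true (step-reflects r A x) d)) λ ()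
    progress {r = r} (suc k) A k<n | true with has 𝟏 (A k) | has-reflects 𝟏 (A k)
    ... | _ | ofⁿ ¬m = inj₂ (x , ¬m ∘ subst (λ i → A i ≡ just 𝟏) (toℕ-fromℕ< k<n) ,
                             sweep-marks k _ x (mark⁺ A k x (inj₁ (toℕ-fromℕ< k<n))))
      where x = fromℕ< k<n
    -- Marking `k` a second time changes the function only intensionally; `same` carries the outcome
    -- for it back to `A`.
    ... | _ | ofʸ m with progress {r} k (upd A k (just 𝟏)) (<⇒≤ k<n)
    ...   | inj₂ (x , ¬m , m′) = inj₂ (x , ¬m ∘ mark⁺ A k x ∘ inj₂ , m′)
    ...   | inj₁ cl = inj₁ below
      where
      same : ∀ x → Marked (upd A k (just 𝟏)) x → Marked A x
      same x m′ with mark⁻ A k x m′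
      ... | inj₁ x≡k = trans (cong A x≡k) m
      ... | inj₂ m″  = m″
      below : ∀ x → toℕ x < suc k → Due A x → Marked A x
      below x (s≤s x≤k) d with m≤n⇒m<n∨m≡n x≤k
      ... | inj₁ x<k  = same x (cl x x<k (due-mono A (upd A k (just 𝟏)) (λ y → mark⁺ A k y ∘ inj₂) d))
      ... | inj₂ refl = m

    marks : (ℕ → Content) → Subset n
    marks A = tabulate (has 𝟏 ∘ A ∘ toℕ)

    ∈marks⁺ : ∀ A x → Marked A x → x ∈ marks A
    ∈marks⁺ A x m = lookup⇒[]= x _ (trans (lookup∘tabulate _ x) (cong (has 𝟏) m))

    ∈marks⁻ : ∀ A x → x ∈ marks A → Marked A x
    ∈marks⁻ A x p = reflected (has-reflects 𝟏 (A (toℕ x)))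
      (trans (sym (lookup∘tabulate _ x)) ([]=⇒lookup p))

    rounds-closed : ∀ r A → Closed A → Closed (rounds step n r A)
    rounds-closed zero    A cl = cl
    rounds-closed (suc r) A cl = rounds-closed r (sweep (step r) n A) λ x d →
      sweep-marks n A x (cl x (due-mono (sweep (step r) n A) A (sweep-closed n A ≤-refl cl) d))

    rounds-sound : ∀ r A → Sound A → Sound (rounds step n r A)
    rounds-sound zero    A so = so
    rounds-sound (suc r) A so = rounds-sound r _ (sweep-sound n A ≤-refl so)

    -- The number of marks is a potential. Either some round meets a closed set, which later rounds
    -- keep, or every round raises it.
    rounds-progress : ∀ r A → Closed (rounds step n r A) ⊎
                              r + ∣ marks A ∣ ≤ ∣ marks (rounds step n r A) ∣
    rounds-progress zero    A = inj₂ ≤-refl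
    rounds-progress (suc r) A with progress {r} n A ≤-refl
    ... | inj₁ cl = inj₁ (rounds-closed (suc r) A λ x → cl x (toℕ<n x))
    ... | inj₂ (x , ¬m , m) with rounds-progress r (sweep (step r) n A)
    ...   | inj₁ cl = inj₁ cl
    ...   | inj₂ le = inj₂ (≤-trans (≤-trans (≤-reflexive (sym (+-suc r _))) (+-monoʳ-≤ r more′)) le)
      where
      more′ : ∣ marks A ∣ < ∣ marks (sweep (step r) n A) ∣
      more′ = p⊂q⇒∣p∣<∣q∣
        ( (λ {y} p → ∈marks⁺ (sweep (step r) n A) y (sweep-marks n A y (∈marks⁻ A y p)))
        , x , ∈marks⁺ (sweep (step r) n A) x m , ¬m ∘ ∈marks⁻ A x )

    fixpoint : ℕ → Content
    fixpoint = rounds step n n ∅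

    -- If all `n` rounds add a mark, every vertex is marked and the set is closed trivially.
    fixpoint-closed : Closed fixpoint
    fixpoint-closed with rounds-progress n ∅
    ... | inj₁ cl = cl
    ... | inj₂ le = λ x _ → ∈marks⁻ fixpoint x (subst (x ∈_) (sym full) ∈⊤)
      where
      full = ∣p∣≡n⇒p≡⊤ (≤-antisym (∣p∣≤n (marks fixpoint)) (≤-trans (m≤m+n n _) le))

    fixpoint-reflects : ∀ x → Reflects (Star R s x) (has 𝟏 (fixpoint (toℕ x)))
    fixpoint-reflects x with has 𝟏 (fixpoint (toℕ x)) | has-reflects 𝟏 (fixpoint (toℕ x))
    ... | _ | ofʸ m  = ofʸ (rounds-sound n ∅ (λ _ ()) x m)
    ... | _ | ofⁿ ¬m = ofⁿ λ p → ¬m (complete ε (fixpoint-closed s (inj₁ refl)) p)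
      where
      complete : ∀ {u v} → Star R s u → Marked fixpoint u → Star R u v → Marked fixpoint v
      complete p m ε       = m
      complete p m (r ◅ q) = complete (p ◅◅ r ◅ ε) (fixpoint-closed _ (inj₂ (_ , m , r))) q

-- The 2-SAT criterion

HasSize2 : ∀ {n} → (Fin n → Set) → Set
HasSize2 P = ∃[ x ] ∃[ y ] x ≢ y × P x × P y × (∀ z → P z → z ≡ x ⊎ z ≡ y)

module Tours {n k : ℕ} (E : Fin n → Fin n → Set) (v₀ : Fin n) (F : Fin k → Fin n → Set) where

  Visits : Set
  Visits = Σ[ π ∈ (ℕ → Fin n) ] π 0 ≡ v₀ × (∀ i → E (π i) (π (suc i))) × (∀ i → ∃[ p ] F i (π p))

  -- `Compatible u u` amounts to reachability of `u` from `v₀`. An unreachable vertex is thus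
  -- incompatible with itself, so unit clauses are covered by the same relation.
  Compatible : Fin n → Fin n → Set
  Compatible u w = Star E v₀ u × Star E v₀ w × (Star E u w ⊎ Star E w u)

  Pair : Fin n → Fin n → Set
  Pair x y = x ≢ y × ∃[ i ] F i x × F i y

  -- Visiting u excludes w, hence requires v.
  Force : Fin n → Fin n → Set
  Force u v = ∃[ w ] ¬ Compatible u w × Pair w v

  -- In the implication graph, `x` leads to its own negation: forcing takes it to `a`, and the
  -- incompatibility is the final implication from `a` to not `x`.
  Bad : Fin n → Set
  Bad x = ∃[ a ] Star Force x a × ¬ Compatible a x

  -- A pair with two bad members closes the cycle from x to not x, to y, to not y and back to x,
  -- which is the usual obstruction to satisfying a 2-SAT instance.
  Winnable : Set
  Winnable = ∀ x y → Pair x y → ¬ (Bad x × Bad y)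

  compatible-sym : ∀ {u w} → Compatible u w → Compatible w u
  compatible-sym (p , q , r) = q , p , swap r

  pair-sym : ∀ {x y} → Pair x y → Pair y x
  pair-sym (x≢y , i , p , q) = x≢y ∘ sym , i , q , p

  module _ (size2 : ∀ i → HasSize2 (F i)) where

    pair-covers : ∀ {x y i} → x ≢ y → F i x → F i y → ∀ z → F i z → z ≡ x ⊎ z ≡ y
    pair-covers {i = i} x≢y fx fy z fz with size2 i
    ... | a , b , _ , _ , _ , only with only _ fx | only _ fy | only _ fz
    ...   | inj₁ refl | inj₁ refl | _         = contradiction refl x≢y
    ...   | inj₂ refl | inj₂ refl | _         = contradiction refl x≢y
    ...   | inj₁ refl | inj₂ refl | z≡        = z≡
    ...   | inj₂ refl | inj₁ refl | z≡        = swap z≡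

    -- The vertices met at the chosen times satisfy all clauses: they lie on one path, hence are
    -- pairwise compatible, and they contain a member of each pair. So they are closed under
    -- forcing, and a bad vertex among them would be accompanied by a vertex incompatible with it.
    visits⇒winnable : Visits → Winnable
    visits⇒winnable (π , π0≡v₀ , edges , visits) x y pair ((a , x⇒a , ¬ax) , (b , y⇒b , ¬by)) =
      [ (λ sx → ¬ax (compatible (forced sx x⇒a) sx))
      , (λ sy → ¬by (compatible (forced sy y⇒b) sy)) ]′ (chosen x y pair)
      where
      S : Fin n → Set
      S u = ∃[ i ] u ≡ π (proj₁ (visits i))
      chosen : ∀ x y → Pair x y → S x ⊎ S y
      chosen x y (x≢y , i , fx , fy) with pair-covers x≢y fx fy _ (proj₂ (visits i))
      ... | inj₁ e = inj₁ (i , sym e)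
      ... | inj₂ e = inj₂ (i , sym e)
      along : ∀ p d → Star E (π p) (π (d + p))
      along p zero    = ε
      along p (suc d) = along p d ◅◅ edges (d + p) ◅ ε
      between : ∀ {p q} → p ≤ q → Star E (π p) (π q)
      between {p} {q} p≤q = subst (λ q → Star E (π p) (π q)) (m∸n+n≡m p≤q) (along p (q ∸ p))
      compatible : ∀ {u w} → S u → S w → Compatible u w
      compatible (i , refl) (j , refl) = from-v₀ , from-v₀ , comparable
        where
        from-v₀ : ∀ {p} → Star E v₀ (π p)
        from-v₀ = subst (λ v → Star E v _) π0≡v₀ (between z≤n)
        comparable : Star E _ _ ⊎ Star E _ _
        comparable with ≤-total (proj₁ (visits i)) (proj₁ (visits j))
        ... | inj₁ le = inj₁ (between le)
        ... | inj₂ le = inj₂ (between le)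
      forced : ∀ {u v} → S u → Star Force u v → S v
      forced s ε = s
      forced s ((w , ¬uw , pair) ◅ p) with chosen _ _ pair
      ... | inj₁ sw = contradiction (compatible s sw) ¬uw
      ... | inj₂ sv = forced sv p

  -- From satisfying selections to infinite paths

  record Path (v : Fin n) (P : Fin n → Set) : Set where
    field
      π     : ℕ → Fin n
      start : π 0 ≡ v
      edges : ∀ i → E (π i) (π (suc i))
      meets : ∀ x → P x → ∃[ p ] π p ≡ x

  prepend : ∀ {u v P} → Star E u v → Path v P → Path u P
  prepend ε       p = p
  prepend {u} {P = P} (e ◅ s) p = extend e (prepend s p)
    where
    extend : ∀ {v} → E u v → Path v P → Path u P
    extend e p = record
      { π     = λ { zero → u ; (suc i) → Path.π p i }
      ; start = refl
      ; edges = λ { zero → subst (E u) (sym (Path.start p)) e ; (suc i) → Path.edges p i }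
      ; meets = λ x m → suc (proj₁ (Path.meets p x m)) , proj₂ (Path.meets p x m)
      }

  data Tour : Fin n → List (Fin n) → Set where
    []  : ∀ {v} → Tour v []
    _∷_ : ∀ {v x xs} → Star E v x → Tour x xs → Tour v (x ∷ xs)

  -- One step of an insertion sort along the reachability preorder: `c` goes before the first stop
  -- that it reaches. Every stop passed on the way reaches `c`, which renews the hypothesis that the
  -- current start does.
  insert : ∀ {v xs} (S : Fin n → Set) c → S c → (∀ x → S x → Star E c x ⊎ Star E x c) →
           Star E v c → All S xs → Tour v xs →
           ∃[ ys ] Tour v ys × All S ys × c ∈ₗ ys × (∀ {x} → x ∈ₗ xs → x ∈ₗ ys)
  insert S c sc cmp v→c []        []      = c ∷ [] , v→c ∷ [] , sc ∷ [] , here refl , λ ()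
  insert S c sc cmp v→c (sx ∷ ss) (p ∷ t) with cmp _ sx
  ... | inj₁ c→x = _ , v→c ∷ c→x ∷ t , sc ∷ sx ∷ ss , here refl , there
  ... | inj₂ x→c with insert S c sc cmp x→c ss t
  ...   | ys , t′ , ss′ , c∈ , ⊆ =
    _ , p ∷ t′ , sx ∷ ss′ , there c∈ , λ { (here e) → here e ; (there m) → there (⊆ m) }

  tour : ∀ {S : Fin n → Set} → (∀ {u w} → S u → S w → Compatible u w) →
         ∀ xs → All S xs → ∃[ ys ] Tour v₀ ys × All S ys × (∀ {x} → x ∈ₗ xs → x ∈ₗ ys)
  tour compatible []       []        = [] , [] , [] , λ ()
  tour {S} compatible (x ∷ xs) (sx ∷ ss) with tour compatible xs ss
  ... | ys , t , ss′ , ⊆ with insert S x sx (λ y sy → proj₂ (proj₂ (compatible sx sy)))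
                                (proj₁ (compatible sx sx)) ss′ t
  ...   | zs , t′ , ss″ , x∈ , ⊆′ =
    zs , t′ , ss″ , λ { (here refl) → x∈ ; (there m) → ⊆′ (⊆ m) }

  module _ (total : ∀ u → ∃[ v ] E u v) where

    follow : ∀ {v xs} → Tour v xs → Path v (_∈ₗ xs)
    follow {v} [] = record { π = π ; start = refl ; edges = λ i → proj₂ (total (π i)) ; meets = λ _ () }
      where
      π : ℕ → Fin n
      π zero    = v
      π (suc i) = proj₁ (total (π i))
    follow (p ∷ t) with follow t
    ... | q = prepend p (record
      { π = Path.π q ; start = Path.start q ; edges = Path.edges q
      ; meets = λ { _ (here refl) → 0 , Path.start q ; x (there m) → Path.meets q x m } })

    module _ (size2 : ∀ i → HasSize2 (F i))
      (compatible? : ∀ u w → Dec (Compatible u w)) (force? : ∀ x a → Dec (Star Force x a)) where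

      bad? : ∀ x → Dec (Bad x)
      bad? x = any? λ a → force? x a ×-dec ¬? (compatible? a x)

      -- The implications u ⇒ v of Force come from pairs of clauses, so they
      -- can be read backwards.
      contrapose : ∀ {S : Fin n → Set} → (∀ {u v} → S u → Force u v → S v) →
                   ∀ {x c a} → S a → Star Force x c → ¬ Compatible a c →
                   ∃[ a′ ] S a′ × ¬ Compatible a′ x
      contrapose closed sa ε ¬ac = _ , sa , ¬ac
      contrapose closed sa ((w , ¬xw , pair) ◅ p) ¬ac with contrapose closed sa p ¬ac
      ... | a′ , sa′ , ¬a′x₁ =
        w , closed sa′ (_ , ¬a′x₁ , pair-sym pair) , ¬xw ∘ compatible-sym

      -- A partial solution of the 2-SAT instance. Being closed under forcing, it can be enlarged
      -- without revising earlier picks.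
      record Selection (S : Fin n → Set) : Set where
        field
          dec        : ∀ u → Dec (S u)
          compatible : ∀ {u w} → S u → S w → Compatible u w
          closed     : ∀ {u v} → S u → Force u v → S v

      open Selection

      -- Suppose that `c` forces a vertex incompatible with a member of `S`. By contraposition some
      -- member of `S` is incompatible with `c`, hence forces `d` into `S`. If instead two vertices
      -- forced by `c` are incompatible, contraposition gives a forced vertex incompatible with `c`,
      -- so that `c` is bad.
      grow : ∀ {S} → Selection S → ∀ {c d} → Pair c d → ¬ S d → ¬ Bad c →
             Selection (λ u → S u ⊎ Star Force c u)
      grow {S} sel {c} {d} pair ¬sd ¬bad = record
        { dec        = λ u → dec sel u ⊎-dec force? c u
        ; compatible = λ
          { (inj₁ su) (inj₁ sw) → compatible sel su sw
          ; (inj₁ su) (inj₂ cw) → cross su cw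
          ; (inj₂ cu) (inj₁ sw) → compatible-sym (cross sw cu)
          ; (inj₂ cu) (inj₂ cw) → inner cu cw }
        ; closed     = λ { (inj₁ su) f → inj₁ (closed sel su f) ; (inj₂ cu) f → inj₂ (cu ◅◅ f ◅ ε) }
        }
        where
        cross : ∀ {u w} → S u → Star Force c w → Compatible u w
        cross su cw = decidable-stable (compatible? _ _) λ ¬uw →
          let a , sa , ¬ac = contrapose (closed sel) su cw ¬uw in ¬sd (closed sel sa (c , ¬ac , pair))
        inner : ∀ {u w} → Star Force c u → Star Force c w → Compatible u w
        inner cu cw = decidable-stable (compatible? _ _) λ ¬uw →
          ¬bad (contrapose (λ p f → p ◅◅ f ◅ ε) cu cw ¬uw)

      -- A greedy choice suffices: when a pair is not yet met, one of its members is not bad, and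
      -- that member can be added together with all that it forces.
      select : Winnable → ∀ is → ∃[ S ] Selection S × All (λ i → ∃[ x ] F i x × S x) is
      select win [] = const ⊥ , record { dec = λ _ → no λ () ; compatible = λ () ; closed = λ () } , []
      select win (i ∷ is) with select win is
      ... | S , sel , hits with size2 i
      ...   | x , y , x≢y , fx , fy , _ with dec sel x | dec sel y | bad? x
      ...     | yes sx | _      | _       = S , sel , (x , fx , sx) ∷ hits
      ...     | no _   | yes sy | _       = S , sel , (y , fy , sy) ∷ hits
      ...     | no _   | no ¬sy | no ¬bad = _ , grow sel (x≢y , i , fx , fy) ¬sy ¬bad
                , (x , fx , inj₂ ε) ∷ All.map (λ (z , fz , sz) → z , fz , inj₁ sz) hits
      ...     | no ¬sx | no _   | yes bad = _
                , grow sel (x≢y ∘ sym , i , fy , fx) ¬sx (λ bad′ → win x y (x≢y , i , fx , fy) (bad , bad′))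
                , (y , fy , inj₂ ε) ∷ All.map (λ (z , fz , sz) → z , fz , inj₁ sz) hits

      winnable⇒visits : Winnable → Visits
      winnable⇒visits win with select win (allFin k)
      ... | S , sel , hits with tour (compatible sel) (map (proj₁ ∘ hit) (allFin k))
                                     (All.map⁺ (All.universal (λ i → proj₂ (proj₂ (hit i))) (allFin k)))
        where
        hit : ∀ i → ∃[ x ] F i x × S x
        hit i = All.lookup hits (∈-allFin i)
      ...   | ys , t , _ , ⊆ = Path.π path , Path.start path , Path.edges path , λ i →
        let p , e = Path.meets path (proj₁ (hit i)) (⊆ (∈-map⁺ (proj₁ ∘ hit) (∈-allFin i)))
        in p , subst (F i) (sym e) (proj₁ (proj₂ (hit i)))
        where
        path = follow t
        hit : ∀ i → ∃[ x ] F i x × S x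
        hit i = All.lookup hits (∈-allFin i)

-- Strategies and plays

x∉p-x : ∀ {n} (p : Subset n) x → x ∉ p - x
x∉p-x (_ ∷ p) (suc x) (there x∈) = x∉p-x p x x∈
x∉p-x (inside  ∷ p) zero ()
x∉p-x (outside ∷ p) zero ()

∣p∣≡1+∣p-x∣ : ∀ {n} {p : Subset n} {x} → x ∈ p → ∣ p ∣ ≡ suc ∣ (p - x) ∣
∣p∣≡1+∣p-x∣ {p = inside ∷ p} here        = cong (suc ∘ ∣_∣) (sym (p─⊥≡p p))
∣p∣≡1+∣p-x∣ {p = inside ∷ p} (there x∈)  = cong suc (∣p∣≡1+∣p-x∣ x∈)
∣p∣≡1+∣p-x∣ {p = outside ∷ p} (there x∈) = ∣p∣≡1+∣p-x∣ x∈

Empty⇒∣p∣≡0 : ∀ {n} {p : Subset n} → Empty p → ∣ p ∣ ≡ 0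
Empty⇒∣p∣≡0 {n} e = trans (cong ∣_∣ (Empty-unique e)) (∣⊥∣≡0 n)

∣p∣≡0⇒Empty : ∀ {n} {p : Subset n} → ∣ p ∣ ≡ 0 → Empty p
∣p∣≡0⇒Empty e (x , x∈p) = contradiction (trans (sym e) (∣p∣≡1+∣p-x∣ x∈p)) λ ()

∣p∣≡suc⇒Nonempty : ∀ {n m} {p : Subset n} → ∣ p ∣ ≡ suc m → Nonempty p
∣p∣≡suc⇒Nonempty {p = p} e with nonempty? p
... | yes ne = ne
... | no ¬ne = contradiction (trans (sym (Empty⇒∣p∣≡0 ¬ne)) e) λ ()

∣p∣≡2⇒size2 : ∀ {n} {p : Subset n} → ∣ p ∣ ≡ 2 → HasSize2 (_∈ p)
∣p∣≡2⇒size2 {p = p} e with ∣p∣≡suc⇒Nonempty e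
... | x , x∈p with e′ ← suc-injective (trans (sym (∣p∣≡1+∣p-x∣ x∈p)) e) with ∣p∣≡suc⇒Nonempty e′
...   | y , y∈ = x , y , (λ { refl → x∉p-x p x y∈ }) , x∈p , p─q⊆p p _ y∈ , only
  where
  only : ∀ z → z ∈ p → z ≡ x ⊎ z ≡ y
  only z z∈p with z Fin.≟ x | z Fin.≟ y
  ... | yes z≡x | _ = inj₁ z≡x
  ... | no _ | yes z≡y = inj₂ z≡y
  ... | no z≢x | no z≢y = ⊥-elim (∣p∣≡0⇒Empty (suc-injective (trans (sym (∣p∣≡1+∣p-x∣ y∈)) e′))
    (z , x∈p∧x≢y⇒x∈p-y (x∈p∧x≢y⇒x∈p-y z∈p z≢x) z≢y))

size2⇒∣p∣≡2 : ∀ {n} {p : Subset n} → HasSize2 (_∈ p) → ∣ p ∣ ≡ 2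
size2⇒∣p∣≡2 {p = p} (x , y , x≢y , x∈p , y∈p , only) = begin
  ∣ p ∣                ≡⟨ ∣p∣≡1+∣p-x∣ x∈p ⟩
  1 + ∣ (p - x) ∣        ≡⟨ cong suc (∣p∣≡1+∣p-x∣ (x∈p∧x≢y⇒x∈p-y y∈p (x≢y ∘ sym))) ⟩
  2 + ∣ (p - x - y) ∣    ≡⟨ cong (2 +_) (Empty⇒∣p∣≡0 empty) ⟩
  2                    ∎
  where
  open ≡-Reasoning
  empty : Empty (p - x - y)
  empty (z , z∈) with only z (p─q⊆p p _ (p─q⊆p (p - x) _ z∈))
  ... | inj₁ refl = x∉p-x p x (p─q⊆p (p - x) _ z∈)
  ... | inj₂ refl = x∉p-x (p - x) y z∈

module _ (G : Instance) where
  open Instance G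
  open Tours {size} {k} Edge v₀ (λ i x → x ∈ lookup F i)

  module _ (one-player : OnePlayer arena) where

    -- A strategy of Eve yields a play only against some strategy of Adam; with no vertices to
    -- control, he has this vacuous one.
    adam : Strategy arena V□
    adam = record
      { move  = λ _ v v∈ → ⊥-elim (one-player (v , v∈))
      ; legal = λ _ v v∈ → ⊥-elim (one-player (v , v∈))
      }

    eveWins⇒visits : EveWins arena (GenReach arena F) v₀ → Visits
    eveWins⇒visits (σ , wins) = Play.vertex π , refl , Play.edge π , wins adam
      where π = outcome arena v₀ σ adam

    visits⇒eveWins : Visits → EveWins arena (GenReach arena F) v₀
    visits⇒eveWins (π , π0≡v₀ , edges , visits) = σ , λ τ i →
      let p , m = visits i in p , subst (_∈ lookup F i) (sym (on-track τ p)) m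
      where
      -- The length of the history is the time, so a path that revisits vertices can be followed.
      -- Histories off the path still need a legal move, which `total` supplies.
      choose : List V → (v : V) → Σ[ v′ ∈ V ] Edge v v′
      choose w v with π (length w) Fin.≟ v
      ... | yes refl = π (suc (length w)) , edges (length w)
      ... | no _     = total v
      choose-π : ∀ {i} w → length w ≡ i → proj₁ (choose w (π i)) ≡ π (suc i)
      choose-π w refl with π (length w) Fin.≟ π (length w)
      ... | yes refl = refl
      ... | no ¬p    = contradiction refl ¬p
      σ : Strategy arena V○
      σ = record { move = λ w v _ → proj₁ (choose w v) ; legal = λ w v _ → proj₂ (choose w v) }
      module _ (τ : Strategy arena V□) where
        length-history : ∀ i → length (history arena v₀ σ τ i) ≡ i
        length-history zero    = refl
        length-history (suc i) = trans (length-++ (history arena v₀ σ τ i))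
          (trans (+-comm _ 1) (cong suc (length-history i)))
        next-choose : ∀ w v → proj₁ (next arena v₀ σ τ w v) ≡ proj₁ (choose w v)
        next-choose w v with v ∈? V○
        ... | yes _   = refl
        ... | no v∉V○ = ⊥-elim (one-player (v , x∉p⇒x∈∁p v∉V○))
        on-track : ∀ i → current arena v₀ σ τ i ≡ π i
        on-track zero    = sym π0≡v₀
        on-track (suc i) = begin
          current arena v₀ σ τ (suc i)       ≡⟨ next-choose h _ ⟩
          proj₁ (choose h (current arena v₀ σ τ i))
            ≡⟨ cong (λ v → proj₁ (choose h v)) (on-track i) ⟩
          proj₁ (choose h (π i))             ≡⟨ choose-π h (length-history i) ⟩
          π (suc i)                          ∎
          where
          open ≡-Reasoning
          h = history arena v₀ σ τ i

-- Encodings of games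

symbolAt-++ˡ : ∀ v w {i} → i < length v → symbolAt (v ++ w) i ≡ symbolAt v i
symbolAt-++ˡ (x ∷ v) w {zero}  _         = refl
symbolAt-++ˡ (x ∷ v) w {suc i} (s≤s i<v) = symbolAt-++ˡ v w i<v

symbolAt-++ʳ : ∀ v w i → symbolAt (v ++ w) (length v + i) ≡ symbolAt w i
symbolAt-++ʳ []      w i = refl
symbolAt-++ʳ (x ∷ v) w i = symbolAt-++ʳ v w i

symbolAt-just : ∀ w {i} → i < length w → ∃[ s ] symbolAt w i ≡ just s
symbolAt-just (x ∷ w) {zero}  _         = x , refl
symbolAt-just (x ∷ w) {suc i} (s≤s i<w) = symbolAt-just w i<w

symbolAt-ext : ∀ v w → length v ≡ length w → (∀ i → i < length v → symbolAt v i ≡ symbolAt w i) → v ≡ w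
symbolAt-ext []      []      e f = refl
symbolAt-ext (x ∷ v) (y ∷ w) e f = cong₂ _∷_ (just-injective (f 0 (s≤s z≤n)))
  (symbolAt-ext v w (suc-injective e) (λ i i<v → f (suc i) (s≤s i<v)))

length-encodeSubset : ∀ {n} (p : Subset n) → length (encodeSubset p) ≡ suc n
length-encodeSubset {n} p = begin
  length (map bit (toList p) ++ ♯ ∷ [])    ≡⟨ length-++ (map bit (toList p)) ⟩
  length (map bit (toList p)) + 1          ≡⟨ cong (_+ 1) (trans (length-map bit (toList p)) (length-toList p)) ⟩
  n + 1                                    ≡⟨ +-comm n 1 ⟩
  suc n                                    ∎
  where open ≡-Reasoning

length-encodeSubsets : ∀ {n m} (ps : Vec (Subset n) m) → length (encodeSubsets ps) ≡ m * suc n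
length-encodeSubsets []       = refl
length-encodeSubsets (p ∷ ps) = trans (length-++ (encodeSubset p))
  (cong₂ _+_ (length-encodeSubset p) (length-encodeSubsets ps))

encodeSubset-bit : ∀ {n} (p : Subset n) j → symbolAt (encodeSubset p) (toℕ j) ≡ just (bit (lookup p j))
encodeSubset-bit (b ∷ p) zero    = refl
encodeSubset-bit (b ∷ p) (suc j) = encodeSubset-bit p j

encodeSubset-♯ : ∀ {n} (p : Subset n) → symbolAt (encodeSubset p) n ≡ just ♯
encodeSubset-♯ []      = refl
encodeSubset-♯ (b ∷ p) = encodeSubset-♯ p

encodeSubsets-row : ∀ {n m} (ps : Vec (Subset n) m) i {j} → j < suc n →
  symbolAt (encodeSubsets ps) (toℕ i * suc n + j) ≡ symbolAt (encodeSubset (lookup ps i)) j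
encodeSubsets-row {n} (p ∷ ps) zero {j} j≤n =
  symbolAt-++ˡ (encodeSubset p) _ (subst (j <_) (sym (length-encodeSubset p)) j≤n)
encodeSubsets-row {n} (p ∷ ps) (suc i) {j} j≤n = begin
  symbolAt (encodeSubset p ++ rest) (suc n + toℕ i * suc n + j)
    ≡⟨ cong (symbolAt (encodeSubset p ++ rest)) (trans (+-assoc (suc n) _ j)
         (cong (_+ (toℕ i * suc n + j)) (sym (length-encodeSubset p)))) ⟩
  symbolAt (encodeSubset p ++ rest) (length (encodeSubset p) + (toℕ i * suc n + j))
    ≡⟨ symbolAt-++ʳ (encodeSubset p) rest _ ⟩
  symbolAt rest (toℕ i * suc n + j)
    ≡⟨ encodeSubsets-row ps i j≤n ⟩
  symbolAt (encodeSubset (lookup ps i)) j ∎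
  where
  open ≡-Reasoning
  rest = encodeSubsets ps

One : List Symbol → ℕ → ℕ → ℕ → Set
One w n i j = symbolAt w (i * suc n + j) ≡ just 𝟏

-- Membership in terms of single symbols, the language that formulas speak. The 2 + n + k blocks are
-- the owner row, the n rows of the matrix, the start row and the k targets, each of length n + 1
-- with its closing ♯.
record Conditions (w : List Symbol) (n k : ℕ) (v₀ : Fin n) : Set where
  field
    len    : length w ≡ (2 + n + k) * suc n
    ends   : ∀ (i : Fin (2 + n + k)) → symbolAt w (toℕ i * suc n + n) ≡ just ♯
    bits   : ∀ (i : Fin (2 + n + k)) (j : Fin n) → symbolAt w (toℕ i * suc n + toℕ j) ≢ just ♯
    eve    : ∀ (j : Fin n) → One w n 0 (toℕ j)
    total  : ∀ (u : Fin n) → ∃[ v ] One w n (1 + toℕ u) (toℕ {n} v)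
    start  : One w n (1 + n) (toℕ v₀)
    start! : ∀ v → One w n (1 + n) (toℕ v) → v ≡ v₀
    sizes  : ∀ (i : Fin k) → HasSize2 {n} (λ x → One w n (2 + n + toℕ i) (toℕ x))
    visits : Tours.Visits {n} {k} (λ u v → One w n (1 + toℕ u) (toℕ v)) v₀
                          (λ i x → One w n (2 + n + toℕ i) (toℕ x))

bit-one : ∀ {n} (p : Subset n) {j c} → c ≡ just (bit (lookup p j)) → c ≡ just 𝟏 → j ∈ p
bit-one p {j} e e′ with lookup p j in eq
... | true  = lookup⇒[]= j p eq
... | false = contradiction (trans (sym e) e′) λ ()

one-bit : ∀ {n} {p : Subset n} {j c} → c ≡ just (bit (lookup p j)) → j ∈ p → c ≡ just 𝟏
one-bit e j∈p = trans e (cong (just ∘ bit) ([]=⇒lookup j∈p))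

module _ (G : Instance) where
  open Instance G

  blocks : Vec (Subset size) (1 + (size + (1 + k)))
  blocks = V○ ∷ (E Vec.++ (⁅ v₀ ⁆ ∷ F))

  encode-blocks : encode G ≡ encodeSubsets blocks
  encode-blocks = cong (encodeSubset V○ ++_) (sym (trans
    (cong (concatMap encodeSubset) (toList-++ E (⁅ v₀ ⁆ ∷ F)))
    (concatMap-++ encodeSubset (toList E) (toList (⁅ v₀ ⁆ ∷ F)))))

  rows : 1 + (size + (1 + k)) ≡ 2 + size + k
  rows = cong suc (+-suc size k)

  private
    w = encode G
    n = size

  encode-row : ∀ i {j} → j < suc n →
               symbolAt w (toℕ i * suc n + j) ≡ symbolAt (encodeSubset (lookup blocks i)) j
  encode-row i {j} j≤n = trans (cong (λ w → symbolAt w (toℕ i * suc n + j)) encode-blocks) (encodeSubsets-row blocks i j≤n)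

  encode-bit : ∀ i p → lookup blocks i ≡ p → ∀ {m} → toℕ i ≡ m → ∀ j →
               symbolAt w (m * suc n + toℕ j) ≡ just (bit (lookup p j))
  encode-bit i p refl refl j = trans (encode-row i (m<n⇒m<1+n (toℕ<n j))) (encodeSubset-bit p j)

  row-V○ : ∀ j → symbolAt w (0 * suc n + toℕ j) ≡ just (bit (lookup V○ j))
  row-V○ = encode-bit zero V○ refl refl

  row-E : ∀ u j → symbolAt w ((1 + toℕ u) * suc n + toℕ j) ≡ just (bit (lookup (lookup E u) j))
  row-E u = encode-bit (suc (u ↑ˡ (1 + k))) (lookup E u) (lookup-++ˡ E _ u) (cong suc (toℕ-↑ˡ u (1 + k)))

  row-v₀ : ∀ j → symbolAt w ((1 + n) * suc n + toℕ j) ≡ just (bit (lookup ⁅ v₀ ⁆ j))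
  row-v₀ = encode-bit (suc (n ↑ʳ zero)) ⁅ v₀ ⁆ (lookup-++ʳ E _ zero)
    (cong suc (trans (toℕ-↑ʳ n zero) (+-identityʳ n)))

  row-F : ∀ i j → symbolAt w ((2 + n + toℕ i) * suc n + toℕ j) ≡ just (bit (lookup (lookup F i) j))
  row-F i = encode-bit (suc (n ↑ʳ suc i)) (lookup F i) (lookup-++ʳ E _ (suc i))
    (cong suc (trans (toℕ-↑ʳ n (suc i)) (+-suc n (toℕ i))))

  edge⁺ : ∀ {u v} → Edge u v → One w n (1 + toℕ u) (toℕ v)
  edge⁺ {u} {v} = one-bit (row-E u v)

  edge⁻ : ∀ {u v} → One w n (1 + toℕ u) (toℕ v) → Edge u v
  edge⁻ {u} {v} = bit-one (lookup E u) (row-E u v)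

  target⁺ : ∀ {i x} → x ∈ lookup F i → One w n (2 + n + toℕ i) (toℕ x)
  target⁺ {i} {x} = one-bit (row-F i x)

  target⁻ : ∀ {i x} → One w n (2 + n + toℕ i) (toℕ x) → x ∈ lookup F i
  target⁻ {i} {x} = bit-one (lookup F i) (row-F i x)

  encode⇒conditions : OnePlayer arena → (∀ i → ∣ lookup F i ∣ ≡ 2) →
                      EveWins arena (GenReach arena F) v₀ → Conditions (encode G) size k v₀
  encode⇒conditions one-player sizes wins = record
    { len    = trans (trans (cong length encode-blocks) (length-encodeSubsets blocks))
                     (cong (_* suc n) rows)
    ; ends   = λ i → on-block i λ i′ e → trans (cong (λ m → symbolAt w (m * suc n + n)) e)
                       (trans (encode-row i′ ≤-refl) (encodeSubset-♯ (lookup blocks i′)))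
    ; bits   = λ i j → on-block i λ i′ e e♯ → bit≢♯ _ (just-injective (trans
                 (sym (encode-bit i′ _ refl (sym e) j)) e♯))
    ; eve    = λ j → one-bit (row-V○ j) (all-eve j)
    ; total  = λ u → let v , uv = Arena.total arena u in v , edge⁺ uv
    ; start  = one-bit (row-v₀ v₀) (x∈⁅x⁆ v₀)
    ; start! = λ v o → x∈⁅y⁆⇒x≡y v₀ (bit-one ⁅ v₀ ⁆ (row-v₀ v) o)
    ; sizes  = λ i → let x , y , x≢y , fx , fy , only = ∣p∣≡2⇒size2 (sizes i) in
                 x , y , x≢y , target⁺ fx , target⁺ fy , λ z → only z ∘ target⁻
    ; visits = let π , π0 , edges , hits = eveWins⇒visits G one-player wins in
               π , π0 , edge⁺ ∘ edges , λ i → proj₁ (hits i) , target⁺ (proj₂ (hits i))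
    }
    where
    on-block : ∀ {P : Set} (i : Fin (2 + n + k)) →
               (∀ (i′ : Fin (1 + (n + (1 + k)))) → toℕ i ≡ toℕ i′ → P) → P
    on-block i f = f (Fin.cast (sym rows) i) (sym (Fin.toℕ-cast (sym rows) i))
    bit≢♯ : ∀ b → bit b ≢ ♯
    bit≢♯ true  ()
    bit≢♯ false ()
    all-eve : ∀ j → j ∈ V○
    all-eve j with j ∈? V○
    ... | yes j∈ = j∈
    ... | no j∉  = ⊥-elim (one-player (j , x∉p⇒x∈∁p j∉))

  conditions⇒wins : Conditions (encode G) size k v₀ →
    OnePlayer arena × (∀ i → ∣ lookup F i ∣ ≡ 2) × EveWins arena (GenReach arena F) v₀
  conditions⇒wins c = one-player
    , (λ i → let x , y , x≢y , fx , fy , only = sizes i in size2⇒∣p∣≡2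
         (x , y , x≢y , target⁻ fx , target⁻ fy , λ z → only z ∘ target⁺))
    , visits⇒eveWins G one-player (let π , π0 , edges , hits = visits in
         π , π0 , edge⁻ ∘ edges , λ i → proj₁ (hits i) , target⁻ (proj₂ (hits i)))
    where
    open Conditions c using (eve; sizes; visits)
    one-player : OnePlayer arena
    one-player (v , v∈) = x∈∁p⇒x∉p v∈ (bit-one V○ (row-V○ v) (eve v))

-- Decoding a word into a game

module _ {w : List Symbol} {n k : ℕ} {v₀ : Fin n} (c : Conditions w n k v₀) where
  open Conditions c

  block : ℕ → Subset n
  block i = tabulate λ j → has 𝟏 (symbolAt w (i * suc n + toℕ j))

  ∈block : ∀ {i j} → One w n i (toℕ j) → j ∈ block i
  ∈block {i} {j} o = lookup⇒[]= j _ (trans (lookup∘tabulate _ j) (cong (has 𝟏) o))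

  block∋ : ∀ {i j} → j ∈ block i → One w n i (toℕ j)
  block∋ {i} {j} j∈ = reflected (has-reflects 𝟏 _) (trans (sym (lookup∘tabulate _ j)) ([]=⇒lookup j∈))

  decode : Instance
  decode = record
    { arena = record
      { size  = n
      ; V○    = block 0
      ; E     = tabulate λ u → block (1 + toℕ u)
      ; total = λ u → let v , uv = total u in
                v , subst (v ∈_) (sym (lookup∘tabulate _ u)) (∈block {1 + toℕ u} uv)
      }
    ; k     = k
    ; F     = tabulate λ i → block (2 + n + toℕ i)
    ; v₀    = v₀
    }

  start-block : ⁅ v₀ ⁆ ≡ block (1 + n)
  start-block = ⊆-antisym
    (λ v∈ → subst (_∈ block (1 + n)) (sym (x∈⁅y⁆⇒x≡y v₀ v∈)) (∈block {1 + n} start))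
    (λ {v} v∈ → subst (_∈ ⁅ v₀ ⁆) (sym (start! v (block∋ {1 + n} v∈))) (x∈⁅x⁆ v₀))

  decode-blocks : ∀ i → lookup (blocks decode) i ≡ block (toℕ i)
  decode-blocks zero    = refl
  decode-blocks (suc i) with splitAt n i in e
  ... | inj₁ u with refl ← splitAt⁻¹-↑ˡ e = trans (lookup-++ˡ (Instance.E decode) _ u)
    (trans (lookup∘tabulate _ u) (cong (block ∘ suc) (sym (toℕ-↑ˡ u (1 + k)))))
  ... | inj₂ i′ with refl ← splitAt⁻¹-↑ʳ {n} e =
    trans (lookup-++ʳ (Instance.E decode) rest i′)
          (trans (lookup-rest i′) (cong (block ∘ suc) (sym (toℕ-↑ʳ n i′))))
    where
    rest = ⁅ v₀ ⁆ ∷ Instance.F decode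
    lookup-rest : ∀ i → lookup rest i ≡ block (suc (n + toℕ i))
    lookup-rest zero    = trans start-block (cong (block ∘ suc) (sym (+-identityʳ n)))
    lookup-rest (suc i) = trans (lookup∘tabulate (λ i → block (2 + n + toℕ i)) i)
                                (cong (block ∘ suc) (sym (+-suc n (toℕ i))))

  -- The words have equal length and are compared symbol by symbol; division of a position by the
  -- block length gives its block and its place there.
  decode-encode : w ≡ encode decode
  decode-encode = symbolAt-ext w (encode decode) same-length λ p p<w →
    subst (λ p → symbolAt w p ≡ symbolAt (encode decode) p)
      (trans (+-comm (p / suc n * suc n) _) (sym (m≡m%n+[m/n]*n p (suc n))))
      (entries (p / suc n) (p % suc n)
        (m<n*o⇒m/o<n {p} {2 + n + k} {suc n} (subst (p <_) len p<w)) (m%n<n p (suc n)))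
    where
    same-length : length w ≡ length (encode decode)
    same-length = trans len (sym (trans
      (trans (cong length (encode-blocks decode)) (length-encodeSubsets (blocks decode)))
      (cong (_* suc n) (rows decode))))
    in-range : ∀ i j → i < 2 + n + k → j < suc n → i * suc n + j < length w
    in-range i j i<m j≤n = subst (i * suc n + j <_) (sym len)
      (<-≤-trans (+-monoʳ-< (i * suc n) j≤n)
        (≤-trans (≤-reflexive (+-comm (i * suc n) (suc n))) (*-monoˡ-≤ (suc n) i<m)))
    -- Inside the word and with ♯ excluded, a symbol is determined by whether it is 𝟏.
    only-bits : ∀ {c} → (∃[ s ] c ≡ just s) → c ≢ just ♯ → c ≡ just (bit (has 𝟏 c))
    only-bits (𝟎 , refl) _  = refl
    only-bits (𝟏 , refl) _  = refl
    only-bits (♯ , refl) c≢ = contradiction refl c≢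
    entries : ∀ i j → i < 2 + n + k → j < suc n →
              symbolAt w (i * suc n + j) ≡ symbolAt (encode decode) (i * suc n + j)
    entries i j i<m j≤n = begin
      symbolAt w (i * suc n + j)
        ≡⟨ in-block (m≤n⇒m<n∨m≡n (s≤s⁻¹ j≤n)) ⟩
      symbolAt (encodeSubset (block i)) j
        ≡⟨ cong (λ p → symbolAt (encodeSubset p) j) (trans (decode-blocks i′) (cong block i′≡i)) ⟨
      symbolAt (encodeSubset (lookup (blocks decode) i′)) j
        ≡⟨ encode-row decode i′ j≤n ⟨
      symbolAt (encode decode) (toℕ i′ * suc n + j)
        ≡⟨ cong (λ i → symbolAt (encode decode) (i * suc n + j)) i′≡i ⟩
      symbolAt (encode decode) (i * suc n + j) ∎
      where
      open ≡-Reasoning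
      i′ : Fin (1 + (n + (1 + k)))
      i′ = fromℕ< (subst (i <_) (sym (rows decode)) i<m)
      i′≡i : toℕ i′ ≡ i
      i′≡i = toℕ-fromℕ< _
      in-block : j < n ⊎ j ≡ n → symbolAt w (i * suc n + j) ≡ symbolAt (encodeSubset (block i)) j
      in-block (inj₂ refl) = trans
        (subst (λ i → symbolAt w (i * suc n + n) ≡ just ♯) (toℕ-fromℕ< i<m) (ends (fromℕ< i<m)))
        (sym (encodeSubset-♯ (block i)))
      in-block (inj₁ j<n) = subst
        (λ j → symbolAt w (i * suc n + j) ≡ symbolAt (encodeSubset (block i)) j) (toℕ-fromℕ< j<n)
        (trans (only-bits (symbolAt-just w (in-range i _ i<m (m<n⇒m<1+n (toℕ<n j′)))) not♯)
          (trans (cong (just ∘ bit) (sym (lookup∘tabulate _ j′))) (sym (encodeSubset-bit (block i) j′))))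
        where
        j′ = fromℕ< j<n
        not♯ : symbolAt w (i * suc n + toℕ j′) ≢ just ♯
        not♯ = subst (λ i → symbolAt w (i * suc n + toℕ j′) ≢ just ♯) (toℕ-fromℕ< i<m)
                     (bits (fromℕ< i<m) j′)

  conditions⇒game : OnePlayerGenReachSizeTwo w
  conditions⇒game = decode , decode-encode ,
    conditions⇒wins decode (subst (λ w → Conditions w n k v₀) decode-encode c)

game⇒conditions : ∀ {w} → OnePlayerGenReachSizeTwo w → ∃[ n ] ∃[ k ] ∃[ v₀ ] Conditions w n k v₀
game⇒conditions (G , refl , one-player , sizes , wins) =
  _ , _ , _ , encode⇒conditions G one-player sizes wins

-- The formula

infixr 2 _⇛_
infixr 3 _∥_
infix 5 _≈_

_≈_ : Term → Term → Formula
t ≈ u = t ≼ u & u ≼ t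

_∥_ _⇛_ : Formula → Formula → Formula
φ ∥ ψ = ∼ (∼ φ & ∼ ψ)
φ ⇛ ψ = ∼ (φ & ∼ ψ)

all : Term → Formula → Formula
all t φ = ∼ ex t (∼ φ)

-- The properties that formulas express

reflects-map : ∀ {P Q : Set} {b} → (P → Q) → (Q → P) → Reflects P b → Reflects Q b
reflects-map f g (ofʸ p)  = ofʸ (f p)
reflects-map f g (ofⁿ ¬p) = ofⁿ (¬p ∘ g)

module _ {P Q : Set} where

  ∥-reflects : ∀ {a b} → Reflects P a → Reflects Q b → Reflects (P ⊎ Q) (not (not a ∧ not b))
  ∥-reflects (ofʸ p)  _        = ofʸ (inj₁ p)
  ∥-reflects (ofⁿ ¬p) (ofʸ q)  = ofʸ (inj₂ q)
  ∥-reflects (ofⁿ ¬p) (ofⁿ ¬q) = ofⁿ [ ¬p , ¬q ]′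

  ⇛-reflects : ∀ {a b} → Reflects P a → Reflects Q b → Reflects (P → Q) (not (a ∧ not b))
  ⇛-reflects (ofⁿ ¬p) _        = ofʸ (⊥-elim ∘ ¬p)
  ⇛-reflects (ofʸ p)  (ofʸ q)  = ofʸ (const q)
  ⇛-reflects (ofʸ p)  (ofⁿ ¬q) = ofⁿ (λ f → ¬q (f p))

any-reflects : ∀ {b} {P : Fin b → Set} {f} → (∀ x → Reflects (P x) (f (toℕ x))) →
               Reflects (∃[ x ] P x) (any< b f)
any-reflects {b} {P} {f} r with any< b f in e
... | true  = ofʸ (found b ≤-refl e)
  where
  found : ∀ k → k ≤ b → any< k f ≡ true → ∃[ x ] P x
  found (suc k) k<b e with f k in fk
  ... | false = found k (<⇒≤ k<b) e
  ... | true  = fromℕ< k<b , reflected (r _) (trans (cong f (toℕ-fromℕ< k<b)) fk)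
... | false = ofⁿ λ (x , p) → contradiction
  (trans (sym e) (finds b (toℕ x) (toℕ<n x) (reflects-true (r x) p))) λ ()
  where
  finds : ∀ k i → i < k → f i ≡ true → any< k f ≡ true
  finds (suc k) i (s≤s i≤k) fi with m≤n⇒m<n∨m≡n i≤k
  ... | inj₂ refl rewrite fi = refl
  ... | inj₁ i<k with f k
  ...   | true  = refl
  ...   | false = finds k i i<k fi

≈-reflects : ∀ {b} t u n {ν κ} {x y : Fin b} → val t ν ≡ toℕ x → val u ν ≡ toℕ y →
             Reflects (x ≡ y) (⟦ t ≈ u ⟧ n ν κ)
≈-reflects t u n {ν} e e′ = reflects-map
  (λ (p , q) → Fin.toℕ-injective (trans (sym e) (trans (≤-antisym p q) e′)))
  (λ { refl → ≤-reflexive (trans e (sym e′)) , ≤-reflexive (trans e′ (sym e)) })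
  (≤ᵇ-reflects-≤ (val t ν) (val u ν) ×-reflects ≤ᵇ-reflects-≤ (val u ν) (val t ν))

ex-reflects : ∀ {b} l ν κ t φ {P : Fin b → Set} → val t ν ≡ b →
  (∀ a → Reflects (P a) (⟦ φ ⟧ (suc l) (upd ν l (toℕ a)) κ)) →
  Reflects (∃[ a ] P a) (⟦ ex t φ ⟧ l ν κ)
ex-reflects l ν κ t φ refl r = any-reflects r

all-reflects : ∀ {b} l ν κ t φ {P : Fin b → Set} → val t ν ≡ b →
  (∀ a → Reflects (P a) (⟦ φ ⟧ (suc l) (upd ν l (toℕ a)) κ)) →
  Reflects (∀ a → P a) (⟦ all t φ ⟧ l ν κ)
all-reflects l ν κ t φ val≡ r = reflects-map
  (λ ¬∃¬ a → decidable-stable (_ because r a) λ ¬p → ¬∃¬ (a , ¬p)) (λ p (a , ¬p) → ¬p (p a))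
  (¬-reflects (ex-reflects l ν κ t (∼ φ) val≡ (¬-reflects ∘ r)))

-- Tape 0 holds the input and the positions of tapes 1 to 4 are its length,
-- size, k and v₀; x, y, … below are tapes and l is the first free one.
𝑛 𝑘 : Term
𝑛 = var 2
𝑘 = var 3

oneAt : Term → Term → Formula
oneAt i j = at 0 𝟏 (i ⊗ (one ⊕ 𝑛) ⊕ j)

targetF : ℕ → ℕ → Formula
targetF i x = oneAt (one ⊕ one ⊕ 𝑛 ⊕ var i) (var x)

edgeF : ℕ → ℕ → ℕ → Formula
edgeF _ u v = oneAt (one ⊕ var u) (var v)

-- Tape `l` carries the set of vertices reached from `s`, `1 + l` the round, `2 + l` the candidate
-- and `3 + l` its predecessor, so `R` starts at level `4 + l`.
starF : (ℕ → ℕ → ℕ → Formula) → ℕ → ℕ → ℕ → Formula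
starF R l s t = fix 𝑛
  (var (2 + l) ≈ var s ∥ ex 𝑛 (at l 𝟏 (var (3 + l)) & R (4 + l) (3 + l) (2 + l)))
  (at l 𝟏 (var t))

compatibleF : ℕ → ℕ → ℕ → Formula
compatibleF l u w =
  starF edgeF l 4 u & starF edgeF l 4 w & (starF edgeF l u w ∥ starF edgeF l w u)

pairF : ℕ → ℕ → ℕ → Formula
pairF l x y = ∼ (var x ≈ var y) & ex 𝑘 (targetF l x & targetF l y)

forceF : ℕ → ℕ → ℕ → Formula
forceF l u v = ex 𝑛 (∼ compatibleF (1 + l) u l & pairF (1 + l) l v)

badF : ℕ → ℕ → Formula
badF l x = ex 𝑛 (starF forceF (1 + l) x l & ∼ compatibleF (1 + l) l x)

rowsT cellT : Term
rowsT = one ⊕ one ⊕ 𝑛 ⊕ 𝑘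
cellT = var 5 ⊗ (one ⊕ 𝑛)

onlyF winF : Formula
onlyF = targetF 5 8 ⇛ var 8 ≈ var 6 ∥ var 8 ≈ var 7
winF  = pairF 7 5 6 ⇛ ∼ (badF 7 5 & badF 7 6)

bodyF : Formula
bodyF =
  var 1 ≈ rowsT ⊗ (one ⊕ 𝑛) &
  all rowsT (at 0 ♯ (cellT ⊕ 𝑛)) &
  all rowsT (all 𝑛 (∼ at 0 ♯ (cellT ⊕ var 6))) &
  all 𝑛 (at 0 𝟏 (var 5)) &
  all 𝑛 (ex 𝑛 (edgeF 7 5 6)) &
  oneAt (one ⊕ 𝑛) (var 4) &
  all 𝑛 (oneAt (one ⊕ 𝑛) (var 5) ⇛ var 5 ≈ var 4) &
  all 𝑘 (ex 𝑛 (ex 𝑛 (∼ (var 6 ≈ var 7) & targetF 5 6 & targetF 5 7 & all 𝑛 onlyF))) &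
  all 𝑛 (all 𝑛 winF)

-- The input does not state n and k, so they are searched for. The input length bounds the search
-- because it equals (2 + n + k)(n + 1), which exceeds both.
gameF : Formula
gameF = ex (var 1) (ex (var 1) (ex 𝑛 bodyF))

module Semantics (w : List Symbol) (n k : ℕ) (v₀ : Fin n) where

  Edge′ : Fin n → Fin n → Set
  Edge′ u v = One w n (1 + toℕ u) (toℕ v)

  Target : Fin k → Fin n → Set
  Target i x = One w n (2 + n + toℕ i) (toℕ x)

  open Tours {n} {k} Edge′ v₀ Target

  record Env (l : ℕ) (ν : ℕ → ℕ) (κ : ℕ → ℕ → Content) : Set where
    field
      5≤l   : 5 ≤ l
      input : κ 0 ≡ symbolAt w
      is-0  : ν 0 ≡ 0
      is-n  : ν 2 ≡ n
      is-k  : ν 3 ≡ k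
      is-v₀ : ν 4 ≡ toℕ v₀

  open Env

  Is : ∀ {m} → ℕ → (ℕ → ℕ) → ℕ → Fin m → Set
  Is l ν x a = x < l × ν x ≡ toℕ a

  skip : ∀ {m l ν x} {a : Fin m} y → Is l ν x a → Is (suc l) (upd ν l y) x a
  skip {ν = ν} y (x<l , e) = m<n⇒m<1+n x<l , trans (upd-other ν y (<⇒≢ x<l ∘ sym)) e

  this : ∀ {m l ν} (a : Fin m) → Is (suc l) (upd ν l (toℕ a)) l a
  this {l = l} {ν} a = ≤-refl , upd-same ν l _

  extend : ∀ {l ν κ} y → Env l ν κ → Env (suc l) (upd ν l y) κ
  extend {l} {ν} y env = record
    { 5≤l   = m≤n⇒m≤1+n (5≤l env)
    ; input = input env
    ; is-0  = trans (low 0 (s≤s z≤n)) (is-0 env)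
    ; is-n  = trans (low 2 (s≤s (s≤s (s≤s z≤n)))) (is-n env)
    ; is-k  = trans (low 3 (s≤s (s≤s (s≤s (s≤s z≤n))))) (is-k env)
    ; is-v₀ = trans (low 4 ≤-refl) (is-v₀ env)
    }
    where
    low : ∀ i → i < 5 → upd ν l y i ≡ ν i
    low i i<5 = upd-other ν y (<⇒≢ (<-≤-trans i<5 (5≤l env)) ∘ sym)

  with-row : ∀ {l m ν κ} A → 0 < m → Env l ν κ → Env l ν (upd κ m A)
  with-row {κ = κ} A 0<m env = record
    { 5≤l = 5≤l env ; is-0 = is-0 env ; is-n = is-n env ; is-k = is-k env ; is-v₀ = is-v₀ env
    ; input = trans (upd-other κ A (<⇒≢ 0<m ∘ sym)) (input env) }

  0<l : ∀ {l ν κ} → Env l ν κ → 0 < l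
  0<l env = <-≤-trans (s≤s z≤n) (5≤l env)

  oneAt-reflects : ∀ {l ν κ} i j a b → Env l ν κ → val i ν ≡ a → val j ν ≡ b →
                   Reflects (One w n a b) (⟦ oneAt i j ⟧ l ν κ)
  oneAt-reflects {ν = ν} {κ} i j _ _ env refl refl =
    subst (Reflects _) (cong₂ (λ f p → has 𝟏 (f p)) (sym (input env)) (sym place)) (has-reflects 𝟏 _)
    where
    place : ν 0 + (val i ν * suc (ν 2) + val j ν) ≡ val i ν * suc n + val j ν
    place = cong₂ _+_ (is-0 env) (cong (λ m → val i ν * suc m + val j ν) (is-n env))

  Reflected : (ℕ → ℕ → ℕ → Formula) → (Fin n → Fin n → Set) → Set
  Reflected F R = ∀ {l ν κ x y a b} → Env l ν κ → Is l ν x a → Is l ν y b →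
                  Reflects (R a b) (⟦ F l x y ⟧ l ν κ)

  edgeF-reflects : Reflected edgeF Edge′
  edgeF-reflects {x = x} {y} env (_ , x≡) (_ , y≡) =
    oneAt-reflects (one ⊕ var x) (var y) _ _ env (cong suc x≡) y≡

  targetF-reflects : ∀ {l ν κ i x j a} → Env l ν κ → Is l ν i j → Is l ν x a →
                     Reflects (Target j a) (⟦ targetF i x ⟧ l ν κ)
  targetF-reflects {i = i} {x} env (_ , i≡) (_ , x≡) =
    oneAt-reflects (one ⊕ one ⊕ 𝑛 ⊕ var i) (var x) _ _ env (cong₂ (λ m i → 2 + m + i) (is-n env) i≡) x≡

  -- `Reflected` covers all environments, in particular those in which the round and the partial set
  -- vary. The truth of `F` is thus the same throughout the iteration, as `Closure` requires of its
  -- step.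
  starF-reflects : ∀ {F R} → Reflected F R → Reflected (starF F) (Star R)
  starF-reflects {F} {R} reflects {l} {ν} {κ} {x} {y} {a} {b} env x∶a y∶b =
    subst (Reflects (Star R a b)) (sym value) (fixpoint-reflects step-reflects b)
    where
    step′ : ℕ → (ℕ → Content) → ℕ → Bool
    step′ r A z = ⟦ var (2 + l) ≈ var x ∥ ex 𝑛 (at l 𝟏 (var (3 + l)) & F (4 + l) (3 + l) (2 + l)) ⟧
      (3 + l) (upd (upd (upd ν l 0) (1 + l) r) (2 + l) z) (upd κ l A)
    open Closure R a step′
    step-reflects : ∀ r A z → Reflects (Due A z) (step′ r A (toℕ z))
    step-reflects r A z = ∥-reflects
      (≈-reflects (var (2 + l)) (var x) (3 + l) {ν′} {upd κ l A} (proj₂ z∶)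
        (proj₂ (skip {l = 2 + l} {ν₂} (toℕ z) (skip {l = 1 + l} {ν₁} r (skip {ν = ν} 0 x∶a)))))
      (ex-reflects (3 + l) ν′ (upd κ l A) 𝑛 (at l 𝟏 (var (3 + l)) & F (4 + l) (3 + l) (2 + l)) (is-n env′) λ c →
        subst (Reflects (Marked A c)) (cong (has 𝟏) (sym (marked c))) (has-reflects 𝟏 _)
        ×-reflects reflects (extend {ν = ν′} (toℕ c) env′) (this {ν = ν′} c) (skip {ν = ν′} (toℕ c) z∶))
      where
      ν₁ = upd ν l 0
      ν₂ = upd ν₁ (1 + l) r
      ν′ = upd ν₂ (2 + l) (toℕ z)
      z∶ : Is (3 + l) ν′ (2 + l) z
      z∶ = this {l = 2 + l} {ν₂} z
      env′ : Env (3 + l) ν′ (upd κ l A)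
      env′ = with-row A (0<l env) (extend {2 + l} {ν₂} (toℕ z) (extend {1 + l} {ν₁} r (extend 0 env)))
      marked : ∀ c → upd κ l A l (upd ν′ (3 + l) (toℕ c) l + upd ν′ (3 + l) (toℕ c) (3 + l)) ≡ A (toℕ c)
      marked c = cong₂ (λ f p → f p) (upd-same κ l A) (cong₂ _+_
        (trans (upd-other ν′ _ (<⇒≢ (m≤n+m (suc l) 2) ∘ sym))
          (trans (upd-other (upd (upd ν l 0) (1 + l) r) _ (<⇒≢ (m≤n+m (suc l) 1) ∘ sym))
            (trans (upd-other (upd ν l 0) r (<⇒≢ (n<1+n l) ∘ sym)) (upd-same ν l 0))))
        (upd-same ν′ (3 + l) _))
    value : ⟦ starF F l x y ⟧ l ν κ ≡ has 𝟏 (fixpoint step-reflects (toℕ b))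
    value = cong (has 𝟏) (trans
      (cong₂ (λ f p → f p) (upd-same κ l _) (cong₂ _+_ (upd-same ν l 0) (proj₂ (skip 0 y∶b))))
      (cong (λ m → rounds step′ m m ∅ (toℕ b)) (is-n env)))

  reach-reflects : Reflected (starF edgeF) (Star Edge′)
  reach-reflects = starF-reflects {edgeF} edgeF-reflects

  compatibleF-reflects : Reflected compatibleF Compatible
  compatibleF-reflects env x∶a y∶b =
    reach-reflects env v₀∶ x∶a ×-reflects reach-reflects env v₀∶ y∶b ×-reflects
    ∥-reflects (reach-reflects env x∶a y∶b) (reach-reflects env y∶b x∶a)
    where v₀∶ = 5≤l env , is-v₀ env

  pairF-reflects : Reflected pairF Pair
  pairF-reflects {l} {ν} {κ} {x} {y} env x∶a y∶b =
    ¬-reflects (≈-reflects (var x) (var y) l {κ = κ} (proj₂ x∶a) (proj₂ y∶b)) ×-reflects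
    ex-reflects l ν κ 𝑘 (targetF l x & targetF l y) (is-k env) λ i →
      targetF-reflects (extend (toℕ i) env) (this i) (skip _ x∶a) ×-reflects
      targetF-reflects (extend (toℕ i) env) (this i) (skip _ y∶b)

  forceF-reflects : Reflected forceF Force
  forceF-reflects {l} {ν} {κ} {x} {y} env x∶a y∶b =
    ex-reflects l ν κ 𝑛 (∼ compatibleF (1 + l) x l & pairF (1 + l) l y) (is-n env) λ c →
      ¬-reflects (compatibleF-reflects (extend (toℕ c) env) (skip _ x∶a) (this c)) ×-reflects
      pairF-reflects (extend (toℕ c) env) (this c) (skip _ y∶b)

  forces-reflects : Reflected (starF forceF) (Star Force)
  forces-reflects = starF-reflects {forceF} forceF-reflects

  badF-reflects : ∀ {l ν κ x a} → Env l ν κ → Is l ν x a → Reflects (Bad a) (⟦ badF l x ⟧ l ν κ)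
  badF-reflects {l} {ν} {κ} {x} env x∶a =
    ex-reflects l ν κ 𝑛 (starF forceF (1 + l) x l & ∼ compatibleF (1 + l) l x) (is-n env) λ c →
      forces-reflects (extend (toℕ c) env) (skip _ x∶a) (this c) ×-reflects
      ¬-reflects (compatibleF-reflects (extend (toℕ c) env) (this c) (skip _ x∶a))

  -- These are the `Conditions` with the infinite path replaced by the criterion, after which all
  -- quantifiers are bounded.
  Spec : Set
  Spec =
    length w ≡ (2 + n + k) * suc n ×
    (∀ (i : Fin (2 + n + k)) → symbolAt w (toℕ i * suc n + n) ≡ just ♯) ×
    (∀ (i : Fin (2 + n + k)) (j : Fin n) → symbolAt w (toℕ i * suc n + toℕ j) ≢ just ♯) ×
    (∀ (j : Fin n) → One w n 0 (toℕ j)) ×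
    (∀ (u : Fin n) → ∃[ v ] Edge′ u v) ×
    One w n (1 + n) (toℕ v₀) ×
    (∀ (v : Fin n) → One w n (1 + n) (toℕ v) → v ≡ v₀) ×
    (∀ i → HasSize2 (Target i)) ×
    Winnable

  places : ℕ → ℕ
  places = upd (upd (upd (positions w) 2 n) 3 k) 4 (toℕ v₀)

  env : Env 5 places (contents w)
  env = record { 5≤l = ≤-refl ; input = refl ; is-0 = refl ; is-n = refl ; is-k = refl ; is-v₀ = refl }

  places² : Fin n → Fin n → ℕ → ℕ
  places² u v = upd (upd places 5 (toℕ u)) 6 (toℕ v)

  env² : ∀ u v → Env 7 (places² u v) (contents w)
  env² u v = extend (toℕ v) (extend (toℕ u) env)

  fst² : ∀ u v → Is 7 (places² u v) 5 u
  fst² u v = m≤n+m 6 1 , refl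

  snd² : ∀ u v → Is 7 (places² u v) 6 v
  snd² u v = ≤-refl , refl

  bodyF-reflects : Reflects Spec (⟦ bodyF ⟧ 5 places (contents w))
  bodyF-reflects = len ×-reflects ends ×-reflects bits ×-reflects eve ×-reflects total ×-reflects
    has-reflects 𝟏 _ ×-reflects start! ×-reflects sizes ×-reflects wins
    where
    κ = contents w
    infixl 8 _▹_
    _▹_ : ∀ {m} → (ℕ → ℕ) → ℕ × Fin m → ℕ → ℕ
    ν ▹ (l , a) = upd ν l (toℕ a)
    len = reflects-map (λ (p , q) → ≤-antisym p q) (λ e → ≤-reflexive e , ≤-reflexive (sym e))
      (≤ᵇ-reflects-≤ (length w) ((2 + n + k) * suc n) ×-reflects
       ≤ᵇ-reflects-≤ ((2 + n + k) * suc n) (length w))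
    ends = all-reflects 5 places κ rowsT (at 0 ♯ (cellT ⊕ 𝑛)) refl
      λ i → has-reflects ♯ (symbolAt w (toℕ i * suc n + n))
    bits = all-reflects 5 places κ rowsT (all 𝑛 (∼ at 0 ♯ (cellT ⊕ var 6))) refl
      λ i → all-reflects 6 (places ▹ (5 , i)) κ 𝑛 (∼ at 0 ♯ (cellT ⊕ var 6)) refl
      λ j → ¬-reflects (has-reflects ♯ (symbolAt w (toℕ i * suc n + toℕ j)))
    eve = all-reflects 5 places κ 𝑛 (at 0 𝟏 (var 5)) refl
      λ j → has-reflects 𝟏 (symbolAt w (toℕ j))
    total = all-reflects 5 places κ 𝑛 (ex 𝑛 (edgeF 7 5 6)) refl
      λ u → ex-reflects 6 (places ▹ (5 , u)) κ 𝑛 (edgeF 7 5 6) refl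
      λ v → edgeF-reflects (env² u v) (fst² u v) (snd² u v)
    start! = all-reflects 5 places κ 𝑛 (oneAt (one ⊕ 𝑛) (var 5) ⇛ var 5 ≈ var 4) refl
      λ v → ⇛-reflects (has-reflects 𝟏 (symbolAt w ((1 + n) * suc n + toℕ v)))
        (≈-reflects (var 5) (var 4) 6 {places ▹ (5 , v)} {κ} refl refl)
    sizes = all-reflects 5 places κ 𝑘 (ex 𝑛 (ex 𝑛 pair)) refl
      λ i → let ν₁ = places ▹ (5 , i) in ex-reflects 6 ν₁ κ 𝑛 (ex 𝑛 pair) refl
      λ x → let ν₂ = ν₁ ▹ (6 , x) in ex-reflects 7 ν₂ κ 𝑛 pair refl
      λ y → let ν₃ = ν₂ ▹ (7 , y) in
        ¬-reflects (≈-reflects (var 6) (var 7) 8 {ν₃} {κ} refl refl) ×-reflects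
        target i x ×-reflects target i y ×-reflects
        all-reflects 8 ν₃ κ 𝑛 onlyF refl λ z → let ν₄ = ν₃ ▹ (8 , z) in
          ⇛-reflects (target i z)
            (∥-reflects (≈-reflects (var 8) (var 6) 9 {ν₄} {κ} refl refl)
                        (≈-reflects (var 8) (var 7) 9 {ν₄} {κ} refl refl))
      where
      pair = ∼ (var 6 ≈ var 7) & targetF 5 6 & targetF 5 7 & all 𝑛 onlyF
      target : ∀ i x → Reflects (Target i x) (has 𝟏 (symbolAt w ((2 + n + toℕ i) * suc n + toℕ x)))
      target i x = has-reflects 𝟏 _
    wins = all-reflects 5 places κ 𝑛 (all 𝑛 winF) refl
      λ x → all-reflects 6 (places ▹ (5 , x)) κ 𝑛 winF refl
      λ y → ⇛-reflects
        (pairF-reflects (env² x y) (fst² x y) (snd² x y))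
        (¬-reflects (badF-reflects (env² x y) (fst² x y) ×-reflects
                     badF-reflects (env² x y) (snd² x y)))

  spec⇒conditions : Spec → Conditions w n k v₀
  spec⇒conditions (len , ends , bits , eve , total , start , start! , sizes , winnable) = record
    { len = len ; ends = ends ; bits = bits ; eve = eve ; total = total ; start = start
    ; start! = start! ; sizes = sizes
    ; visits = winnable⇒visits total sizes
        -- The decision procedures needed to build the path are the evaluations of the formulas
        -- themselves.
        (λ u v → _ because compatibleF-reflects (env² u v) (fst² u v) (snd² u v))
        (λ u v → _ because forces-reflects (env² u v) (fst² u v) (snd² u v))
        winnable
    }

  conditions⇒spec : Conditions w n k v₀ → Spec
  conditions⇒spec c = len , ends , bits , eve , total , start , start! , sizes ,
    visits⇒winnable sizes visits
    where open Conditions c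

gameF-reflects : ∀ w → Reflects (OnePlayerGenReachSizeTwo w) (⟦ gameF ⟧ 2 (positions w) (contents w))
gameF-reflects w = reflects-map
  (λ (n , k , v₀ , spec) → conditions⇒game (Semantics.spec⇒conditions w (toℕ n) (toℕ k) v₀ spec))
  found
  (any-reflects λ n → any-reflects λ k → any-reflects λ v₀ →
    Semantics.bodyF-reflects w (toℕ n) (toℕ k) v₀)
  where
  found : OnePlayerGenReachSizeTwo w →
          ∃[ n ] ∃[ k ] ∃[ v₀ ] Semantics.Spec w (toℕ {length w} n) (toℕ {length w} k) v₀
  found game with game⇒conditions game
  ... | n , k , v₀ , c with fromℕ< n<w | toℕ-fromℕ< n<w | fromℕ< k<w | toℕ-fromℕ< k<w
    where
    rows≤w : 2 + n + k ≤ length w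
    rows≤w = ≤-trans (m≤m*n (2 + n + k) (suc n)) (≤-reflexive (sym (Conditions.len c)))
    n<w : n < length w
    n<w = ≤-trans (s≤s (≤-trans (m≤m+n n k) (n≤1+n (n + k)))) rows≤w
    k<w : k < length w
    k<w = ≤-trans (s≤s (≤-trans (m≤n+m k n) (n≤1+n (n + k)))) rows≤w
  ...   | n′ | refl | k′ | refl = n′ , k′ , v₀ , Semantics.conditions⇒spec w (toℕ n′) (toℕ k′) v₀ c

theorem5 : PTIME OnePlayerGenReachSizeTwo
theorem5 = formula⇒PTIME gameF _ OnePlayerGenReachSizeTwo gameF-reflects
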